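{- Up to permutations of the point set there is exactly one $3$-$(11,5,1)$ covering with $20$ blocks. Its automorphism group has order $240$, so there are exactly $166{,}320$ labelled $3$-$(11,5,1)$ coverings with $20$ blocks on the fixed point set $\{1,\dots,11\}$.
   Context: Let $v \ge k \ge t \ge 1$ and let $X$ be a set of $v$ points. A $t$-$(v,k,1)$ covering is a pair $(X,\mathcal{B})$ where $\mathcal{B}$ is a set of $k$-subsets of $X$ (called blocks) such that every $t$-subset of $X$ is contained in at least one block of $\mathcal{B}$. The symmetric group on $X$ acts on coverings by permuting points; two coverings on $X$ are the same up to permutations of the point set if they lie in the same orbit, and the automorphism group of a covering is its stabiliser in this action, i.e. the group of permutations of $X$ mapping $\mathcal{B}$ to itself. -}

module Defs where

open import Algebra.Bundles using (Group)
open import Data.Fin.Permutation as Perm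
  using (Permutation′; _⟨$⟩ʳ_; _⟨$⟩ˡ_; _∘ₚ_; inverseˡ; inverseʳ)
open import Data.Fin.Properties using (≡-setoid)
open import Data.Fin.Subset using (Subset; _⊆_; ∣_∣)
open import Data.List.Base using (List; length; map)
open import Data.List.Properties using (map-∘; map-cong; map-id)
open import Data.List.Relation.Binary.BagAndSetEquality
  using (_∼[_]_; set; [_]-Equality)
import Data.List.Relation.Binary.BagAndSetEquality as Eq
open import Data.List.Relation.Unary.All using (All)
open import Data.List.Relation.Unary.Any using (Any)
open import Data.List.Relation.Unary.Unique.Propositional using (Unique)
open import Data.Nat.Base using (ℕ)
open import Data.Product.Base using (∃; _,_; proj₁; proj₂)
open import Data.Vec.Base using (lookup; tabulate)
open import Data.Vec.Properties
  using (lookup∘tabulate; tabulate∘lookup; tabulate-cong)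
open import Function.Base using (_on_)
open import Function.Bundles using (Bijection)
open import Level using (0ℓ)
open import Relation.Binary.Bundles using (Setoid)
import Relation.Binary.Construct.On as On
open import Relation.Binary.PropositionalEquality
  using (_≡_; _≗_; refl; sym; trans; cong)

private
  variable
    v k t : ℕ

-- The cardinality of a setoid counts its equivalence classes.

HasCardinality : Setoid 0ℓ 0ℓ → ℕ → Set
HasCardinality S n = Bijection (≡-setoid n) S

-- A finite set of blocks is a duplicate-free list taken up to having the
-- same members, so that `length blocks` is the number of blocks.

record Covering (t v k : ℕ) : Set where
  field
    blocks   : List (Subset v)
    distinct : Unique blocks
    uniform  : All (λ B → ∣ B ∣ ≡ k) blocks
    covers   : ∀ (T : Subset v) → ∣ T ∣ ≡ t → Any (T ⊆_) blocks

open Covering public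

CoveringOfSize : (t v k b : ℕ) → Set
CoveringOfSize t v k b = ∃ λ (C : Covering t v k) → length (blocks C) ≡ b

-- Labelled coverings: equal exactly when they have the same blocks.

coveringSetoid : (t v k b : ℕ) → Setoid 0ℓ 0ℓ
coveringSetoid t v k b = On.setoid {B = CoveringOfSize t v k b}
  ([ set ]-Equality (Subset v)) (λ C → blocks (proj₁ C))

-- The image { π x ∣ x ∈ p }: a point i belongs to it iff π⁻¹ i ∈ p.

image : Permutation′ v → Subset v → Subset v
image π p = tabulate (λ i → lookup p (π ⟨$⟩ˡ i))

images : Permutation′ v → List (Subset v) → List (Subset v)
images π = map (image π)

infix 4 _≅_

_≅_ : Covering t v k → Covering t v k → Set
C ≅ D = ∃ λ π → images π (blocks C) ∼[ set ] blocks D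

record Automorphism (C : Covering t v k) : Set where
  constructor _,_
  field
    perm       : Permutation′ v
    stabilises : images perm (blocks C) ∼[ set ] blocks C

open Automorphism public

private

  image-id : image {v} Perm.id ≗ λ p → p
  image-id = tabulate∘lookup

  image-∘ : (π ρ : Permutation′ v) →
            ∀ p → image (π ∘ₚ ρ) p ≡ image ρ (image π p)
  image-∘ π ρ p = tabulate-cong λ i → sym (lookup∘tabulate _ (ρ ⟨$⟩ˡ i))

  image-flip : (π : Permutation′ v) →
               ∀ p → image (Perm.flip π) (image π p) ≡ p
  image-flip π p = trans
    (tabulate-cong λ i → trans (lookup∘tabulate _ (π ⟨$⟩ʳ i))
                               (cong (lookup p) (inverseˡ π)))
    (tabulate∘lookup p)

  module SetEq {v} = Setoid ([ set ]-Equality (Subset v))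

  images-cong : (π : Permutation′ v) {xs ys : List (Subset v)} →
                xs ∼[ set ] ys → images π xs ∼[ set ] images π ys
  images-cong π = Eq.map-cong λ _ → refl

  images-id : (xs : List (Subset v)) → images Perm.id xs ≡ xs
  images-id xs = trans (map-cong image-id xs) (map-id xs)

  images-∘ : (π ρ : Permutation′ v) (xs : List (Subset v)) →
             images (π ∘ₚ ρ) xs ≡ images ρ (images π xs)
  images-∘ π ρ xs = trans (map-cong (image-∘ π ρ) xs) (map-∘ xs)

  images-flip : (π : Permutation′ v) (xs : List (Subset v)) →
                images (Perm.flip π) (images π xs) ≡ xs
  images-flip π xs =
    trans (sym (map-∘ xs)) (trans (map-cong (image-flip π) xs) (map-id xs))

  flip-cong : (π ρ : Permutation′ v) →
              π Perm.≈ ρ → Perm.flip π Perm.≈ Perm.flip ρ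
  flip-cong π ρ eq i = trans (sym (inverseˡ ρ))
    (cong (ρ ⟨$⟩ˡ_) (trans (sym (eq (π ⟨$⟩ˡ i))) (inverseʳ π)))

-- The product f ∙ g is "f, then g", following _∘ₚ_.

Aut : Covering t v k → Group 0ℓ 0ℓ
Aut C = record
  { Carrier = Automorphism C
  ; _≈_     = Perm._≈_ on perm
  ; _∙_     = λ (π , p) (ρ , q) → π ∘ₚ ρ ,
      SetEq.trans (SetEq.reflexive (images-∘ π ρ (blocks C)))
                  (SetEq.trans (images-cong ρ p) q)
  ; ε       = Perm.id , SetEq.reflexive (images-id (blocks C))
  ; _⁻¹     = λ (π , p) → Perm.flip π ,
      SetEq.trans (images-cong (Perm.flip π) (SetEq.sym p))
                  (SetEq.reflexive (images-flip π (blocks C)))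
  ; isGroup = record
    { isMonoid = record
      { isSemigroup = record
        { isMagma = record
          { isEquivalence = record
            { refl  = λ _ → refl
            ; sym   = λ eq i → sym (eq i)
            ; trans = λ eq₁ eq₂ i → trans (eq₁ i) (eq₂ i)
            }
          ; ∙-cong = λ {_} {_} {(ρ , _)} eq₁ eq₂ i →
              trans (cong (ρ ⟨$⟩ʳ_) (eq₁ i)) (eq₂ _)
          }
        ; assoc = λ _ _ _ _ → refl
        }
      ; identity = (λ _ _ → refl) , (λ _ _ → refl)
      }
    ; inverse = (λ (π , _) _ → inverseʳ π) , (λ (π , _) _ → inverseˡ π)
    ; ⁻¹-cong = λ {(π , _)} {(ρ , _)} eq → flip-cong π ρ eq
    }
  }

HasOrder : Group 0ℓ 0ℓ → ℕ → Set
HasOrder G n = HasCardinality (Group.setoid G) n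

{-# OPTIONS --safe #-}
-- Of the 100 incidences each point takes at least nine, so after a permutation
-- all points other than ∞ have degree nine. Then some y other than ∞ lies with 0
-- on only three blocks, and these partition the remaining nine points. From such
-- a pencil a search branches over the blocks through an uncovered triple. A
-- branch dies when the uncovered triples at some point demand more blocks than
-- its degree admits, or else it reaches a permuted copy of a configuration that
-- has been settled before; a single covering survives. The bound nine is the
-- result of a smaller search of the same kind. The automorphisms are found among
-- the maps that preserve the number of blocks on every pair of points, and the
-- labelled coverings are counted as 11! / 240.

module Submission where

open import Defs
open import Algebra.Bundles using (Group)
import Algebra.Properties.CommutativeMonoid.Sum as CommutativeMonoidSum
open import Data.Bool.Base using (Bool; true; false; if_then_else_; _∧_)
open import Data.Bool.ListAction using (all)
open import Data.Bool.Properties using (∧-idem; T-≡) renaming (_≟_ to _≟ᵇ_)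
open import Data.Empty using (⊥; ⊥-elim)
open import Data.Fin.Base using (Fin; zero; suc; fromℕ; combine; remQuot; punchIn)
open import Data.Fin.Patterns using (0F; 1F)
open import Data.Fin.Permutation as Perm
  using ( Permutation′; permutation; _⟨$⟩ʳ_; _⟨$⟩ˡ_; _∘ₚ_; inverseˡ; inverseʳ; transpose
        ; insert; remove; insert-punchIn; insert-remove )
open import Data.Fin.Properties
  using ( _≟_; any?; all?; remQuot-combine; combine-remQuot
        ; cantor-schröder-bernstein; punchIn-injective )
open import Data.Fin.Subset
  using (Subset; _∈_; _∉_; _⊆_; ∣_∣; _∩_; _∪_; _─_; _-_; ⁅_⁆) renaming (⊥ to ∅)
open import Data.Fin.Subset.Properties
  using ( x∈p∩q⁻; p─q⊆p; x∈p∧x≢y⇒x∈p-y; x∈p⇒∣p-x∣<∣p∣; p⊆q⇒∣p∣≤∣q∣; Empty-unique; ∣⊥∣≡0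
        ; x∈⁅x⁆; x∈⁅y⁆⇒x≡y; ∣⁅x⁆∣≡1; x∈p∪q⁻; x∈p∪q⁺; ∪-identityˡ; drop-∷-⊆; _⊆?_; ⊥⊆ )
open import Data.List.Base as List
  using (List; []; _∷_; _++_; map; length; foldr; filter; allFin; cartesianProductWith; deduplicate)
open import Data.List.Properties as List
  using (map-∘; map-cong; map-id; map-++; length-map)
import Data.List.Membership.DecPropositional as DecMembership
open import Data.List.Membership.Propositional using (find) renaming (_∈_ to _∈ₗ_)
open import Data.List.Membership.Propositional.Properties
  using ( ∈-map⁺; ∈-++⁺ˡ; ∈-++⁺ʳ; ∈-++⁻; ∈-∃++; ∈-filter⁺; ∈-cartesianProductWith⁺
        ; ∈-allFin; ∈-lookup )
open import Data.List.Membership.Propositional.Properties.WithK using (unique∧set⇒bag)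
import Data.List.Membership.Setoid as SetoidMembership
open import Data.List.Relation.Binary.BagAndSetEquality as Eq
  using (_∼[_]_; set; [_]-Equality; ∼bag⇒↭)
open import Data.List.Relation.Binary.Permutation.Propositional
  using (_↭_; ↭-sym; ↭-refl; ↭-trans; prep)
import Data.List.Relation.Binary.Permutation.Propositional.Properties as ↭
open import Data.List.Relation.Unary.All as All using (All; []; _∷_)
import Data.List.Relation.Unary.All.Properties as All
open import Data.List.Relation.Unary.AllPairs using ([]; _∷_)
open import Data.List.Relation.Unary.Any as Any using (Any; here; there)
import Data.List.Relation.Unary.Any.Properties as Any
import Data.List.Relation.Unary.Enumerates.Setoid.Properties as Enumerates
import Data.List.Relation.Unary.Unique.DecPropositional as DecUnique
open import Data.List.Relation.Unary.Unique.DecSetoid.Properties using (deduplicate-!)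
open import Data.List.Relation.Unary.Unique.Propositional using (Unique)
import Data.List.Relation.Unary.Unique.Propositional.Properties as Unique
import Data.List.Relation.Unary.Unique.Setoid as SetoidUnique
open import Data.Maybe.Base using (Maybe; just; nothing)
open import Data.Nat.Base
  using (ℕ; zero; suc; _+_; _*_; _/_; _%_; _!; _≤_; _<ᵇ_; z≤n; s≤s; s≤s⁻¹; NonZero)
open import Data.Nat.DivMod using (_mod_; m<n*o⇒m/o<n)
open import Data.Nat.ListAction using () renaming (sum to sumₗ)
open import Data.Nat.ListAction.Properties using (sum-++; sum-↭)
open import Data.Nat.Properties as ℕ using (_≤?_; module ≤-Reasoning)
open import Data.Nat.Tactic.RingSolver using (solve-∀)
open import Data.Product using (∃; ∃!; _×_; _,_; proj₁; proj₂; uncurry)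
open import Data.Sum.Base using (inj₁; inj₂)
open import Data.Unit.Base using (⊤)
open import Data.Vec.Base as Vec using (Vec; []; _∷_; lookup; tabulate; zipWith)
open import Data.Vec.Properties
  using ( ≡-dec; ∷-injective; lookup⇒[]=; []=⇒lookup; lookup-map; lookup-zipWith; lookup-allFin
        ; lookup∘tabulate; tabulate∘lookup; tabulate-cong )
open import Data.Vec.Relation.Binary.Pointwise.Extensional using (ext; Pointwise-≡⇒≡)
open import Function.Base using (_∘_)
open import Function.Bundles using (Bijection; Equivalence; mk⇔)
open import Level using (0ℓ)
open import Relation.Binary.Bundles using (Setoid; DecSetoid)
open import Relation.Binary.PropositionalEquality
  using ( _≡_; _≢_; _≗_; refl; sym; trans; cong; cong₂; subst; decSetoid; module ≡-Reasoning )
import Relation.Binary.Reasoning.Setoid as SetoidReasoning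
open import Relation.Nullary using (Dec; yes; no; ¬_; does; ¬?; _×-dec_; _→-dec_)
open import Relation.Nullary.Decidable using (map′)

open CommutativeMonoidSum ℕ.+-0-commutativeMonoid
  using (sum; sum-cong-≗; ∑-distrib-+; sum-permute; sum-replicate-zero)

-- Plain counting is too weak. A pair of points needs three blocks for the nine other points, so a
-- point needs 30/4, that is eight, blocks, and eleven such points ask for only 18 blocks. That a
-- degree is at least nine amounts to the fact that eight quadruples do not cover the pairs of ten
-- points. It fixes 99 of the 100 incidences, and the lack of slack is what lets branches die early.
-- The other obstacle is symmetry: without identification of equivalent partial coverings the same
-- configuration would be explored under very many labellings. The trees are therefore certificates.
-- They name the triple to branch over, the overloaded point, and the permutation through which an
-- earlier configuration recurs, so that the checker tests memberships and never looks for an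
-- isomorphism. Its soundness is proved once, for arbitrary degree bounds and for any goal that can
-- be carried back along permutations; the verdicts on the actual trees are evaluations by `refl`.

private variable n m t k : ℕ

-- Sums and cardinalities

true≢false : true ≢ false
true≢false ()

⟦_⟧ : Bool → ℕ
⟦ b ⟧ = if b then 1 else 0

sum-mono : (f g : Fin n → ℕ) → (∀ i → g i ≤ f i) → sum g ≤ sum f
sum-mono {zero}  f g g≤f = z≤n
sum-mono {suc n} f g g≤f =
  ℕ.+-mono-≤ (g≤f zero) (sum-mono (f ∘ suc) (g ∘ suc) (g≤f ∘ suc))

-- The slack at one point is part of the total slack. The additive form avoids truncated
-- subtraction; it serves to split off a single term, such as the diagonal one in a sum of
-- codegrees.
sum-gap : (f g : Fin n → ℕ) → (∀ i → g i ≤ f i) → ∀ i → sum g + f i ≤ sum f + g i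
sum-gap {suc n} f g g≤f zero = begin
  g zero + sum (g ∘ suc) + f zero
    ≤⟨ ℕ.+-monoˡ-≤ (f zero) (ℕ.+-monoʳ-≤ (g zero) (sum-mono _ _ (g≤f ∘ suc))) ⟩
  g zero + sum (f ∘ suc) + f zero   ≡⟨ rearrange (g zero) (sum (f ∘ suc)) (f zero) ⟩
  f zero + sum (f ∘ suc) + g zero   ∎
  where
  open ≤-Reasoning
  rearrange : ∀ a b c → a + b + c ≡ c + b + a
  rearrange = solve-∀
sum-gap {suc n} f g g≤f (suc i) = begin
  g zero + sum (g ∘ suc) + f (suc i)    ≡⟨ ℕ.+-assoc (g zero) _ _ ⟩
  g zero + (sum (g ∘ suc) + f (suc i))
    ≤⟨ ℕ.+-mono-≤ (g≤f zero) (sum-gap (f ∘ suc) (g ∘ suc) (g≤f ∘ suc) i) ⟩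
  f zero + (sum (f ∘ suc) + g (suc i))  ≡⟨ ℕ.+-assoc (f zero) _ _ ⟨
  f zero + sum (f ∘ suc) + g (suc i)    ∎
  where open ≤-Reasoning

-- Once lower bounds exhaust the total, no point has slack left. This is how lower bounds on degrees
-- become exact values.
sum-saturated : (f g : Fin n → ℕ) → (∀ i → g i ≤ f i) → sum f ≤ sum g → ∀ i → f i ≤ g i
sum-saturated f g g≤f Σf≤Σg i = ℕ.+-cancelˡ-≤ (sum g) _ _
  (ℕ.≤-trans (sum-gap f g g≤f i) (ℕ.+-monoˡ-≤ (g i) Σf≤Σg))

∣p∣≡sum : (p : Subset n) → ∣ p ∣ ≡ sum (λ x → ⟦ lookup p x ⟧)
∣p∣≡sum []          = refl
∣p∣≡sum (true ∷ p)  = cong suc (∣p∣≡sum p)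
∣p∣≡sum (false ∷ p) = ∣p∣≡sum p

∣p∣≡∣p∩q∣+∣p─q∣ : (p q : Subset n) → ∣ p ∣ ≡ ∣ p ∩ q ∣ + ∣ p ─ q ∣
∣p∣≡∣p∩q∣+∣p─q∣ []          []          = refl
∣p∣≡∣p∩q∣+∣p─q∣ (true ∷ p)  (true ∷ q)  = cong suc (∣p∣≡∣p∩q∣+∣p─q∣ p q)
∣p∣≡∣p∩q∣+∣p─q∣ (true ∷ p)  (false ∷ q) =
  trans (cong suc (∣p∣≡∣p∩q∣+∣p─q∣ p q)) (sym (ℕ.+-suc _ _))
∣p∣≡∣p∩q∣+∣p─q∣ (false ∷ p) (true ∷ q)  = ∣p∣≡∣p∩q∣+∣p─q∣ p q
∣p∣≡∣p∩q∣+∣p─q∣ (false ∷ p) (false ∷ q) = ∣p∣≡∣p∩q∣+∣p─q∣ p q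

x∈p─q⇒x∉q : (p q : Subset n) {x : Fin n} → x ∈ p ─ q → x ∉ q
x∈p─q⇒x∉q (true ∷ p) (false ∷ q) {zero}  _              ()
x∈p─q⇒x∉q (_ ∷ p)    (_ ∷ q)     {suc x} (Vec.there x∈) (Vec.there x∈q) = x∈p─q⇒x∉q p q x∈ x∈q

lookup-image : (π : Permutation′ n) (p : Subset n) → ∀ x → lookup (image π p) x ≡ lookup p (π ⟨$⟩ˡ x)
lookup-image π p = lookup∘tabulate (λ x → lookup p (π ⟨$⟩ˡ x))

∣image∣ : (π : Permutation′ n) (p : Subset n) → ∣ image π p ∣ ≡ ∣ p ∣
∣image∣ π p = begin
  ∣ image π p ∣                          ≡⟨ ∣p∣≡sum (image π p) ⟩
  sum (λ x → ⟦ lookup (image π p) x ⟧)   ≡⟨ sum-cong-≗ (λ x → cong ⟦_⟧ (lookup-image π p x)) ⟩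
  sum (λ x → ⟦ lookup p (π ⟨$⟩ˡ x) ⟧)    ≡⟨ sum-permute (λ x → ⟦ lookup p x ⟧) (Perm.flip π) ⟨
  sum (λ x → ⟦ lookup p x ⟧)             ≡⟨ ∣p∣≡sum p ⟨
  ∣ p ∣                                  ∎
  where open ≡-Reasoning

image-∘ : (π ρ : Permutation′ n) (p : Subset n) → image (π ∘ₚ ρ) p ≡ image ρ (image π p)
image-∘ π ρ p = tabulate-cong λ i → sym (lookup∘tabulate _ (ρ ⟨$⟩ˡ i))

image-cong : (π ρ : Permutation′ n) → (∀ i → π ⟨$⟩ˡ i ≡ ρ ⟨$⟩ˡ i) → (p : Subset n) → image π p ≡ image ρ p
image-cong π ρ eq p = tabulate-cong λ i → cong (lookup p) (eq i)

image-flip : (π : Permutation′ n) (p : Subset n) → image (Perm.flip π) (image π p) ≡ p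
image-flip π p = begin
  image (Perm.flip π) (image π p)  ≡⟨ image-∘ π (Perm.flip π) p ⟨
  image (π ∘ₚ Perm.flip π) p       ≡⟨ image-cong (π ∘ₚ Perm.flip π) Perm.id (λ _ → inverseˡ π) p ⟩
  image Perm.id p                  ≡⟨ tabulate∘lookup p ⟩
  p                                ∎
  where open ≡-Reasoning

∈-image⁺ : (π : Permutation′ n) {p : Subset n} {x : Fin n} → (π ⟨$⟩ˡ x) ∈ p → x ∈ image π p
∈-image⁺ π {p} {x} x∈ = lookup⇒[]= x _ (trans (lookup-image π p x) ([]=⇒lookup x∈))

-- Degrees

tally : (Subset n → Bool) → List (Subset n) → ℕ
tally f Bs = sumₗ (map (⟦_⟧ ∘ f) Bs)

degree : Fin n → List (Subset n) → ℕ
degree x = tally (λ B → lookup B x)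

codegree : Fin n → Fin n → List (Subset n) → ℕ
codegree x y = tally (λ B → lookup B x ∧ lookup B y)

tally-++ : (f : Subset n → Bool) → ∀ Bs Cs → tally f (Bs ++ Cs) ≡ tally f Bs + tally f Cs
tally-++ f Bs Cs = trans (cong sumₗ (map-++ _ Bs Cs)) (sum-++ (map _ Bs) _)

tally-↭ : (f : Subset n → Bool) → ∀ {Bs Cs} → Bs ↭ Cs → tally f Bs ≡ tally f Cs
tally-↭ f Bs↭Cs = sum-↭ (↭.map⁺ _ Bs↭Cs)

tally-cong : {f g : Subset n → Bool} → f ≗ g → tally f ≗ tally g
tally-cong f≗g Bs = cong sumₗ (map-cong (cong ⟦_⟧ ∘ f≗g) Bs)

tally≤length : (f : Subset n → Bool) → ∀ Bs → tally f Bs ≤ length Bs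
tally≤length f []       = z≤n
tally≤length f (B ∷ Bs) = ℕ.+-mono-≤ (bit≤1 (f B)) (tally≤length f Bs)
  where
  bit≤1 : ∀ b → ⟦ b ⟧ ≤ 1
  bit≤1 true  = s≤s z≤n
  bit≤1 false = z≤n

tally-true : (Bs : List (Subset n)) → tally (λ _ → true) Bs ≡ length Bs
tally-true []       = refl
tally-true (B ∷ Bs) = cong suc (tally-true Bs)

tally-images : (f : Subset n → Bool) (π : Permutation′ n) →
               ∀ Bs → tally f (images π Bs) ≡ tally (f ∘ image π) Bs
tally-images f π Bs = cong sumₗ (sym (map-∘ Bs))

degree-images : (π : Permutation′ n) → ∀ x Bs → degree x (images π Bs) ≡ degree (π ⟨$⟩ˡ x) Bs
degree-images π x Bs =
  trans (tally-images _ π Bs) (tally-cong (λ B → lookup-image π B x) Bs)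

codegree-images : (π : Permutation′ n) → ∀ x y Bs →
                  codegree x y (images π Bs) ≡ codegree (π ⟨$⟩ˡ x) (π ⟨$⟩ˡ y) Bs
codegree-images π x y Bs =
  trans (tally-images _ π Bs)
        (tally-cong (λ B → cong₂ _∧_ (lookup-image π B x) (lookup-image π B y)) Bs)

codegree-diagonal : (x : Fin n) → ∀ Bs → codegree x x Bs ≡ degree x Bs
codegree-diagonal x = tally-cong (λ B → ∧-idem (lookup B x))

Uniform : ℕ → List (Subset n) → Set
Uniform k = All (λ B → ∣ B ∣ ≡ k)

-- Double counting of the incident pairs of a point and a block with property `f`. Degrees and
-- codegrees are the two cases in use.
sum-tally : ∀ {k} (f : Subset n → Bool) {Bs} → Uniform k Bs →
            sum (λ x → tally (λ B → f B ∧ lookup B x) Bs) ≡ k * tally f Bs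
sum-tally {n} {k} f [] = trans (sum-replicate-zero n) (sym (ℕ.*-zeroʳ k))
sum-tally {n} {k} f {B ∷ Bs} (∣B∣≡k ∷ uni) = begin
  sum (λ x → ⟦ f B ∧ lookup B x ⟧ + tally (λ B → f B ∧ lookup B x) Bs)
    ≡⟨ ∑-distrib-+ (λ x → ⟦ f B ∧ lookup B x ⟧) _ ⟩
  sum (λ x → ⟦ f B ∧ lookup B x ⟧) + sum (λ x → tally (λ B → f B ∧ lookup B x) Bs)
    ≡⟨ cong₂ _+_ (first (f B)) (sum-tally f uni) ⟩
  k * ⟦ f B ⟧ + k * tally f Bs
    ≡⟨ ℕ.*-distribˡ-+ k ⟦ f B ⟧ _ ⟨
  k * (⟦ f B ⟧ + tally f Bs)
    ∎
  where
  open ≡-Reasoning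
  first : ∀ b → sum (λ x → ⟦ b ∧ lookup B x ⟧) ≡ k * ⟦ b ⟧
  first true  = trans (sym (∣p∣≡sum B)) (trans ∣B∣≡k (sym (ℕ.*-identityʳ k)))
  first false = trans (sum-replicate-zero n) (sym (ℕ.*-zeroʳ k))

sum-codegree : ∀ {k} (x : Fin n) {Bs} → Uniform k Bs →
               sum (λ y → codegree x y Bs) ≡ k * degree x Bs
sum-codegree x = sum-tally (λ B → lookup B x)

sum-degree : ∀ {k} {Bs : List (Subset n)} → Uniform k Bs →
             sum (λ x → degree x Bs) ≡ k * length Bs
sum-degree {k = k} {Bs} uni = trans (sum-tally (λ _ → true) uni) (cong (k *_) (tally-true Bs))

-- Tables of uncovered triples

Table : ℕ → Set
Table n = Vec (Vec (Subset n) n) n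

row : Table n → Fin n → Fin n → Subset n
row t x y = lookup (lookup t x) y

Triple : Fin n → Fin n → Fin n → Subset n → Set
Triple x y z B = x ∈ B × y ∈ B × z ∈ B

Distinct : Fin n → Fin n → Fin n → Set
Distinct x y z = x ≢ y × x ≢ z × y ≢ z

-- `meets` reads the table as a list of obligations: the remaining blocks `Bs` have to cover what it
-- records and may cover more.
record Residual (t : Table n) (Bs : List (Subset n)) : Set where
  field
    differ : ∀ {x y z} → z ∈ row t x y → Distinct x y z
    meets  : ∀ {x y z} → z ∈ row t x y → Any (Triple x y z) Bs

-- A block through x and y has only three other points.

∣row∣≤3codegree : ∀ {x y : Fin n} → x ≢ y → (W : Subset n) {Bs : List (Subset n)} → Uniform 5 Bs →
                  (∀ {z} → z ∈ W → Distinct x y z × Any (Triple x y z) Bs) →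
                  ∣ W ∣ ≤ codegree x y Bs * 3
∣row∣≤3codegree {n} x≢y W {[]} [] cov =
  ℕ.≤-reflexive (trans (cong ∣_∣ (Empty-unique {p = W} λ (z , z∈W) → Any.¬Any[] (proj₂ (cov z∈W))))
                       (∣⊥∣≡0 n))
∣row∣≤3codegree {n} {x} {y} x≢y W {B ∷ Bs} (∣B∣≡5 ∷ uni) cov
  with lookup B x in x∈B | lookup B y in y∈B
... | true | true = begin
  ∣ W ∣                      ≡⟨ ∣p∣≡∣p∩q∣+∣p─q∣ W B ⟩
  ∣ W ∩ B ∣ + ∣ W ─ B ∣      ≤⟨ ℕ.+-mono-≤ ∣W∩B∣≤3 (∣row∣≤3codegree x≢y (W ─ B) uni rest) ⟩
  3 + codegree x y Bs * 3    ∎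
  where
  open ≤-Reasoning
  W∩B⊆B-x-y : W ∩ B ⊆ B - x - y
  W∩B⊆B-x-y z∈ with x∈p∩q⁻ W B z∈
  ... | z∈W , z∈B with cov z∈W
  ...   | (_ , x≢z , y≢z) , _ = x∈p∧x≢y⇒x∈p-y (x∈p∧x≢y⇒x∈p-y z∈B (x≢z ∘ sym)) (y≢z ∘ sym)
  ∣W∩B∣≤3 : ∣ W ∩ B ∣ ≤ 3
  ∣W∩B∣≤3 = s≤s⁻¹ (s≤s⁻¹ (begin
    2 + ∣ W ∩ B ∣        ≤⟨ ℕ.+-monoʳ-≤ 2 (p⊆q⇒∣p∣≤∣q∣ W∩B⊆B-x-y) ⟩
    2 + ∣ B - x - y ∣    ≤⟨ s≤s (x∈p⇒∣p-x∣<∣p∣ (x∈p∧x≢y⇒x∈p-y (lookup⇒[]= y B y∈B) (x≢y ∘ sym))) ⟩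
    1 + ∣ B - x ∣        ≤⟨ x∈p⇒∣p-x∣<∣p∣ (lookup⇒[]= x B x∈B) ⟩
    ∣ B ∣                ≡⟨ ∣B∣≡5 ⟩
    5                    ∎))
  rest : ∀ {z} → z ∈ W ─ B → Distinct x y z × Any (Triple x y z) Bs
  rest z∈ = let d , meets = cov (p─q⊆p W B z∈) in
    d , Any.tail (λ (_ , _ , z∈B) → x∈p─q⇒x∉q W B z∈ z∈B) meets
... | true | false = ∣row∣≤3codegree x≢y W uni λ z∈W → let d , meets = cov z∈W in
  d , Any.tail (λ (_ , y∈ , _) → true≢false (trans (sym ([]=⇒lookup y∈)) y∈B)) meets
... | false | _ = ∣row∣≤3codegree x≢y W uni λ z∈W → let d , meets = cov z∈W in
  d , Any.tail (λ (x∈ , _ , _) → true≢false (trans (sym ([]=⇒lookup x∈)) x∈B)) meets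

-- A third of `∣ W ∣`, rounded up: the blocks that a pair with row `W` still requires.
need : Subset n → ℕ
need W = (∣ W ∣ + 2) / 3

need≤ : (W : Subset n) → ∀ c → ∣ W ∣ ≤ c * 3 → need W ≤ c
need≤ W c ∣W∣≤3c = s≤s⁻¹ (m<n*o⇒m/o<n (begin-strict
  ∣ W ∣ + 2  ≤⟨ ℕ.+-monoˡ-≤ 2 ∣W∣≤3c ⟩
  c * 3 + 2  <⟨ ℕ.n<1+n _ ⟩
  suc (c * 3 + 2) ≡⟨ cong suc (ℕ.+-comm (c * 3) 2) ⟩
  suc c * 3  ∎))
  where open ≤-Reasoning

module _ {t : Table n} {Bs : List (Subset n)} (uni : Uniform 5 Bs) (res : Residual t Bs) where
  open Residual res

  need≤codegree : ∀ {x y} → x ≢ y → need (row t x y) ≤ codegree x y Bs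
  need≤codegree {x} {y} x≢y = need≤ (row t x y) (codegree x y Bs)
    (∣row∣≤3codegree x≢y (row t x y) uni λ z∈ → differ z∈ , meets z∈)

  need-diagonal : ∀ x → need (row t x x) ≡ 0
  need-diagonal x = cong (λ m → (m + 2) / 3) (trans
    (cong ∣_∣ (Empty-unique {p = row t x x} λ (z , z∈) → proj₁ (differ z∈) refl))
    (∣⊥∣≡0 n))

demand : Table n → Fin n → ℕ
demand t x = Vec.sum (Vec.map need (lookup t x))

Vec-sum-lookup : ∀ {m} (f : Subset n → ℕ) (ws : Vec (Subset n) m) →
                 Vec.sum (Vec.map f ws) ≡ sum (λ y → f (lookup ws y))
Vec-sum-lookup f []       = refl
Vec-sum-lookup f (w ∷ ws) = cong (f w +_) (Vec-sum-lookup f ws)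

-- A block through `x` contains four other points and so counts for four rows of `x`. In the sum
-- over all `y`, which is five times the degree, the diagonal term is the degree itself, and
-- `sum-gap` takes it out.
demand≤4degree : ∀ {t : Table n} {Bs} → Uniform 5 Bs → Residual t Bs →
                 ∀ x → demand t x ≤ 4 * degree x Bs
demand≤4degree {t = t} {Bs} uni res x = ℕ.+-cancelʳ-≤ (degree x Bs) _ _ (begin
  demand t x + degree x Bs
    ≡⟨ cong₂ _+_ (Vec-sum-lookup need (lookup t x)) (sym (codegree-diagonal x Bs)) ⟩
  sum (λ y → need (row t x y)) + codegree x x Bs
    ≤⟨ sum-gap (λ y → codegree x y Bs) (λ y → need (row t x y)) bound x ⟩
  sum (λ y → codegree x y Bs) + need (row t x x)
    ≡⟨ cong₂ _+_ (sum-codegree x uni) (need-diagonal uni res x) ⟩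
  5 * degree x Bs + 0
    ≡⟨ split (degree x Bs) ⟩
  4 * degree x Bs + degree x Bs
    ∎)
  where
  open ≤-Reasoning
  split : ∀ d → 5 * d + 0 ≡ 4 * d + d
  split = solve-∀
  bound : ∀ y → need (row t x y) ≤ codegree x y Bs
  bound y with x ≟ y
  ... | yes refl = ℕ.≤-trans (ℕ.≤-reflexive (need-diagonal uni res x)) z≤n
  ... | no x≢y   = need≤codegree uni res x≢y

_≟ₛ_ : (p q : Subset n) → Dec (p ≡ q)
_≟ₛ_ = ≡-dec _≟ᵇ_

distinct? : (x y z : Fin n) → Dec (Distinct x y z)
distinct? x y z = ¬? (x ≟ y) ×-dec ¬? (x ≟ z) ×-dec ¬? (y ≟ z)

-- Each triple is stored under all orderings of its points, so that a single row shows how many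
-- points a pair still misses.
allTriples : Table n
allTriples = tabulate λ x → tabulate λ y → tabulate λ z → does (distinct? x y z)

cover : Subset n → Table n → Table n
cover B = zipWith (λ b ws → if b then zipWith (λ c w → if c then w ─ B else w) B ws else ws) B

-- Applied to `refl`, it settles a finite statement by evaluating its decision procedure.
witness : ∀ {A : Set} (A? : Dec A) → does A? ≡ true → A
witness (yes a) _ = a

∈-allTriples : ∀ {x y z : Fin n} → z ∈ row allTriples x y → Distinct x y z
∈-allTriples {n} {x} {y} {z} z∈ = witness (distinct? x y z) (begin
  does (distinct? x y z)              ≡⟨ lookup∘tabulate (λ z → does (distinct? x y z)) z ⟨
  lookup (r x y) z                    ≡⟨ cong (λ w → lookup w z) (lookup∘tabulate (r x) y) ⟨
  lookup (lookup (tabulate (r x)) y) z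
    ≡⟨ cong (λ ws → lookup (lookup ws y) z) (lookup∘tabulate (λ x → tabulate (r x)) x) ⟨
  lookup (row allTriples x y) z       ≡⟨ []=⇒lookup z∈ ⟩
  true                                ∎)
  where
  open ≡-Reasoning
  r : Fin n → Fin n → Subset n
  r x y = tabulate λ z → does (distinct? x y z)

row-cover : (B : Subset n) (t : Table n) → ∀ x y →
            row (cover B t) x y ≡ (if lookup B x ∧ lookup B y then row t x y ─ B else row t x y)
row-cover B t x y
  rewrite lookup-zipWith (λ b ws → if b then zipWith (λ c w → if c then w ─ B else w) B ws else ws) x B t
  with lookup B x
... | false = refl
... | true  = lookup-zipWith (λ c w → if c then w ─ B else w) y B (lookup t x)

∈-cover : (B : Subset n) (t : Table n) → ∀ {x y z} → z ∈ row (cover B t) x y →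
          z ∈ row t x y × ¬ Triple x y z B
∈-cover B t {x} {y} {z} z∈ = helper (lookup B x) (lookup B y) refl refl (subst (z ∈_) (row-cover B t x y) z∈)
  where
  helper : ∀ b c → lookup B x ≡ b → lookup B y ≡ c →
           z ∈ (if b ∧ c then row t x y ─ B else row t x y) → z ∈ row t x y × ¬ Triple x y z B
  helper true  true  _ _ z∈ = p─q⊆p (row t x y) B z∈ , λ (_ , _ , z∈B) → x∈p─q⇒x∉q (row t x y) B z∈ z∈B
  helper true  false _ y∉ z∈ = z∈ , λ (_ , y∈B , _) → true≢false (trans (sym ([]=⇒lookup y∈B)) y∉)
  helper false _     x∉ _ z∈ = z∈ , λ (x∈B , _ , _) → true≢false (trans (sym ([]=⇒lookup x∈B)) x∉)

residual-cover : ∀ {t : Table n} {B Bs} → Residual t (B ∷ Bs) → Residual (cover B t) Bs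
residual-cover {t = t} {B} {Bs} res = record
  { differ = λ z∈ → differ (proj₁ (∈-cover B t z∈))
  ; meets  = λ z∈ → let z∈row , ∉B = ∈-cover B t z∈ in Any.tail ∉B (meets z∈row)
  }
  where open Residual res

-- The order matters, since the digits of the hints in a tree follow it. A triple of 11 points has
-- 28 extensions by two points.
extensions : ℕ → Subset n → List (Subset n)
extensions zero    []          = [] ∷ []
extensions (suc k) []          = []
extensions k       (true ∷ p)  = map (true ∷_) (extensions k p)
extensions zero    (false ∷ p) = map (false ∷_) (extensions zero p)
extensions (suc k) (false ∷ p) =
  map (true ∷_) (extensions k p) ++ map (false ∷_) (extensions (suc k) p)

∈-extensions : ∀ k (p B : Subset n) → p ⊆ B → ∣ B ∣ ≡ ∣ p ∣ + k → B ∈ₗ extensions k p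
∈-extensions zero    []          []          _   _  = here refl
∈-extensions (suc k) []          []          _   ()
∈-extensions zero    (true ∷ p)  (true ∷ B)  p⊆B eq =
  ∈-map⁺ (true ∷_) (∈-extensions zero p B (drop-∷-⊆ p⊆B) (ℕ.suc-injective eq))
∈-extensions (suc k) (true ∷ p)  (true ∷ B)  p⊆B eq =
  ∈-map⁺ (true ∷_) (∈-extensions (suc k) p B (drop-∷-⊆ p⊆B) (ℕ.suc-injective eq))
∈-extensions zero    (true ∷ p)  (false ∷ B) p⊆B eq with () ← p⊆B {zero} Vec.here
∈-extensions (suc k) (true ∷ p)  (false ∷ B) p⊆B eq with () ← p⊆B {zero} Vec.here
∈-extensions zero    (false ∷ p) (true ∷ B)  p⊆B eq =
  ⊥-elim (ℕ.<⇒≢ (s≤s (p⊆q⇒∣p∣≤∣q∣ (drop-∷-⊆ p⊆B))) (sym (trans eq (ℕ.+-identityʳ _))))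
∈-extensions zero    (false ∷ p) (false ∷ B) p⊆B eq =
  ∈-map⁺ (false ∷_) (∈-extensions zero p B (drop-∷-⊆ p⊆B) eq)
∈-extensions (suc k) (false ∷ p) (true ∷ B)  p⊆B eq =
  ∈-++⁺ˡ (∈-map⁺ (true ∷_) (∈-extensions k p B (drop-∷-⊆ p⊆B)
    (ℕ.suc-injective (trans eq (ℕ.+-suc ∣ p ∣ k)))))
∈-extensions (suc k) (false ∷ p) (false ∷ B) p⊆B eq =
  ∈-++⁺ʳ (map (true ∷_) (extensions k p))
    (∈-map⁺ (false ∷_) (∈-extensions (suc k) p B (drop-∷-⊆ p⊆B) eq))

-- Search trees

-- A tree settles the coverings that contain a given list of blocks. It either
-- branches over the blocks B through an uncovered triple {x, y, z}, or appeals
-- to a configuration settled before, counted backwards from the latest one,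
-- whose image under perm consists of given blocks; the number perm has the
-- values of the permutation as its base n digits, least significant first.
-- The hints are base 1 + n digits, one for each B in the order of extensions:
-- 0 points to the next subtree, 1 + x says that adding B overloads the point x.

data Tree : Set where
  branch    : (x y z hints : ℕ) → List Tree → Tree
  copy : (config perm : ℕ) → Tree

-- Point i belongs to the block if bit i of the number is set.

block : ∀ n → ℕ → Subset n
block zero    c = []
block (suc n) c = (0 <ᵇ c % 2) ∷ block n (c / 2)

digits : .{{_ : NonZero n}} → ∀ m → ℕ → Vec (Fin n) m
digits     zero    c = []
digits {n} (suc m) c = c mod n ∷ digits m (c / n)

-- The last index is also the answer for a value that does not occur. This is harmless, as `inverse`
-- then rejects the vector.
position : Fin n → ∀ {m} → Vec (Fin n) (suc m) → Fin (suc m)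
position x (y ∷ [])         = zero
position x (y ∷ ys@(_ ∷ _)) = if does (x ≟ y) then zero else suc (position x ys)

-- The vector comes from an arbitrary number in a certificate, hence the test of both composites.
inverse : Vec (Fin (suc n)) (suc n) → Maybe (Permutation′ (suc n))
inverse f with all? (λ i → lookup f (position i f) ≟ i) | all? (λ i → position (lookup f i) f ≟ i)
... | yes p | yes q = just (permutation (lookup f) (λ i → position i f) p q)
... | _     | _     = nothing

nth : ∀ {A : Set} → List A → ℕ → Maybe A
nth []       _       = nothing
nth (x ∷ xs) zero    = just x
nth (x ∷ xs) (suc k) = nth xs k

All-nth : ∀ {A : Set} {P : A → Set} {xs x} → All P xs → ∀ k → nth xs k ≡ just x → P x
All-nth (px ∷ pxs) zero    refl = px
All-nth (px ∷ pxs) (suc k) eq   = All-nth pxs k eq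

Bounds : ℕ → Set
Bounds n = Fin n → ℕ

-- A further block through x takes at most three points out of each of four rows.

overloaded : Bounds n → Table n → List (Subset n) → Fin n → Bool
overloaded u t Bs x = 4 * u x <ᵇ demand t x + 4 * degree x Bs

_∈ₗ?_ : (B : Subset n) (Bs : List (Subset n)) → Dec (B ∈ₗ Bs)
_∈ₗ?_ = DecMembership._∈?_ _≟ₛ_

unique? : (Bs : List (Subset n)) → Dec (Unique Bs)
unique? = DecUnique.unique? _≟ₛ_

-- A permutation that nowhere raises `u` preserves it, because the sums agree. So `π` permutes the
-- points of equal bound; a point with a bound of its own, such as `∞` in the main search, is fixed.
occurs? : (u : Bounds n) (π : Permutation′ n) (F Bs : List (Subset n)) →
          Dec (All (_∈ₗ Bs) (images π F) × (∀ x → u (π ⟨$⟩ʳ x) ≤ u x))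
occurs? u π F Bs = All.all? (_∈ₗ? Bs) (images π F) ×-dec all? (λ x → u (π ⟨$⟩ʳ x) ≤? u x)

occurs : Bounds n → Maybe (Permutation′ n) → Maybe (List (Subset n)) → List (Subset n) → Bool
occurs u (just π) (just F) Bs = does (occurs? u π F Bs)
occurs u _        _        Bs = false

module _ {m : ℕ} (u : Bounds (suc m)) where

  -- The criterion `dead` is a parameter because two of them are used: an overloaded point, and
  -- later an excess of blocks on one pair.
  module _ (dead : Table (suc m) → List (Subset (suc m)) → Fin (suc m) → Bool)
           (db : List (List (Subset (suc m)))) where

    verify     : Tree → Table (suc m) → List (Subset (suc m)) → Bool
    verifyAll  : ℕ → List Tree → Table (suc m) → List (Subset (suc m)) → List (Subset (suc m)) → Bool
    verifyNext : Fin (2 + m) → ℕ → List Tree → Table (suc m) → List (Subset (suc m)) → Subset (suc m) →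
                 List (Subset (suc m)) → Bool

    verify (copy k c)           t Bs = occurs u (inverse (digits (suc m) c)) (nth db k) Bs
    verify (branch x′ y′ z′ hs ss) t Bs =
      lookup (row t x y) z ∧ verifyAll hs ss t Bs (extensions 2 (⁅ x ⁆ ∪ ⁅ y ⁆ ∪ ⁅ z ⁆))
      where
      -- Trees carry plain numbers and do not depend on `m`; the remainder turns any number into a
      -- point.
      x = x′ mod suc m
      y = y′ mod suc m
      z = z′ mod suc m

    verifyAll hs ss t Bs []       = true
    verifyAll hs ss t Bs (D ∷ Ds) = verifyNext (hs mod (2 + m)) (hs / (2 + m)) ss t Bs D Ds

    verifyNext (suc x) hs ss       t Bs D Ds = dead (cover D t) (D ∷ Bs) x ∧ verifyAll hs ss t Bs Ds
    verifyNext zero    hs []       t Bs D Ds = false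
    verifyNext zero    hs (s ∷ ss) t Bs D Ds = verify s (cover D t) (D ∷ Bs) ∧ verifyAll hs ss t Bs Ds

  -- A configuration is checked against those before it and then joins them at the head of `db`, to
  -- which the backward count of `copy` refers.
  verifyEntries : List (List (Subset (suc m))) → List (List ℕ × Tree) → Bool
  verifyEntry   : List (List (Subset (suc m))) → List (Subset (suc m)) → Tree → List (List ℕ × Tree) → Bool

  verifyEntries db []            = true
  verifyEntries db ((F , s) ∷ es) = verifyEntry db (map (block (suc m)) F) s es

  verifyEntry db F s es =
    -- Distinct blocks can be split off from a covering that contains them, as `partial-config`
    -- does.
    does (unique? F) ∧ verify (overloaded u) db s (foldr cover allTriples F) F
                     ∧ verifyEntries (F ∷ db) es

configs : List (List (Subset n)) → List (List ℕ × Tree) → List (List (Subset n))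
configs     db []             = db
configs {n} db ((F , _) ∷ es) = configs (map (block n) F ∷ db) es

-- Soundness of the search

∣⁅x⁆∪p∣ : {x : Fin n} {p : Subset n} → x ∉ p → ∣ ⁅ x ⁆ ∪ p ∣ ≡ suc ∣ p ∣
∣⁅x⁆∪p∣ {x = zero}  {true ∷ p}  x∉ = ⊥-elim (x∉ Vec.here)
∣⁅x⁆∪p∣ {x = zero}  {false ∷ p} x∉ = cong (suc ∘ ∣_∣) (∪-identityˡ p)
∣⁅x⁆∪p∣ {x = suc x} {true ∷ p}  x∉ = cong suc (∣⁅x⁆∪p∣ (x∉ ∘ Vec.there))
∣⁅x⁆∪p∣ {x = suc x} {false ∷ p} x∉ = ∣⁅x⁆∪p∣ (x∉ ∘ Vec.there)

∣triple∣ : {x y z : Fin n} → Distinct x y z → ∣ ⁅ x ⁆ ∪ ⁅ y ⁆ ∪ ⁅ z ⁆ ∣ ≡ 3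
∣triple∣ {x = x} {y} {z} (x≢y , x≢z , y≢z) =
  trans (∣⁅x⁆∪p∣ x∉) (cong suc (trans (∣⁅x⁆∪p∣ (y≢z ∘ x∈⁅y⁆⇒x≡y z)) (cong suc (∣⁅x⁆∣≡1 z))))
  where
  x∉ : x ∉ ⁅ y ⁆ ∪ ⁅ z ⁆
  x∉ x∈ with x∈p∪q⁻ ⁅ y ⁆ ⁅ z ⁆ x∈
  ... | inj₁ x∈y = x≢y (x∈⁅y⁆⇒x≡y y x∈y)
  ... | inj₂ x∈z = x≢z (x∈⁅y⁆⇒x≡y z x∈z)

triple⊆ : {x y z : Fin n} {B : Subset n} → Triple x y z B → ⁅ x ⁆ ∪ ⁅ y ⁆ ∪ ⁅ z ⁆ ⊆ B
triple⊆ {x = x} {y} {z} (x∈B , y∈B , z∈B) w∈ with x∈p∪q⁻ ⁅ x ⁆ _ w∈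
... | inj₁ w∈x rewrite x∈⁅y⁆⇒x≡y x w∈x = x∈B
... | inj₂ w∈′ with x∈p∪q⁻ ⁅ y ⁆ ⁅ z ⁆ w∈′
...   | inj₁ w∈y rewrite x∈⁅y⁆⇒x≡y y w∈y = y∈B
...   | inj₂ w∈z rewrite x∈⁅y⁆⇒x≡y z w∈z = z∈B

Meeting : List (Subset n) → Set
Meeting Bs = ∀ {x y z} → Distinct x y z → Any (Triple x y z) Bs

-- These are the properties on which pruning relies, and they survive every permutation that
-- respects `u`. The number of blocks is left to the goal of a search.
record Admissible (u : Bounds n) (Cs : List (Subset n)) : Set where
  field
    sizes   : Uniform 5 Cs
    meeting : Meeting Cs
    bounded : ∀ x → degree x Cs ≤ u x

-- One occurrence of `x` is deleted from `ys`. The other members of `xs` are still found there,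
-- since `x` does not recur among them.
unique-⊆ : ∀ {A : Set} {xs ys : List A} → Unique xs → All (_∈ₗ ys) xs → ∃ λ zs → xs ++ zs ↭ ys
unique-⊆ {ys = ys} []              []           = ys , ↭-refl
unique-⊆ {xs = x ∷ xs} (x∉xs ∷ unique) (x∈ys ∷ xs⊆ys) with ∈-∃++ x∈ys
... | ys₁ , ys₂ , refl with unique-⊆ unique (All.tabulate λ {y} y∈xs →
        remaining y∈xs (↭.∈-resp-↭ (↭.shift x ys₁ ys₂) (All.lookup xs⊆ys y∈xs)))
  where
  remaining : ∀ {y} → y ∈ₗ xs → y ∈ₗ x ∷ ys₁ ++ ys₂ → y ∈ₗ ys₁ ++ ys₂
  remaining y∈xs = Any.tail λ y≡x → All.lookup x∉xs y∈xs (sym y≡x)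
...   | zs , split = zs , ↭-trans (prep x split) (↭-sym (↭.shift x ys₁ ys₂))

-- An element left over would make `ys` longer than `xs`.
unique-⊆-↭ : ∀ {A : Set} {xs ys : List A} → Unique xs → All (_∈ₗ ys) xs → length ys ≡ length xs → xs ↭ ys
unique-⊆-↭ {xs = xs} unique xs⊆ys len with unique-⊆ unique xs⊆ys
... | []     , split = subst (_↭ _) (List.++-identityʳ xs) split
... | z ∷ zs , split = ⊥-elim (ℕ.m+1+n≢m (length xs)
  (trans (sym (List.length-++ xs)) (trans (↭.↭-length split) len)))

-- The blocks of Cs split into the list Bs of blocks chosen so far and a
-- remainder, which covers the triples recorded in the table.

Partial : Table n → List (Subset n) → List (Subset n) → Set
Partial t Bs Cs = ∃ λ Rs → Bs ++ Rs ↭ Cs × Residual t Rs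

partial-start : {Cs : List (Subset n)} → Meeting Cs → Partial allTriples [] Cs
partial-start {Cs = Cs} meeting = Cs , ↭-refl , record
  { differ = ∈-allTriples
  ; meets  = λ z∈ → meeting (∈-allTriples z∈)
  }

partial-step : ∀ {t : Table n} {Bs Cs Rs} → Bs ++ Rs ↭ Cs → Residual t Rs →
               ∀ {B} → B ∈ₗ Rs → Partial (cover B t) (B ∷ Bs) Cs
partial-step {t = t} {Bs} {Cs} {Rs} split res {B} B∈Rs with ∈-∃++ B∈Rs
... | Rs₁ , Rs₂ , refl =
  Rs₁ ++ Rs₂ ,
  ↭-trans (↭-sym (↭.shift B Bs (Rs₁ ++ Rs₂))) (↭-trans (↭.++⁺ˡ Bs (↭-sym moved)) split) ,
  residual-cover (record
    { differ = Residual.differ res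
    ; meets  = λ z∈ → ↭.Any-resp-↭ moved (Residual.meets res z∈)
    })
  where
  moved : Rs₁ ++ B ∷ Rs₂ ↭ B ∷ Rs₁ ++ Rs₂
  moved = ↭.shift B Rs₁ Rs₂

partial-config : {Cs : List (Subset n)} → Meeting Cs →
                 ∀ {F} → Unique F → All (_∈ₗ Cs) F → Partial (foldr cover allTriples F) F Cs
partial-config meeting []           []           = partial-start meeting
partial-config meeting {B ∷ F} (B∉F ∷ unique) (B∈Cs ∷ F⊆Cs)
  with partial-config meeting unique F⊆Cs
... | Rs , split , res with ∈-++⁻ F (↭.∈-resp-↭ (↭-sym split) B∈Cs)
-- The new block is either among those already split off, which distinctness excludes, or in the
-- remainder.
...   | inj₁ B∈F  = ⊥-elim (All.lookup B∉F B∈F refl)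
...   | inj₂ B∈Rs = partial-step split res B∈Rs

-- The remaining blocks through `x` must meet the demand and the chosen ones are already there;
-- together they make up the degree, which `u` bounds. Keeping the factor 4 on both sides avoids a
-- division.
overloaded-sound : ∀ {u : Bounds n} {t Bs Cs} x → Admissible u Cs → Partial t Bs Cs →
                   overloaded u t Bs x ≢ true
overloaded-sound {n} {u} {t} {Bs} {Cs} x adm (Rs , split , res) over = ℕ.<-irrefl refl (begin-strict
  4 * u x                                  <⟨ ℕ.<ᵇ⇒< (4 * u x) _ (Equivalence.from T-≡ over) ⟩
  demand t x + 4 * degree x Bs             ≤⟨ ℕ.+-monoˡ-≤ _ (demand≤4degree uniR res x) ⟩
  4 * degree x Rs + 4 * degree x Bs        ≡⟨ ℕ.*-distribˡ-+ 4 (degree x Rs) _ ⟨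
  4 * (degree x Rs + degree x Bs)          ≡⟨ cong (4 *_) (ℕ.+-comm (degree x Rs) _) ⟩
  4 * (degree x Bs + degree x Rs)          ≡⟨ cong (4 *_) (tally-++ (λ C → lookup C x) Bs Rs) ⟨
  4 * degree x (Bs ++ Rs)                  ≡⟨ cong (4 *_) (tally-↭ (λ C → lookup C x) split) ⟩
  4 * degree x Cs                          ≤⟨ ℕ.*-monoʳ-≤ 4 (Admissible.bounded adm x) ⟩
  4 * u x                                  ∎)
  where
  open ≤-Reasoning
  uniR : Uniform 5 Rs
  uniR = All.++⁻ʳ Bs (↭.All-resp-↭ (↭-sym split) (Admissible.sizes adm))

meeting-images : (σ : Permutation′ n) {Cs : List (Subset n)} → Meeting Cs → Meeting (images σ Cs)
meeting-images σ meeting (x≢y , x≢z , y≢z) =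
  Any.map⁺ (Any.map (λ (x∈ , y∈ , z∈) → ∈-image⁺ σ x∈ , ∈-image⁺ σ y∈ , ∈-image⁺ σ z∈)
                    (meeting (x≢y ∘ back , x≢z ∘ back , y≢z ∘ back)))
  where
  back : ∀ {x y} → σ ⟨$⟩ˡ x ≡ σ ⟨$⟩ˡ y → x ≡ y
  back eq = trans (sym (inverseʳ σ)) (trans (cong (σ ⟨$⟩ʳ_) eq) (inverseʳ σ))

uniform-images : (σ : Permutation′ n) {Cs : List (Subset n)} → ∀ {k} → Uniform k Cs → Uniform k (images σ Cs)
uniform-images σ uni = All.map⁺ (All.map (λ {B} eq → trans (∣image∣ σ B) eq) uni)

-- The degree of `x` in the image under `π⁻¹` is the degree of `π x` in `Cs`, hence at most
-- `u (π x)`, which does not exceed `u x`.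
admissible-images : ∀ {u : Bounds n} (π : Permutation′ n) → (∀ x → u (π ⟨$⟩ʳ x) ≤ u x) →
                    ∀ {Cs} → Admissible u Cs → Admissible u (images (Perm.flip π) Cs)
admissible-images π ok {Cs} adm = record
  { sizes   = uniform-images (Perm.flip π) sizes
  ; meeting = meeting-images (Perm.flip π) meeting
  ; bounded = λ x → ℕ.≤-trans (ℕ.≤-reflexive (degree-images (Perm.flip π) x Cs))
                              (ℕ.≤-trans (bounded (π ⟨$⟩ʳ x)) (ok x))
  }
  where open Admissible adm

∧⁻ : ∀ {a b} → a ∧ b ≡ true → a ≡ true × b ≡ true
∧⁻ {true} eq = refl , eq

-- The goal is absurdity in the search for points of low degree and isomorphism with `standard` in
-- the main one. `goal-images` is what a `copy` leaf requires of it.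
module Soundness {m : ℕ} (u : Bounds (suc m))
  (Goal : List (Subset (suc m)) → Set)
  (goal-images : ∀ (π : Permutation′ (suc m)) Cs → Goal (images (Perm.flip π) Cs) → Goal Cs)
  where

  Blocks : Set
  Blocks = List (Subset (suc m))

  Good : Blocks → Set
  Good F = ∀ Cs → Admissible u Cs → All (_∈ₗ Cs) F → Goal Cs

  -- If `π F` lies within `Cs`, then `F` lies within the image of `Cs` under `π⁻¹`. That image is
  -- admissible again, so the earlier verdict on `F` applies to it and is carried back to `Cs`.
  occurs-sound : ∀ {db} → All Good db → ∀ π k Bs → occurs u π (nth db k) Bs ≡ true →
                 ∀ {Cs} → Admissible u Cs → All (_∈ₗ Cs) Bs → Goal Cs
  occurs-sound {db} good (just π) k Bs ok {Cs} adm Bs⊆Cs with nth db k in eq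
  ... | just F with witness (occurs? u π F Bs) ok
  ...   | πF⊆Bs , bounds = goal-images π Cs
    (All-nth good k eq (images (Perm.flip π) Cs) (admissible-images π bounds adm)
      (All.map (λ {B} πB∈ → subst (_∈ₗ images (Perm.flip π) Cs) (image-flip π B)
                                  (∈-map⁺ (image (Perm.flip π)) (All.lookup Bs⊆Cs πB∈)))
               (All.map⁻ πF⊆Bs)))

  -- `Extra` is a hypothesis on the one covering under examination, at the disposal of `dead` alone.
  -- It may refer to particular points: a copy appeals to `Good`, which speaks of all admissible
  -- coverings, so `Extra` is never transported along a permutation.
  module _ (dead : Table (suc m) → Blocks → Fin (suc m) → Bool) {db : List Blocks} (good : All Good db)
           (Extra : Blocks → Set)
           (dead-sound : ∀ {t Bs Cs} x → Extra Cs → Admissible u Cs → Partial t Bs Cs → dead t Bs x ≢ true)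
           {Cs : Blocks} (extra : Extra Cs) (adm : Admissible u Cs) where

    verify-sound : ∀ s t Bs → verify u dead db s t Bs ≡ true → Partial t Bs Cs → Goal Cs
    verifyAll-sound : ∀ hs ss t Bs Ds → verifyAll u dead db hs ss t Bs Ds ≡ true →
                      ∀ {D} → D ∈ₗ Ds → Partial (cover D t) (D ∷ Bs) Cs → Goal Cs
    verifyNext-sound : ∀ h hs ss t Bs D Ds → verifyNext u dead db h hs ss t Bs D Ds ≡ true →
                       ∀ {E} → E ∈ₗ D ∷ Ds → Partial (cover E t) (E ∷ Bs) Cs → Goal Cs

    verify-sound (copy k c) t Bs ok (Rs , split , _) =
      occurs-sound good (inverse (digits (suc m) c)) k Bs ok adm
        (All.tabulate λ B∈ → ↭.∈-resp-↭ split (∈-++⁺ˡ B∈))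
    verify-sound (branch x′ y′ z′ hs ss) t Bs ok (Rs , split , res) =
      verifyAll-sound hs ss t Bs _ (proj₂ (∧⁻ ok)) B∈ext (partial-step split res B∈Rs)
      where
      x = x′ mod suc m
      y = y′ mod suc m
      z = z′ mod suc m
      z∈ : z ∈ row t x y
      z∈ = lookup⇒[]= z (row t x y) (proj₁ (∧⁻ ok))
      -- Some remaining block covers the triple. It has five points, so it is one of the extensions
      -- over which the tree branches.
      found = find (Residual.meets res z∈)
      B = proj₁ found
      B∈Rs = proj₁ (proj₂ found)
      B∈ext : B ∈ₗ extensions 2 (⁅ x ⁆ ∪ ⁅ y ⁆ ∪ ⁅ z ⁆)
      B∈ext = ∈-extensions 2 _ B (triple⊆ (proj₂ (proj₂ found)))
        (trans (All.lookup (Admissible.sizes adm) (↭.∈-resp-↭ split (∈-++⁺ʳ Bs B∈Rs)))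
               (cong (_+ 2) (sym (∣triple∣ (Residual.differ res z∈)))))

    verifyAll-sound hs ss t Bs (D ∷ Ds) ok =
      verifyNext-sound (hs mod (2 + m)) (hs / (2 + m)) ss t Bs D Ds ok

    verifyNext-sound (suc x) hs ss t Bs D Ds ok (here refl) part =
      ⊥-elim (dead-sound x extra adm part (proj₁ (∧⁻ ok)))
    verifyNext-sound (suc x) hs ss t Bs D Ds ok (there E∈)  part =
      verifyAll-sound hs ss t Bs Ds (proj₂ (∧⁻ ok)) E∈ part
    verifyNext-sound zero hs (s ∷ ss) t Bs D Ds ok (here refl) part =
      verify-sound s (cover D t) (D ∷ Bs) (proj₁ (∧⁻ ok)) part
    verifyNext-sound zero hs (s ∷ ss) t Bs D Ds ok (there E∈)  part =
      verifyAll-sound hs ss t Bs Ds (proj₂ (∧⁻ ok)) E∈ part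

  config-sound : ∀ {db F} s → All Good db → Unique F →
                 verify u (overloaded u) db s (foldr cover allTriples F) F ≡ true → Good F
  config-sound {F = F} s good unique ok Cs adm F⊆Cs =
    verify-sound (overloaded u) good (λ _ → ⊤) (λ x _ → overloaded-sound x) _ adm s _ F ok
      (partial-config (Admissible.meeting adm) unique F⊆Cs)

  verifyEntries-sound : ∀ {db} es → verifyEntries u db es ≡ true → All Good db → All Good (configs db es)
  verifyEntries-sound []             ok good = good
  verifyEntries-sound ((F , s) ∷ es) ok good with ∧⁻ {does (unique? (map (block (suc m)) F))} ok
  ... | unique , ok′ with ∧⁻ ok′
  ...   | ok₁ , ok₂ = verifyEntries-sound es ok₂
    (config-sound s good (witness (unique? (map (block (suc m)) F)) unique) ok₁ ∷ good)

-- The points other than ∞ form five pairs i, i + 5, which make up two quintuples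
-- 0, …, 4 and 5, …, 9. The first ten blocks are ∞ with two of the pairs; the
-- others replace a point of a quintuple by its partner.

standard : List (Subset 11)
standard = map (block 11)
  (1123 ∷ 1189 ∷ 1321 ∷ 1585 ∷ 1222 ∷ 1354 ∷ 1618 ∷ 1420 ∷ 1684 ∷ 1816 ∷
   62 ∷ 961 ∷ 93 ∷ 930 ∷ 155 ∷ 868 ∷ 279 ∷ 744 ∷ 527 ∷ 496 ∷ [])

∞ : Fin 11
∞ = fromℕ 10

IsCover : List (Subset 11) → Set
IsCover Cs = length Cs ≡ 20 × Uniform 5 Cs × Meeting Cs

images-cover : ∀ σ {Cs} → IsCover Cs → IsCover (images σ Cs)
images-cover σ {Cs} (len , sizes , meeting) =
  trans (length-map (image σ) Cs) len , uniform-images σ sizes , meeting-images σ meeting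

-- Coverings with a point of degree at most eight

lowDegree : List (List ℕ × Tree)
-- The number 149858783964501140359185790045 is (12²⁸ - 1) / 11, with all 28 digits equal to 1 in
-- base 12: every extension overloads the point 0.
lowDegree = (1095 ∷ 1177 ∷ 1825 ∷ 961 ∷ [] , branch 0 1 5 149858783964501140359185790045 [])
  ∷ (1053 ∷ 1633 ∷ 1921 ∷ [] , branch 0 1 9 149858783964501140359185790045 [])
  ∷ (1137 ∷ 1921 ∷ [] , branch 0 1 10 149858783964501130632530755584
   ( branch 0 1 4 148897640819289687448152527005
     ( copy 1 264448623065 ∷ copy 1 264468108905 ∷ copy 1 264487581435 ∷ copy 1 266806409705
     ∷ copy 1 266825895545 ∷ copy 1 266845368075 ∷ copy 1 272160710855 ∷ copy 1 272180196695
     ∷ copy 1 272199669225 ∷ copy 1 274518497495 ∷ copy 1 274537983335 ∷ copy 1 274557455865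
     ∷ copy 1 279819604295 ∷ copy 1 282177390935 ∷ copy 1 282391588765 ∷ [])
   ∷ copy 0 270193473385 ∷ copy 0 272531933905 ∷ copy 0 274675522715 ∷ copy 0 277968806335
   ∷ copy 0 280307266855 ∷ copy 0 282450855665 ∷ copy 0 270195244935 ∷ copy 0 272533705455
   ∷ copy 0 274677294265 ∷ copy 0 277970577885 ∷ copy 0 280309038405 ∷ copy 0 282452627215 ∷ []))
  ∷ (1571 ∷ 1605 ∷ 1673 ∷ 1809 ∷ 481 ∷ [] , branch 0 1 6 149858783964501140359149958237 (branch 0 1 2 149858783964501140359185790045 [] ∷ []))
  ∷ (1561 ∷ 1633 ∷ 1921 ∷ [] , branch 0 1 9 149858783964501140359182804061
   ( branch 0 1 3 149858783618381116767638484061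
     ( copy 0 282199324605 ∷ copy 0 282413668845 ∷ copy 0 282218810445 ∷ copy 0 282433154685 ∷ []) ∷ []))
  ∷ (1633 ∷ 1921 ∷ [] , branch 0 1 9 149858783962282520336306086992
   ( copy 3 258879060935 ∷ copy 3 258879075565 ∷ copy 0 282458522225 ∷ copy 3 258879076885
   ∷ copy 0 282458536855 ∷ copy 0 282458551375 ∷ []))
  ∷ (1921 ∷ [] , branch 0 1 7 149772060131188350347403853824
   ( copy 3 207232236475 ∷ copy 3 207234008025 ∷ copy 3 207235779465 ∷ copy 3 207237549695
   ∷ copy 0 226327803185 ∷ copy 0 252245740615 ∷ copy 0 277968806335 ∷ copy 3 207234169065
   ∷ copy 3 207235940505 ∷ copy 3 207237710735 ∷ copy 0 226329574735 ∷ copy 0 252247512165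
   ∷ copy 0 277970577885 ∷ copy 3 207236101435 ∷ copy 3 207237871665 ∷ copy 0 226331346175
   ∷ copy 0 252249283605 ∷ copy 0 277972349325 ∷ copy 3 207238031385 ∷ copy 0 226333116405
   ∷ copy 0 252251053835 ∷ copy 0 277974119555 ∷ copy 0 226334873325 ∷ copy 0 252252810755
   ∷ copy 0 277975876475 ∷ [])) ∷ []

-- Up to a permutation that fixes 0 there is only one block through 0. So all 28 branches are copies
-- of the last configuration, the single block 0, 7, 8, 9, 10.
lowDegreeTree : Tree
lowDegreeTree = branch 0 1 2 0
   ( copy 0 111291038705 ∷ copy 0 137228463295 ∷ copy 0 163165887775 ∷ copy 0 189103311045
   ∷ copy 0 215040721005 ∷ copy 0 240977984555 ∷ copy 0 266913637595 ∷ copy 0 139586410975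
   ∷ copy 0 165523835455 ∷ copy 0 191461258725 ∷ copy 0 217398668685 ∷ copy 0 243335932235
   ∷ copy 0 269271585275 ∷ copy 0 167881783025 ∷ copy 0 193819206295 ∷ copy 0 219756616255
   ∷ copy 0 245693879805 ∷ copy 0 271629532845 ∷ copy 0 196177152655 ∷ copy 0 222114562615
   ∷ copy 0 248051826165 ∷ copy 0 273987479205 ∷ copy 0 224472495665 ∷ copy 0 250409759215
   ∷ copy 0 276345412255 ∷ copy 0 252767545855 ∷ copy 0 278703198895 ∷ copy 0 281059375025 ∷ [])

module MinimumDegree where

  -- The value 20 imposes nothing beyond the number of blocks; only the point 0 is restricted.
  bound : Bounds 11
  bound 0F      = 8
  bound (suc _) = 20

  Impossible : List (Subset 11) → Set
  Impossible _ = ⊥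

  impossible-images : ∀ (π : Permutation′ 11) Cs → Impossible (images (Perm.flip π) Cs) → Impossible Cs
  impossible-images π Cs ()

  open Soundness bound Impossible impossible-images

  lowDegree-valid : verifyEntries bound [] lowDegree ≡ true
  lowDegree-valid = refl

  lowDegreeTree-valid : verify bound (overloaded bound) (configs [] lowDegree) lowDegreeTree allTriples [] ≡ true
  lowDegreeTree-valid = refl

  contradictory : Good []
  contradictory = config-sound {db = configs [] lowDegree} {F = []} lowDegreeTree
    (verifyEntries-sound {db = []} lowDegree lowDegree-valid []) [] lowDegreeTree-valid

-- A transposition moves a point of degree at most eight to 0, where the search has excluded it.
degree≥9 : ∀ {Cs} → IsCover Cs → ∀ x → 9 ≤ degree x Cs
degree≥9 {Cs} cover x with 9 ≤? degree x Cs
... | yes 9≤d = 9≤d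
... | no  9≰d = ⊥-elim (MinimumDegree.contradictory (images σ Cs) adm [])
  where
  σ = transpose x 0F
  cover′ = images-cover σ cover
  bounded : ∀ y → degree y (images σ Cs) ≤ MinimumDegree.bound y
  bounded 0F = begin
    degree 0F (images σ Cs)  ≡⟨ degree-images σ 0F Cs ⟩
    degree (σ ⟨$⟩ˡ 0F) Cs    ≡⟨⟩
    degree x Cs              ≤⟨ s≤s⁻¹ (ℕ.≰⇒> 9≰d) ⟩
    8                        ∎
    where open ≤-Reasoning
  bounded y@(suc _) = ℕ.≤-trans (tally≤length _ (images σ Cs)) (ℕ.≤-reflexive (proj₁ cover′))
  adm : Admissible MinimumDegree.bound (images σ Cs)
  adm = record { sizes = proj₁ (proj₂ cover′) ; meeting = proj₂ (proj₂ cover′) ; bounded = bounded }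

-- Coverings in which every point other than ∞ has degree nine

bound : Bounds 11
bound x = if does (x ≟ ∞) then 10 else 9

Standard : List (Subset 11) → Set
Standard Cs = ∃ λ π → images π Cs ∼[ set ] standard

images-∘ : ∀ {n} (π ρ : Permutation′ n) Cs → images (π ∘ₚ ρ) Cs ≡ images ρ (images π Cs)
images-∘ π ρ Cs = trans (map-cong (image-∘ π ρ) Cs) (map-∘ Cs)

images-id : ∀ {n} (Cs : List (Subset n)) → images Perm.id Cs ≡ Cs
images-id Cs = trans (map-cong tabulate∘lookup Cs) (map-id Cs)

standard-images : ∀ π Cs → Standard (images π Cs) → Standard Cs
standard-images π Cs (ρ , eq) = π ∘ₚ ρ , subst (_∼[ set ] standard) (sym (images-∘ π ρ Cs)) eq

-- Three blocks that share two points and partition the others.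

pencil : List (Subset 11)
pencil = map (block 11) (199 ∷ 248 ∷ 1984 ∷ [])

-- The length is a premise here because `Admissible` leaves it open. It takes effect in
-- `standard-good`, where a list that contains `standard` has to coincide with it.
Goal : List (Subset 11) → Set
Goal Cs = length Cs ≡ 20 → Standard Cs

goal-images : ∀ π Cs → Goal (images (Perm.flip π) Cs) → Goal Cs
goal-images π Cs goal len =
  standard-images (Perm.flip π) Cs (goal (trans (length-map (image (Perm.flip π)) Cs) len))

open Soundness bound Goal goal-images
standard-unique : Unique standard
standard-unique = witness (unique? standard) refl

-- Twenty distinct blocks leave no room for others in a list of length twenty. With this as the
-- first entry of the database, even the leaf that the surviving covering reaches is a `copy`.
standard-good : Good standard
standard-good Cs adm ⊆Cs len = Perm.id , subst (_∼[ set ] standard) (sym (images-id Cs))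
  (mk⇔ (↭.∈-resp-↭ (↭-sym same)) (↭.∈-resp-↭ same))
  where
  same : standard ↭ Cs
  same = unique-⊆-↭ standard-unique ⊆Cs len

-- These 266 configurations are quoted up to permutations that fix `∞`, so the pencil may appear on
-- another pair of points. A hint `d` times 149858783964501140359185790045 has all its digits equal
-- to `d` in base 12: every extension dies at the point `d - 1`.
extensionsOfPencil : List (List ℕ × Tree)
extensionsOfPencil = (199 ∷ 333 ∷ 370 ∷ 124 ∷ 248 ∷ 1984 ∷ [] , branch 0 4 6 1049011487751457588714459491979 [])
  ∷ (211 ∷ 370 ∷ 124 ∷ 236 ∷ 1984 ∷ [] , branch 0 6 8 1049010935051108857349115537067 (copy 0 282458205415 ∷ []))
  ∷ (203 ∷ 124 ∷ 244 ∷ 376 ∷ 1984 ∷ [] , branch 0 6 8 1048924713735581867253508073095 [])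
  ∷ (211 ∷ 124 ∷ 236 ∷ 880 ∷ 1984 ∷ [] , branch 0 5 6 1048050348786360146787610357387 [])
  ∷ (115 ∷ 188 ∷ 220 ∷ 1712 ∷ 1872 ∷ [] , branch 0 4 7 749293919822505701795928950225 [])
  ∷ (227 ∷ 314 ∷ 124 ∷ 188 ∷ 1888 ∷ 1952 ∷ [] , branch 0 3 5 74929391982250570179592895022 (branch 1 2 5 899152703787005451232193624622 [] ∷ []))
  ∷ (157 ∷ 110 ∷ 118 ∷ 1804 ∷ 1812 ∷ 1252 ∷ [] , branch 0 2 5 446714465394181350688753474839 (branch 0 1 2 449576351893503421077557370135 [] ∷ []))
  ∷ (227 ∷ 818 ∷ 124 ∷ 188 ∷ 1888 ∷ 1952 ∷ [] , branch 0 5 8 899152703787006842154899749422 (branch 0 4 5 899152703787004060314898102830 [] ∷ []))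
  ∷ (185 ∷ 94 ∷ 110 ∷ 1816 ∷ 1832 ∷ 1736 ∷ [] , branch 0 3 9 599435135858004561436743160176 (branch 0 3 6 599435135858004561436277346362 [] ∷ []))
  ∷ (199 ∷ 124 ∷ 248 ∷ 1984 ∷ [] , branch 2 6 8 86814423812643101641229974272
   ( branch 3 6 8 1049011487751440790781179145819 [] ∷ copy 7 282458205415 ∷ copy 7 282458366345
   ∷ copy 7 282458526065 ∷ copy 7 282458205425 ∷ copy 7 282458366355 ∷ copy 7 282458526075
   ∷ copy 6 282458377245 ∷ copy 6 282458538175 ∷ copy 5 282458205425 ∷ copy 4 280238337005
   ∷ copy 6 282458552695 ∷ copy 5 282458366355 ∷ copy 4 280257824055 ∷ copy 5 282458526075
   ∷ copy 4 280277309895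
   ∷ branch 0 3 6 606715707737905057406529163
     ( copy 3 282451629065 ∷ copy 3 280308040255 ∷ copy 2 282318321605 ∷ copy 3 282451643585
     ∷ copy 3 280308054775 ∷ copy 2 282320093155 ∷ copy 1 282451616965 ∷ copy 0 280173537425
     ∷ copy 0 282317126235 ∷ []) ∷ []))
  ∷ (93 ∷ 229 ∷ 358 ∷ 218 ∷ 376 ∷ 1984 ∷ [] , branch 0 1 6 1049011487724884542239779925499 [])
  ∷ (199 ∷ 93 ∷ 362 ∷ 372 ∷ 248 ∷ 1984 ∷ [] , branch 0 5 6 1049011487059301103218853685194 [])
  ∷ (103 ∷ 203 ∷ 244 ∷ 376 ∷ 1984 ∷ [] , branch 0 6 8 1049010935690067786156408513492
   ( copy 11 282262978485 ∷ copy 1 282458345325 ∷ copy 0 282458366015 ∷ []))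
  ∷ (31 ∷ 103 ∷ 391 ∷ 1543 ∷ 121 ∷ 665 ∷ 1305 ∷ 1249 ∷ 865 ∷ 62 ∷ [] , branch 1 5 7 299717763460006108484351374429 [])
  ∷ (47 ∷ 87 ∷ 391 ∷ 1543 ∷ 121 ∷ 681 ∷ 1321 ∷ 1233 ∷ 849 ∷ 158 ∷ [] , branch 3 4 8 49959552725602082956969587805 (branch 1 3 9 299731921526814586626164995165 [] ∷ []))
  ∷ (47 ∷ 87 ∷ 1159 ∷ 775 ∷ 121 ∷ 425 ∷ 1577 ∷ 721 ∷ 1361 ∷ 158 ∷ [] , branch 3 4 8 50039049574669730222538044509 (branch 1 3 8 299877665750754923536100439133 [] ∷ []))
  ∷ (31 ∷ 107 ∷ 395 ∷ 1547 ∷ 117 ∷ 661 ∷ 1301 ∷ 1249 ∷ 865 ∷ 1144 ∷ [] , branch 3 4 7 595864498368551675606953145437 (branch 2 3 9 599435135911251227998503875677 [] ∷ []))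
  ∷ (103 ∷ 171 ∷ 307 ∷ 1571 ∷ 205 ∷ 597 ∷ 1349 ∷ 1177 ∷ 905 ∷ 286 ∷ 542 ∷ [] , branch 1 2 7 311165113926290562273583903837 [])
  ∷ (143 ∷ 535 ∷ 103 ∷ 1287 ∷ 1177 ∷ 233 ∷ 905 ∷ 369 ∷ 1633 ∷ 94 ∷ 314 ∷ 1698 ∷ 1580 ∷ 436 ∷ 1840 ∷ [] , branch 1 3 9 299717567929002280718368322653 [])
  ∷ (143 ∷ 1047 ∷ 103 ∷ 775 ∷ 665 ∷ 233 ∷ 1417 ∷ 369 ∷ 1633 ∷ 94 ∷ 314 ∷ 1698 ∷ 1580 ∷ 436 ∷ 1840 ∷ [] , branch 1 3 9 299717567929002280718368322653 [])
  ∷ (79 ∷ 55 ∷ 647 ∷ 1287 ∷ 121 ∷ 1225 ∷ 841 ∷ 433 ∷ 1585 ∷ 558 ∷ 410 ∷ 1618 ∷ 1564 ∷ 468 ∷ 1936 ∷ [] , branch 1 3 10 299717567929002280718368322653 [])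
  ∷ (271 ∷ 307 ∷ 451 ∷ 1795 ∷ 565 ∷ 1221 ∷ 1081 ∷ 713 ∷ 241 ∷ 94 ∷ 174 ∷ 1550 ∷ 1682 ∷ 1634 ∷ 1504 ∷ [] , branch 2 4 7 1198783497700131845153745876061 [])
  ∷ (199 ∷ 587 ∷ 115 ∷ 1347 ∷ 1165 ∷ 181 ∷ 901 ∷ 313 ∷ 1585 ∷ 286 ∷ 558 ∷ 1682 ∷ 1620 ∷ 472 ∷ 1816 ∷ [] , branch 1 2 10 299717567929002280718368322653 [])
  ∷ (295 ∷ 331 ∷ 403 ∷ 1795 ∷ 109 ∷ 565 ∷ 1189 ∷ 1113 ∷ 713 ∷ 158 ∷ 1606 ∷ 1578 ∷ 242 ∷ 1682 ∷ 1504 ∷ [] , branch 2 6 7 1048924814398454063534733079645 [])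
  ∷ (271 ∷ 307 ∷ 451 ∷ 1795 ∷ 61 ∷ 589 ∷ 1165 ∷ 1137 ∷ 689 ∷ 214 ∷ 1574 ∷ 1562 ∷ 234 ∷ 1730 ∷ [] , branch 2 4 8 19453306811485
   ( branch 2 4 9 449576351893503411350899078237 [] ∷ copy 5 282208150345 ∷ copy 4 281993806105
   ∷ copy 3 282223376985 ∷ copy 2 282355661555 ∷ copy 4 282169173605 ∷ copy 5 281954829365
   ∷ copy 3 282024959755 ∷ copy 2 282397828845 ∷ branch 2 5 6 449576351893503411350899078237 []
   ∷ copy 1 282200349475 ∷ copy 0 282431863725 ∷ copy 1 281950560485 ∷ copy 0 282454559695
   ∷ branch 5 6 9 1498154471265406343694217458781 [] ∷ []))
  ∷ (279 ∷ 299 ∷ 835 ∷ 1411 ∷ 61 ∷ 213 ∷ 1557 ∷ 1129 ∷ 681 ∷ 206 ∷ 1804 ∷ [] , branch 1 2 5 37464695991125285089789932637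
   ( branch 2 6 8 449574695709186683768298075229
     ( branch 2 6 9 415233713901638576411904111709 (copy 0 281601110285 ∷ []) ∷ []) ∷ []))
  ∷ (55 ∷ 91 ∷ 403 ∷ 1555 ∷ 109 ∷ 677 ∷ 1317 ∷ 1225 ∷ 841 ∷ 398 ∷ [] , branch 1 2 9 297636287944575743616223360093
   ( copy 8 282437178045 ∷ copy 8 282205116985 ∷ branch 1 2 10 300671534248682962666067670109 []
   ∷ branch 1 2 6 311244656778613862487418811485 []
   ∷ branch 1 2 6 311244656778613862487418811485 []
   ∷ branch 1 2 10 300678158985949912646087160925 []
   ∷ branch 1 5 8 380406867855974274177094988893 [] ∷ copy 0 282033377835
   ∷ branch 1 2 6 311244656778613862487418811485 [] ∷ []))
  ∷ (55 ∷ 91 ∷ 403 ∷ 1555 ∷ 109 ∷ 677 ∷ 1317 ∷ 1225 ∷ 841 ∷ 1648 ∷ [] , branch 4 5 7 62010301259039590344056403037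
   ( branch 2 4 6 726385477978588165223029470301 []
   ∷ branch 2 3 4 731155288810791615871035962461 []
   ∷ branch 3 4 5 761695427981394086882901161053 [] ∷ copy 1 282032855115
   ∷ branch 4 5 8 886744014644691876037973275741 []
   ∷ branch 2 4 7 749260796136169564699190391901 (branch 2 3 4 749293819447698646259854799965 [] ∷ [])
   ∷ branch 3 4 5 760741465819793983351131501661 []
   ∷ branch 2 4 6 751201844155387082055118517341 []
   ∷ branch 3 4 5 761695427986250080502307386461 [] ∷ []))
  ∷ (79 ∷ 55 ∷ 395 ∷ 1547 ∷ 1221 ∷ 837 ∷ 121 ∷ 689 ∷ 1329 ∷ 158 ∷ [] , branch 1 2 8 299717567929002280718368322653 [])
  ∷ (47 ∷ 87 ∷ 1163 ∷ 779 ∷ 421 ∷ 1573 ∷ 121 ∷ 721 ∷ 1361 ∷ 158 ∷ [] , branch 1 2 8 299717567929002280718368322653 [])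
  ∷ (31 ∷ 103 ∷ 675 ∷ 1315 ∷ 1221 ∷ 837 ∷ 121 ∷ 409 ∷ 1561 ∷ 398 ∷ [] , branch 1 3 5 299717567933842867316164129885 [])
  ∷ (31 ∷ 103 ∷ 419 ∷ 1571 ∷ 709 ∷ 1349 ∷ 121 ∷ 1177 ∷ 793 ∷ 398 ∷ [] , branch 1 2 9 299717567929002280718368322653 [])
  ∷ (31 ∷ 103 ∷ 419 ∷ 1571 ∷ 709 ∷ 1349 ∷ 121 ∷ 1177 ∷ 793 ∷ 1648 ∷ [] , branch 1 3 5 899152703784586655847596422237 [])
  ∷ (31 ∷ 103 ∷ 391 ∷ 1543 ∷ 121 ∷ 681 ∷ 1321 ∷ 1233 ∷ 849 ∷ [] , branch 3 4 7 607016471524174749735433309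
   ( branch 1 3 5 324692827430238709024711324765 [] ∷ copy 4 280314440945 ∷ copy 3 280307839075
   ∷ copy 2 282458522225 ∷ copy 1 279925189995 ∷ copy 0 277776112295 ∷ copy 4 280314294535
   ∷ copy 3 280306082155 ∷ copy 2 282458508915 ∷ copy 1 279925176685 ∷ copy 0 277776125605
   ∷ branch 1 3 5 599435135858004561436733387869 []
   ∷ branch 1 3 5 599408636908936764488688907357 (branch 2 3 5 599435135858004561436733387869 [] ∷ [])
   ∷ branch 1 3 5 553644951868851435215871063133 (branch 1 3 6 599435135858004561436733387869 [] ∷ [])
   ∷ branch 1 4 6 748896435584068454276332893277 (branch 2 4 6 749293919820085408497000100957 [] ∷ []) ∷ []))
  ∷ (31 ∷ 103 ∷ 395 ∷ 1547 ∷ 661 ∷ 1301 ∷ 1249 ∷ 865 ∷ [] , branch 0 3 5 149858783964501033365980410973 (copy 0 277972607935 ∷ []))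
  ∷ (31 ∷ 103 ∷ 1159 ∷ 185 ∷ 1113 ∷ 1825 ∷ 961 ∷ [] , branch 0 1 8 149858783964316255357282134109
   ( branch 0 3 8 149858783964316256100290753629
     ( branch 1 3 8 3257437
       ( copy 21 277280764255 ∷ copy 20 277280178615 ∷ copy 20 277077187805
       ∷ copy 19 274746846385 ∷ copy 21 277076309345 ∷ copy 18 274733963185
       ∷ copy 20 275136265305 ∷ copy 19 277084982405 ∷ copy 20 274735155145
       ∷ copy 21 274733983865 ∷ copy 18 277076286245 ∷ copy 8 277280097545 ∷ copy 8 275136215695
       ∷ copy 19 277270923765 ∷ copy 7 272787018185 ∷ copy 8 272788963975 ∷ copy 20 272788874435
       ∷ copy 7 275134269905 ∷ copy 20 272590755085 ∷ copy 7 277278151755 ∷ copy 18 277280747205 ∷ []) ∷ [])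
   ∷ copy 0 277280763045 ∷ copy 0 277280748525 ∷ []))
  ∷ (79 ∷ 211 ∷ 236 ∷ 880 ∷ 1984 ∷ [] , branch 0 5 6 1049011487751507982514279628427
   ( branch 2 4 6 1049011487735977704767117471371 (copy 0 282416342445 ∷ []) ∷ []))
  ∷ (31 ∷ 103 ∷ 391 ∷ 1543 ∷ 185 ∷ 345 ∷ 1561 ∷ 1825 ∷ 1729 ∷ 110 ∷ [] , branch 3 7 8 87329695645874329250941711453 (branch 1 3 7 299889910775702764515010622557 [] ∷ []))
  ∷ (31 ∷ 295 ∷ 199 ∷ 1543 ∷ 121 ∷ 409 ∷ 1561 ∷ 1697 ∷ 1857 ∷ 110 ∷ 1356 ∷ [] , branch 1 3 8 324692827425400904250291205213 [])
  ∷ (31 ∷ 167 ∷ 327 ∷ 1543 ∷ 121 ∷ 409 ∷ 1561 ∷ 1825 ∷ 1729 ∷ 110 ∷ [] , branch 1 3 7 324348341087519543925712958557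
   ( branch 1 4 6 299717797954601827566875653213 [] ∷ copy 0 282263682085 ∷ []))
  ∷ (31 ∷ 167 ∷ 327 ∷ 1543 ∷ 313 ∷ 217 ∷ 1561 ∷ 1633 ∷ 1921 ∷ 110 ∷ [] , branch 3 5 7 346895330830847294934430813
   ( branch 1 3 7 324692827425400904250291205213 []
   ∷ branch 1 3 7 324692827425400904250291205213 []
   ∷ branch 1 3 8 324520683934220027722355258461 [] ∷ []))
  ∷ (31 ∷ 103 ∷ 391 ∷ 1543 ∷ 185 ∷ 345 ∷ 1561 ∷ 1825 ∷ 1729 ∷ 558 ∷ [] , branch 3 6 9 664304563173843912888710935645 (branch 1 3 7 299889910775702764515010622557 [] ∷ []))
  ∷ (31 ∷ 103 ∷ 391 ∷ 1543 ∷ 185 ∷ 345 ∷ 1561 ∷ 1825 ∷ 1729 ∷ 1308 ∷ [] , branch 2 6 8 446694691501519314733728068701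
   ( branch 2 3 6 449576351920128145270106027101 []
   ∷ branch 2 3 7 449576352212983527441379161181 [] ∷ []))
  ∷ (31 ∷ 107 ∷ 395 ∷ 1547 ∷ 181 ∷ 341 ∷ 1557 ∷ 1825 ∷ 1729 ∷ 230 ∷ 1798 ∷ [] , branch 1 4 7 1398681983668677310019064116317 [])
  ∷ (31 ∷ 107 ∷ 395 ∷ 1547 ∷ 181 ∷ 341 ∷ 1557 ∷ 1825 ∷ 1729 ∷ 230 ∷ [] , branch 1 2 8 25062485929822279398176404573
   ( branch 1 2 10 299723088570016129275099427933 (branch 1 4 5 299717567929002280718368322653 [] ∷ [])
   ∷ branch 1 2 9 299723088570016129275099427933 (branch 1 4 6 299717567929002280718368322653 [] ∷ [])
   ∷ copy 0 282458553905 ∷ []))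
  ∷ (31 ∷ 107 ∷ 395 ∷ 1547 ∷ 181 ∷ 341 ∷ 1557 ∷ 1825 ∷ 1729 ∷ 614 ∷ 1350 ∷ [] , branch 1 2 7 299717617794506906728100082781 [])
  ∷ (55 ∷ 587 ∷ 651 ∷ 93 ∷ 405 ∷ 1557 ∷ 302 ∷ 230 ∷ 1574 ∷ 1676 ∷ 1860 ∷ [] , branch 0 3 5 184201421956365985024832533597 [])
  ∷ (31 ∷ 107 ∷ 395 ∷ 1547 ∷ 181 ∷ 341 ∷ 1557 ∷ 1825 ∷ 1729 ∷ 614 ∷ 1414 ∷ [] , branch 1 4 9 297809643596120900459165725789
   ( branch 1 4 5 299717475918762461978965390429
     ( branch 1 5 7 299716463806124455845533135965 (copy 22 281321743165 ∷ []) ∷ []) ∷ []))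
  ∷ (31 ∷ 107 ∷ 395 ∷ 1547 ∷ 181 ∷ 341 ∷ 1557 ∷ 1825 ∷ 1729 ∷ 614 ∷ [] , branch 1 2 7 276650133030038563212703642717
   ( branch 1 2 8 299797110783544192038943667293 []
   ∷ branch 1 2 8 299797110783544192038943667293 []
   ∷ branch 1 2 8 299717567955627004910923494493 []
   ∷ branch 1 2 8 299797110783544192038943667293 []
   ∷ branch 1 2 8 299797064776205671562501764189 [] ∷ copy 2 282262071685 ∷ copy 1 282456610415
   ∷ branch 1 4 6 361725110345047136057484719197 [] ∷ copy 0 282458553905 ∷ []))
  ∷ (31 ∷ 107 ∷ 395 ∷ 1547 ∷ 181 ∷ 341 ∷ 1557 ∷ 1825 ∷ 1729 ∷ 1432 ∷ [] , branch 3 4 5 549482393283605394041580074077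
   ( branch 2 3 6 449689022265921459923916485725 []
   ∷ branch 2 3 10 450530869981766349371930113117 []
   ∷ branch 2 3 6 449662523316853662975872005213 [] ∷ copy 1 282458522225
   ∷ branch 3 4 6 600395722761897085062240842845 [] ∷ copy 3 282440793195
   ∷ branch 1 4 7 749313794031886256208033461341 []
   ∷ branch 2 3 8 599868504087552107943008711773 []
   ∷ branch 2 3 8 599468259544339307621788988509 [] ∷ []))
  ∷ (31 ∷ 271 ∷ 307 ∷ 451 ∷ 1795 ∷ 597 ∷ 681 ∷ 614 ∷ 666 ∷ 716 ∷ 436 ∷ 1860 ∷ 376 ∷ 1928 ∷ 1840 ∷ [] , branch 0 2 5 149858783964501140359185790045 [])
  ∷ (31 ∷ 295 ∷ 395 ∷ 339 ∷ 1795 ∷ 589 ∷ 689 ∷ 662 ∷ 618 ∷ 316 ∷ 484 ∷ 1828 ∷ 728 ∷ 1864 ∷ 1936 ∷ [] , branch 0 2 7 149858783964501140359185790045 [])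
  ∷ (31 ∷ 271 ∷ 595 ∷ 661 ∷ 569 ∷ 1809 ∷ 481 ∷ 310 ∷ 454 ∷ 1798 ∷ 682 ∷ 620 ∷ 472 ∷ 1832 ∷ 1984 ∷ [] , branch 0 1 5 149858783964501140359185790045 [])
  ∷ (279 ∷ 331 ∷ 419 ∷ 1795 ∷ 557 ∷ 721 ∷ 710 ∷ 570 ∷ 412 ∷ 372 ∷ 1812 ∷ 744 ∷ 1832 ∷ 1264 ∷ 1984 ∷ [] , branch 0 2 6 1049011437561684161447354150371 [])
  ∷ (551 ∷ 283 ∷ 341 ∷ 713 ∷ 433 ∷ 1809 ∷ 454 ∷ 682 ∷ 626 ∷ 1826 ∷ 668 ∷ 364 ∷ 1860 ∷ 1928 ∷ 1264 ∷ [] , branch 0 3 5 899152703784586548856198920738 [])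
  ∷ (79 ∷ 59 ∷ 659 ∷ 213 ∷ 357 ∷ 1605 ∷ 286 ∷ 174 ∷ 1550 ∷ 1474 ∷ 1588 ∷ 1924 ∷ [] , branch 0 1 8 161306329964008041937242256477 [])
  ∷ (55 ∷ 91 ∷ 403 ∷ 1555 ∷ 173 ∷ 357 ∷ 1573 ∷ 1801 ∷ 1729 ∷ 590 ∷ 1318 ∷ 1236 ∷ [] , branch 1 2 7 299717567955625614004843328605 [])
  ∷ (79 ∷ 211 ∷ 355 ∷ 1603 ∷ 285 ∷ 173 ∷ 1549 ∷ 1585 ∷ 1921 ∷ 182 ∷ 1476 ∷ [] , branch 1 2 8 454259438894812993822050743389 [])
  ∷ (87 ∷ 555 ∷ 651 ∷ 205 ∷ 357 ∷ 1605 ∷ 286 ∷ 182 ∷ 1558 ∷ 1474 ∷ 1580 ∷ 1924 ∷ [] , branch 0 1 8 161306329961789421914401371229 [])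
  ∷ (31 ∷ 115 ∷ 403 ∷ 1555 ∷ 173 ∷ 333 ∷ 1549 ∷ 1825 ∷ 1729 ∷ 230 ∷ 1318 ∷ 1236 ∷ [] , branch 1 2 9 299724744754331475678272042077 [])
  ∷ (31 ∷ 115 ∷ 403 ∷ 1555 ∷ 301 ∷ 205 ∷ 1549 ∷ 1697 ∷ 1857 ∷ 614 ∷ 1190 ∷ 1364 ∷ [] , branch 1 2 8 299803689540095954085987890269 [])
  ∷ (47 ∷ 115 ∷ 419 ∷ 1571 ∷ 285 ∷ 205 ∷ 1549 ∷ 1681 ∷ 1857 ∷ 598 ∷ 1414 ∷ 1380 ∷ [] , branch 2 4 10 1273799662739819685214552142941 (branch 3 4 7 1207449305452920195739294446685 [] ∷ []))
  ∷ (31 ∷ 103 ∷ 391 ∷ 1547 ∷ 1557 ∷ 185 ∷ 345 ∷ 1825 ∷ 1729 ∷ 558 ∷ [] , branch 1 2 10 299717567929002280718368322653 [])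
  ∷ (31 ∷ 103 ∷ 391 ∷ 1547 ∷ 1557 ∷ 185 ∷ 345 ∷ 1825 ∷ 1729 ∷ 1308 ∷ [] , branch 1 2 9 449576351893503429993615471709 [])
  ∷ (31 ∷ 1543 ∷ 107 ∷ 395 ∷ 181 ∷ 341 ∷ 1561 ∷ 1825 ∷ 1729 ∷ 230 ∷ [] , branch 1 3 9 299717567875755614156597834845 (branch 1 3 10 299717567929002280718368322653 [] ∷ []))
  ∷ (31 ∷ 1543 ∷ 107 ∷ 395 ∷ 181 ∷ 341 ∷ 1561 ∷ 1825 ∷ 1729 ∷ 614 ∷ [] , branch 1 2 7 299717567929002280718368322653 [])
  ∷ (31 ∷ 1543 ∷ 107 ∷ 395 ∷ 181 ∷ 341 ∷ 1561 ∷ 1825 ∷ 1729 ∷ 1432 ∷ [] , branch 1 3 9 599435135858004552520561275997 [])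
  ∷ (31 ∷ 103 ∷ 391 ∷ 1547 ∷ 1557 ∷ 185 ∷ 345 ∷ 1825 ∷ 1729 ∷ 1236 ∷ 1816 ∷ [] , branch 1 2 9 1491859837617437375228558586973 [])
  ∷ (31 ∷ 167 ∷ 327 ∷ 1547 ∷ 1557 ∷ 313 ∷ 217 ∷ 1633 ∷ 1921 ∷ 1428 ∷ 1816 ∷ [] , branch 1 2 9 1354489285649977996565971612765 [])
  ∷ (31 ∷ 103 ∷ 391 ∷ 1547 ∷ 1557 ∷ 185 ∷ 345 ∷ 1825 ∷ 1729 ∷ [] , branch 1 3 5 83989868747207773
   ( branch 1 2 9 299717567929002280718368322653 [] ∷ copy 6 282458553905 ∷ copy 5 281815915315
   ∷ copy 6 282440806615 ∷ copy 5 281798231385 ∷ copy 4 282458552695 ∷ copy 4 282262070475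
   ∷ copy 3 282458552695 ∷ copy 2 281994709975 ∷ copy 4 281994725815 ∷ copy 3 282440810245
   ∷ copy 2 282208880965 ∷ branch 1 2 9 1490898694472225815323890234461 []
   ∷ branch 1 2 9 1922286301516211007515604061
     ( copy 0 281836851945 ∷ copy 1 282047828755 ∷ copy 1 282208879755 ∷ copy 0 282419856565 ∷ [])
   ∷ branch 1 2 9 1490898326431266522534077609053 [] ∷ []))
  ∷ (31 ∷ 109 ∷ 397 ∷ 182 ∷ 342 ∷ 1564 ∷ 1828 ∷ 1732 ∷ [] , branch 0 2 9 449576351893503421077548412183 (copy 0 282458551355 ∷ []))
  ∷ (31 ∷ 115 ∷ 403 ∷ 188 ∷ 348 ∷ 1840 ∷ 1744 ∷ [] , branch 0 4 9 749293919811412601681709594065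
   ( branch 2 4 9 749293919811412646262226765265
     ( branch 0 2 5 12101466494579097660
       ( branch 0 5 7 149858783971711645774309848157 [] ∷ copy 33 282458537805
       ∷ copy 31 282440822195 ∷ copy 30 282228234875 ∷ copy 29 282458537805
       ∷ copy 28 281815912525 ∷ copy 31 282458506125 ∷ copy 33 282440790515
       ∷ copy 30 282033331485 ∷ copy 29 282440790515 ∷ copy 28 281798228595
       ∷ copy 26 282458536595 ∷ copy 26 282262054375 ∷ copy 22 282458536595
       ∷ copy 21 281994693875 ∷ copy 26 281994709715 ∷ copy 22 282440794145
       ∷ copy 21 282208864865
       ∷ branch 0 6 9 1498521341345409444439120366810
         ( branch 0 7 9 149858783964639803553357067357 []
         ∷ branch 0 3 5 150256268200518094579852997725 []
         ∷ branch 0 3 9 149863752517451352286944130141 [] ∷ copy 24 282263319085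
         ∷ copy 24 282204568725 ∷ branch 0 7 9 253607138118015067632512889949 []
         ∷ branch 1 2 9 1498582319018520812733102869350
           ( branch 1 3 9 1498587801295310012622527581030
             ( branch 5 6 9 1488614849617935153685486266850
               ( branch 0 2 6 1383311427061371578691410442300
                 ( branch 0 3 5 149858783964501140359185790045 [] ∷ copy 20 281604314475
                 ∷ copy 18 270900508605 ∷ copy 19 281599060655 ∷ copy 17 270737453145
                 ∷ copy 19 281604049025 ∷ copy 18 270847066295 ∷ copy 20 281598648795
                 ∷ copy 17 270779645815 ∷ copy 19 270796818155 ∷ copy 20 270796717735
                 ∷ copy 16 281574491925 ∷ copy 19 270760877525
                 ∷ branch 1 5 7 1198783447515148513418507514973 [] ∷ copy 16 281571460965 ∷ []) ∷ []) ∷ []) ∷ [])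
         ∷ branch 1 8 9 1348729407002032393766437762141 []
         ∷ branch 0 3 9 149863752517451352286944130141 [] ∷ [])
       ∷ branch 1 2 6 12101466494579097660
         ( branch 1 2 5 312205197677201602210515727453 []
         ∷ branch 1 2 8 299803750853632499959114839133 []
         ∷ branch 2 5 6 449576351893503411350899078237 [] ∷ copy 32 281819165225
         ∷ branch 1 2 5 312205197677201592484329763933 []
         ∷ branch 1 2 5 312205197677201592484329763933 []
         ∷ branch 0 3 5 624238251863222298714071804090 []
         ∷ branch 1 2 8 446713913330322144953452636347 (copy 15 281824540295 ∷ [])
         ∷ branch 1 2 5 449576340070323151065625831611 (branch 1 2 7 299797110781325589848306935994 [] ∷ [])
         ∷ branch 1 2 8 448621837663203525212655233211 []
         ∷ branch 1 2 8 435266367333033863398237055163 (copy 14 281994029585 ∷ [])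
         ∷ copy 13 282409301585
         ∷ branch 1 2 10 311170638720543011804253513914 (copy 11 282262013125 ∷ [])
         ∷ branch 1 2 7 276650156037038504093577832634
           ( copy 15 282409301835 ∷ copy 14 282261533965
           ∷ branch 1 2 8 299797110781325589848306935994 []
           ∷ branch 1 2 8 299803689540095954085991147706 [] ∷ copy 12 282409261905
           ∷ copy 10 282456884835 ∷ copy 9 282456006375 ∷ [])
         ∷ branch 1 2 8 297895803544814499044548143290
           ( branch 1 2 7 299803689540095954085991147706 [] ∷ copy 9 281798771885 ∷ [])
         ∷ copy 13 281824540045
         ∷ branch 2 5 9 1498582068105538661844915856090
           ( branch 1 2 5 449576351893503421077550855261 []
           ∷ branch 1 2 5 449576351893503421077550855261 []
           ∷ branch 1 2 5 449576351893503421077550855261 []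
           ∷ branch 1 2 8 449576351893503421077550855261 [] ∷ copy 12 282409261905
           ∷ branch 1 2 8 299797110781325589848306935994 []
           ∷ branch 1 2 5 449576351893503421077557370135 []
           ∷ branch 0 2 7 449576351893503421077557370135 []
           ∷ branch 0 2 7 449576351893503421077557370135 [] ∷ [])
         ∷ branch 0 2 7 12101466494579097660
           ( branch 1 3 6 301625492261883660977570919517 []
           ∷ branch 0 2 6 149872033439035038833208030301 []
           ∷ branch 1 2 5 300671530095442970847969621085 []
           ∷ branch 0 2 6 149872033439035038833208030301 []
           ∷ branch 1 2 8 299717571762762273165843444829 []
           ∷ branch 0 3 5 149905157125369785018263630941 []
           ∷ branch 0 3 8 149878677345101950307594761309 []
           ∷ branch 0 2 9 151781070254520913616515953759 []
           ∷ branch 0 3 5 149878658176301988070219150429 []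
           ∷ branch 0 3 5 149878658176301988071079113821 []
           ∷ branch 1 2 5 449576351893503421077550855261 [] ∷ copy 11 282458509975
           ∷ branch 0 2 6 149872033439035038833208030301 []
           ∷ branch 0 2 6 449576251518696365542349698141 []
           ∷ branch 1 2 8 449576351893503421077550855261 [] ∷ copy 11 281798200875
           ∷ branch 1 2 5 446714453892901373346328108311
             ( branch 1 2 8 299717617794505515822023174330 []
             ∷ branch 2 5 6 449574695709186683768304590103 (branch 1 5 7 899152653602023471513269270939 [] ∷ []) ∷ [])
           ∷ branch 1 2 5 449576351893503421077550855261 [] ∷ copy 10 281993072585
           ∷ branch 0 3 5 149905157125369785018263630941 []
           ∷ branch 0 3 5 149905157125369785018263630941 [] ∷ [])
         ∷ branch 1 2 5 449576340392223443735132003607 (branch 1 2 7 299717613934122190088073046202 [] ∷ [])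
         ∷ branch 1 2 5 449576340392223443735132003607 (branch 1 2 7 299717617794505515822023174330 [] ∷ [])
         ∷ branch 1 2 5 449576301706099893309523552442 [] ∷ [])
       ∷ branch 0 2 8 1386365431277857358034451919965
         ( branch 1 2 5 449576363394783398419976221789 [] ∷ copy 27 281798227495 ∷ []) ∷ []) ∷ [])
   ∷ copy 0 282458520895 ∷ copy 0 282458535525 ∷ []))
  ∷ (31 ∷ 115 ∷ 188 ∷ 1840 ∷ 1744 ∷ [] , branch 0 4 7 749293919822505701795928846545
   ( branch 2 4 6 749293919822428666688056018385 (copy 0 282458553905 ∷ []) ∷ []))
  ∷ (211 ∷ 118 ∷ 236 ∷ 376 ∷ 1984 ∷ [] , branch 0 6 8 1049010935051108857349115537348
   ( branch 0 3 6 1049011487751474600365770354315 [] ∷ copy 61 282458245345 ∷ []))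
  ∷ (203 ∷ 121 ∷ 370 ∷ 844 ∷ 244 ∷ 1984 ∷ [] , branch 0 2 6 1049011487751507982514300530315 [])
  ∷ (115 ∷ 61 ∷ 286 ∷ 220 ∷ 1456 ∷ 1872 ∷ [] , branch 0 4 7 749293919822505701795928950225 [])
  ∷ (227 ∷ 110 ∷ 220 ∷ 880 ∷ 1984 ∷ [] , branch 0 4 6 1049011487751507982514300530315 [])
  ∷ (115 ∷ 62 ∷ 220 ∷ 1712 ∷ 1872 ∷ [] , branch 0 4 7 749293919822505701795928950225 [])
  ∷ (205 ∷ 242 ∷ 124 ∷ 1984 ∷ [] , branch 0 6 8 1048408287601683219838764463872
   ( copy 65 282458009695 ∷ copy 65 282458170625 ∷ copy 65 282458345325 ∷ copy 65 282458506255
   ∷ copy 41 282457854065 ∷ copy 5 280187767015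
   ∷ branch 1 6 8 1049011487565144649548103822987 (branch 0 1 6 1049011487751507982514300530315 [] ∷ [])
   ∷ copy 4 282458066925 ∷ copy 4 282458081555 ∷ copy 4 282458227855 ∷ copy 4 282458242485
   ∷ branch 1 6 8 1049011487734683447340839661104
     ( copy 67 282457764625 ∷ copy 67 282457764745
     ∷ branch 0 1 6 87417623979292331876191710859 (copy 6 280978527425 ∷ [])
     ∷ copy 3 282458552445 ∷ copy 2 282342951465 ∷ copy 3 282458553775 ∷ copy 2 282343112515 ∷ [])
   ∷ copy 1 282458334335 ∷ copy 0 280180194735 ∷ copy 1 282458495375 ∷ copy 0 280180355775 ∷ []))
  ∷ (199 ∷ 203 ∷ 244 ∷ 376 ∷ 1984 ∷ [] , branch 0 6 8 1049011487751507982514300530315 [])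
  ∷ (227 ∷ 370 ∷ 220 ∷ 236 ∷ 1984 ∷ [] , branch 0 6 8 1049011487724883365309540132811 (branch 1 2 6 1049011487751507982514300530315 [] ∷ []))
  ∷ (199 ∷ 234 ∷ 372 ∷ 248 ∷ 1984 ∷ [] , branch 1 6 8 1048924814078974112792228800375 (branch 2 3 6 1049011487352107589163752635234 [] ∷ []))
  ∷ (199 ∷ 218 ∷ 868 ∷ 248 ∷ 1984 ∷ [] , branch 0 5 6 1049011487751507982514300530315 [])
  ∷ (115 ∷ 62 ∷ 188 ∷ 1840 ∷ 1760 ∷ [] , branch 0 5 7 899152653602023500692794620318 [])
  ∷ (211 ∷ 236 ∷ 244 ∷ 376 ∷ 1984 ∷ [] , branch 0 6 8 1048924814078973898804958078635 [])
  ∷ (203 ∷ 244 ∷ 248 ∷ 1984 ∷ [] , branch 2 6 8 1049011487734673710919999174400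
   ( copy 5 282457849975 ∷ copy 4 282458205415 ∷ copy 3 282458366015 ∷ copy 3 282458525735
   ∷ copy 2 282458086505 ∷ copy 1 280207107775 ∷ copy 4 282458205425 ∷ copy 3 282458366135
   ∷ copy 3 282458525855 ∷ copy 2 282458086625 ∷ copy 1 280208879335 ∷ copy 0 282458377245
   ∷ copy 0 282458538175 ∷ branch 0 2 6 1049011487751507982514300530315 []
   ∷ branch 0 2 6 1049011487751507982514300530315 [] ∷ []))
  ∷ (199 ∷ 331 ∷ 372 ∷ 248 ∷ 632 ∷ 1984 ∷ [] , branch 0 4 6 1049011487750949157002584735371 (branch 2 3 6 1049011483890752106444810235531 [] ∷ []))
  ∷ (143 ∷ 279 ∷ 551 ∷ 1095 ∷ 1081 ∷ 601 ∷ 361 ∷ 241 ∷ 1921 ∷ [] , branch 1 3 8 558710468676814920335193181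
   ( branch 1 3 10 574458679535878459138384147549 []
   ∷ branch 3 6 7 599435135882207581965435090013 []
   ∷ branch 2 3 4 599435136177484541354052760669 []
   ∷ branch 2 4 6 749293919820085379317080601693 []
   ∷ branch 3 6 10 599435135858004541983429833821 []
   ∷ branch 1 4 6 1047102409103504661396209972317 []
   ∷ branch 1 3 4 599435135858004561436733387869 []
   ∷ branch 2 3 6 599435135858004561436733387869 []
   ∷ branch 2 3 8 599435135858004541983429833821 []
   ∷ branch 3 6 10 599435135858004559950644982877 []
   ∷ branch 2 3 9 599647225735198286234663302237
     ( branch 1 4 5 749293923653845381491207500893 []
     ∷ branch 1 4 6 1024035042923804128059549660253 []
     ∷ branch 2 4 5 749293919820085408497000100957 []
     ∷ branch 1 5 6 899152703782166226377383146589 []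
     ∷ branch 2 3 8 599355639008380867567068181597 []
     ∷ branch 2 4 6 1047102459288487895865324713053 [] ∷ []) ∷ []))
  ∷ (203 ∷ 339 ∷ 364 ∷ 244 ∷ 632 ∷ 1984 ∷ [] , branch 0 5 6 1048050348786361430711249616523
   ( branch 0 2 6 1049011437566524748045614029307
     ( branch 2 6 10 1048924814105597981039140939723 (copy 0 279923272965 ∷ []) ∷ []) ∷ []))
  ∷ (203 ∷ 341 ∷ 362 ∷ 244 ∷ 632 ∷ 1984 ∷ [] , branch 0 6 9 1049011479444426804057079426692 (branch 0 5 6 1049011487751507982514300530315 [] ∷ []))
  ∷ (31 ∷ 295 ∷ 583 ∷ 1219 ∷ 1669 ∷ 233 ∷ 1801 ∷ 1585 ∷ 465 ∷ 186 ∷ [] , branch 1 2 7 299717567929002280718368322653 [])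
  ∷ (31 ∷ 295 ∷ 583 ∷ 1667 ∷ 1221 ∷ 233 ∷ 1801 ∷ 1585 ∷ 465 ∷ 186 ∷ [] , branch 1 2 7 299717567929002280718368322653 [])
  ∷ (31 ∷ 227 ∷ 1795 ∷ 301 ∷ 589 ∷ 1221 ∷ 1673 ∷ 1585 ∷ 465 ∷ 690 ∷ [] , branch 6 7 9 1198870087684435894771093845085 [])
  ∷ (527 ∷ 55 ∷ 199 ∷ 1291 ∷ 1797 ∷ 345 ∷ 425 ∷ 1681 ∷ 1633 ∷ 1504 ∷ [] , branch 2 3 8 524505741000433626159050945629 (branch 2 3 4 599435135857987870429151294557 [] ∷ []))
  ∷ (527 ∷ 55 ∷ 199 ∷ 1291 ∷ 1797 ∷ 345 ∷ 425 ∷ 1681 ∷ 1633 ∷ [] , branch 4 5 8 1373710673639092817794761929821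
   ( branch 1 2 10 299717567929002280718368322653 [] ∷ copy 3 282258544535 ∷ copy 3 282044333395
   ∷ branch 1 2 8 299717567929002280718368322653 []
   ∷ branch 2 3 6 449576401734786925253568296029 [] ∷ copy 2 282258544425 ∷ copy 2 282044333285
   ∷ branch 1 2 8 449576351893503420334542484573 []
   ∷ branch 1 3 4 599435135858004561431107794013 [] ∷ copy 1 282258541785 ∷ copy 0 282398525805
   ∷ copy 1 282044329325 ∷ copy 0 282416387825 ∷ []))
  ∷ (527 ∷ 55 ∷ 199 ∷ 1294 ∷ 346 ∷ 426 ∷ 1682 ∷ 1634 ∷ [] , branch 0 1 8 24976463994083523393197631674 (copy 0 282458553675 ∷ []))
  ∷ (527 ∷ 59 ∷ 1099 ∷ 395 ∷ 213 ∷ 357 ∷ 1605 ∷ 1809 ∷ 1697 ∷ 118 ∷ [] , branch 2 4 9 449576351893503421072355243101 [])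
  ∷ (31 ∷ 295 ∷ 583 ∷ 1159 ∷ 233 ∷ 1801 ∷ 1585 ∷ 465 ∷ 1729 ∷ 186 ∷ [] , branch 1 6 7 374126895032122881520578933853 [])
  ∷ (31 ∷ 551 ∷ 1095 ∷ 391 ∷ 233 ∷ 1801 ∷ 369 ∷ 1681 ∷ 1633 ∷ 602 ∷ [] , branch 1 6 7 299557408901168615041434465373
   ( branch 1 4 7 299717567929002280718368322653 []
   ∷ branch 1 3 7 299717567929002280718368322653 []
   ∷ branch 5 7 9 899152703787006803248491344989 []
   ∷ branch 1 4 5 299717567929063908804666668125 [] ∷ []))
  ∷ (527 ∷ 59 ∷ 203 ∷ 1291 ∷ 341 ∷ 421 ∷ 1797 ∷ 1681 ∷ 1633 ∷ 1480 ∷ [] , branch 1 2 8 524505743875753942623865320541 [])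
  ∷ (31 ∷ 227 ∷ 1795 ∷ 301 ∷ 589 ∷ 1165 ∷ 1585 ∷ 465 ∷ 1729 ∷ 690 ∷ [] , branch 1 2 9 1475691643527525131509524542557 (branch 1 2 7 300197908677253903937051898973 [] ∷ []))
  ∷ (527 ∷ 55 ∷ 199 ∷ 1287 ∷ 345 ∷ 425 ∷ 1801 ∷ 1681 ∷ 1633 ∷ 1504 ∷ [] , branch 1 3 8 661876292967893054603198755933 (branch 1 3 4 599435135858004561436733387869 [] ∷ []))
  ∷ (527 ∷ 115 ∷ 403 ∷ 1054 ∷ 174 ∷ 334 ∷ 1826 ∷ 1730 ∷ [] , branch 0 1 10 299717567924565058504890706106
   ( branch 4 5 7 1373708279981788368261265515457
     ( copy 5 282435860125 ∷ copy 5 282435858805 ∷ branch 0 2 4 174836352134740183216542512222 []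
     ∷ copy 4 282389670795 ∷ copy 4 281961248515 ∷ copy 3 282434765075 ∷ copy 2 281599857705
     ∷ copy 4 282389670685 ∷ copy 4 281961248405 ∷ copy 3 282434764965 ∷ copy 2 281599859025
     ∷ copy 1 282389668045 ∷ copy 0 281564131355 ∷ copy 1 281961243125 ∷ copy 0 281599855395 ∷ []) ∷ []))
  ∷ (527 ∷ 61 ∷ 205 ∷ 342 ∷ 422 ∷ 1804 ∷ 1684 ∷ 1636 ∷ [] , branch 0 2 8 449576351893503421077548412183 (copy 8 282458551355 ∷ []))
  ∷ (115 ∷ 403 ∷ 542 ∷ 188 ∷ 348 ∷ 1840 ∷ 1744 ∷ [] , branch 0 2 4 62441159985208763902476907985
   ( copy 8 280763504145 ∷ copy 1 282458495375 ∷ copy 0 280763505685 ∷ []))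
  ∷ (31 ∷ 103 ∷ 1411 ∷ 1797 ∷ 425 ∷ 1609 ∷ 1585 ∷ 465 ∷ [] , branch 0 1 9 149858783964501140359185769309 (copy 10 282437124805 ∷ []))
  ∷ (31 ∷ 103 ∷ 1414 ∷ 426 ∷ 1610 ∷ 1586 ∷ 466 ∷ [] , branch 0 1 7 23068539661202143133994537146
   ( copy 10 282437124805 ∷ copy 3 281986974555 ∷ copy 0 282263681965 ∷ []))
  ∷ (61 ∷ 205 ∷ 342 ∷ 422 ∷ 1804 ∷ 1684 ∷ 1636 ∷ [] , branch 0 2 8 449576351893503421077547665684
   ( copy 36 282222833805 ∷ copy 3 281385155635 ∷ copy 1 282343579575 ∷ []))
  ∷ (331 ∷ 213 ∷ 234 ∷ 628 ∷ 376 ∷ 1984 ∷ [] , branch 0 5 6 1049011487751457588714566987367 [])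
  ∷ (47 ∷ 1039 ∷ 87 ∷ 409 ∷ 1585 ∷ 1473 ∷ [] , branch 0 1 7 148904821798060450229584491613 (branch 0 2 7 149858783964501140359185790045 [] ∷ []))
  ∷ (47 ∷ 87 ∷ 1294 ∷ 410 ∷ 1586 ∷ 1474 ∷ [] , branch 0 1 8 299717567929002280718371580090 [])
  ∷ (47 ∷ 91 ∷ 412 ∷ 1592 ∷ 1480 ∷ [] , branch 2 3 10 599435135858004558217039142256
   ( copy 1 282458552445 ∷ copy 0 282263680645 ∷ copy 0 282458552355 ∷ copy 0 282263680765
   ∷ copy 0 282458552475 ∷ []))
  ∷ (233 ∷ 214 ∷ 362 ∷ 372 ∷ 632 ∷ 1984 ∷ [] , branch 0 1 6 1049011437566524641051980410363 [])
  ∷ (203 ∷ 369 ∷ 618 ∷ 348 ∷ 244 ∷ 1984 ∷ [] , branch 0 2 6 1049011487751474386647739838091 [])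
  ∷ (539 ∷ 115 ∷ 188 ∷ 348 ∷ 1840 ∷ 1744 ∷ [] , branch 0 4 7 749293919822505701795928846545 (copy 9 282440835415 ∷ []))
  ∷ (205 ∷ 342 ∷ 242 ∷ 620 ∷ 376 ∷ 1984 ∷ [] , branch 0 4 6 1049011487750903256907106791051 [])
  ∷ (157 ∷ 109 ∷ 62 ∷ 458 ∷ 1368 ∷ 1704 ∷ [] , branch 0 1 3 599435135858004561436743158295 [])
  ∷ (31 ∷ 167 ∷ 327 ∷ 1543 ∷ 617 ∷ 1417 ∷ 1137 ∷ 913 ∷ [] , branch 0 5 8 149858231903062227922768196701 (copy 83 281526920455 ∷ []))
  ∷ (31 ∷ 391 ∷ 1543 ∷ 107 ∷ 117 ∷ 681 ∷ 1321 ∷ 1233 ∷ 849 ∷ 158 ∷ [] , branch 1 2 5 299717567929002280718368322653 [])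
  ∷ (79 ∷ 55 ∷ 395 ∷ 1547 ∷ 677 ∷ 1317 ∷ 121 ∷ 1233 ∷ 849 ∷ 158 ∷ [] , branch 1 2 8 299717567929002280718368322653 [])
  ∷ (31 ∷ 103 ∷ 403 ∷ 1555 ∷ 677 ∷ 1317 ∷ 121 ∷ 1225 ∷ 841 ∷ 398 ∷ [] , branch 1 2 9 299717567929002280718368322653 [])
  ∷ (31 ∷ 103 ∷ 419 ∷ 1571 ∷ 661 ∷ 1301 ∷ 121 ∷ 1225 ∷ 841 ∷ 398 ∷ [] , branch 1 2 9 299717567929002280718368322653 [])
  ∷ (31 ∷ 391 ∷ 1543 ∷ 107 ∷ 117 ∷ 681 ∷ 1321 ∷ 1233 ∷ 849 ∷ 1888 ∷ [] , branch 5 6 7 910513475823838467527600518237 [])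
  ∷ (31 ∷ 103 ∷ 395 ∷ 1547 ∷ 677 ∷ 1317 ∷ 121 ∷ 1233 ∷ 849 ∷ [] , branch 1 2 7 556778891676237453541356637
   ( copy 4 282458552695 ∷ branch 1 2 8 299717567929002280718368322653 [] ∷ copy 3 282455040065
   ∷ copy 3 280314645545 ∷ branch 1 2 8 299830188465317533386376557661 [] ∷ copy 2 282458540595
   ∷ copy 1 280314951675 ∷ copy 4 280311126865 ∷ copy 1 282454707315 ∷ copy 2 280311118395
   ∷ branch 1 2 10 300680919293375579408785552477 [] ∷ copy 0 277772280225 ∷ copy 0 277968789285 ∷ []))
  ∷ (47 ∷ 87 ∷ 395 ∷ 1547 ∷ 661 ∷ 1301 ∷ 1249 ∷ 865 ∷ [] , branch 0 3 4 149858783964501033365980410973 (copy 0 282458407495 ∷ []))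
  ∷ (31 ∷ 103 ∷ 1159 ∷ 425 ∷ 1353 ∷ 1585 ∷ 721 ∷ [] , branch 0 1 8 149858783964316255357282134109
   ( copy 7 277901808855 ∷ copy 0 277280177405 ∷ copy 0 277083387845 ∷ []))
  ∷ (59 ∷ 203 ∷ 348 ∷ 684 ∷ 1432 ∷ 1640 ∷ [] , branch 0 2 3 599435135858004561436731216244 (copy 0 282363066505 ∷ []))
  ∷ (121 ∷ 286 ∷ 174 ∷ 460 ∷ 1240 ∷ 1832 ∷ [] , branch 0 2 3 599435135858004454443071967604 [])
  ∷ (199 ∷ 346 ∷ 364 ∷ 628 ∷ 248 ∷ 1984 ∷ [] , branch 0 6 9 1049004310952802120840871816843 [])
  ∷ (203 ∷ 358 ∷ 244 ∷ 376 ∷ 632 ∷ 1984 ∷ [] , branch 0 4 6 1049011437565923553224160783867 [])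
  ∷ (79 ∷ 55 ∷ 155 ∷ 1795 ∷ 285 ∷ 1669 ∷ 1577 ∷ 1617 ∷ 481 ∷ 558 ∷ [] , branch 1 3 8 299717567929002494704779080797 [])
  ∷ (47 ∷ 87 ∷ 155 ∷ 1795 ∷ 285 ∷ 1669 ∷ 1609 ∷ 1585 ∷ 481 ∷ 614 ∷ [] , branch 1 2 7 299717567929002280718368322653 [])
  ∷ (47 ∷ 199 ∷ 115 ∷ 1795 ∷ 1557 ∷ 357 ∷ 409 ∷ 1609 ∷ 1697 ∷ 666 ∷ 1250 ∷ [] , branch 1 2 4 299720880297635755336873882717 [])
  ∷ (31 ∷ 103 ∷ 171 ∷ 1795 ∷ 301 ∷ 1669 ∷ 1609 ∷ 1585 ∷ 465 ∷ 722 ∷ 1250 ∷ [] , branch 1 2 9 299717567929002280718368322653 [])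
  ∷ (47 ∷ 87 ∷ 283 ∷ 1667 ∷ 157 ∷ 1797 ∷ 1609 ∷ 1585 ∷ 481 ∷ 738 ∷ [] , branch 1 3 6 299717567929002280718368322653 [])
  ∷ (47 ∷ 87 ∷ 155 ∷ 1795 ∷ 285 ∷ 1669 ∷ 1609 ∷ 1585 ∷ 481 ∷ 1936 ∷ [] , branch 1 4 5 749293919822501850039124833373 [])
  ∷ (47 ∷ 87 ∷ 155 ∷ 1795 ∷ 1669 ∷ 1609 ∷ 1585 ∷ 481 ∷ [] , branch 0 2 8 149858783964501140359149958237
   ( branch 1 5 9 274741335695847113340324263005
     ( branch 1 4 9 299717567929002280718368322653 [] ∷ copy 5 282458540595 ∷ copy 4 282458553905
     ∷ copy 5 282440810465 ∷ copy 4 282440837085 ∷ branch 1 2 7 307349265260527801755178710109 []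
     ∷ branch 1 5 10 299717561299763833635977933917
       ( branch 1 4 9 299717567929002280718368322653 [] ∷ copy 3 282412366995
       ∷ copy 2 282436857395 ∷ copy 3 282414151745 ∷ copy 2 282456490855
       ∷ branch 1 2 7 276822475934425717607937160285
         ( branch 1 3 6 276822475934425717607937160285
           ( branch 1 2 9 299717567929002280718296659037
             ( branch 2 3 6 449337861351893238818498753629
               ( branch 2 4 5 449337861351893238818498753629
                 ( branch 2 5 6 446714465394181340962095182941
                   ( branch 3 4 5 599434951835104611205743981661
                     ( branch 3 5 7 595619287189821488166144652381
                       -- Twelve nested branches above eight given blocks have now produced all
                       -- twenty. The index 136 passes over the 136 earlier configurations and names
                       -- `standard`.
                       ( branch 4 6 7 744524058800478400901509362781 (copy 136 272602232705 ∷ []) ∷ []) ∷ []) ∷ []) ∷ []) ∷ []) ∷ []) ∷ []) ∷ []) ∷ [])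
     ∷ copy 1 282263682195 ∷ copy 0 281993071525 ∷ copy 1 282051093665 ∷ copy 0 282205660165 ∷ []) ∷ []))
  ∷ (115 ∷ 410 ∷ 188 ∷ 348 ∷ 1840 ∷ 1744 ∷ [] , branch 0 3 4 62441159985208701489788699957
   ( branch 1 2 4 62441159985208798756342302160 (copy 0 280626823745 ∷ []) ∷ []))
  ∷ (199 ∷ 362 ∷ 372 ∷ 248 ∷ 1984 ∷ [] , branch 1 6 9 1049010613467856635133665995335
   ( copy 29 282458190335 ∷ copy 24 282458404945 ∷ copy 22 282458243815 ∷ copy 22 282458406065
   ∷ copy 9 282458234355 ∷ copy 8 282458536855 ∷ branch 0 6 8 1049004310926177503636362241995 []
   ∷ copy 0 281621764985 ∷ []))
  ∷ (61 ∷ 206 ∷ 342 ∷ 678 ∷ 1804 ∷ 1684 ∷ 1380 ∷ [] , branch 0 1 2 449576351893503421077557370135 [])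
  ∷ (115 ∷ 666 ∷ 188 ∷ 348 ∷ 1840 ∷ 1744 ∷ [] , branch 1 2 4 692056189836064294019851044305 (copy 0 280219420855 ∷ []))
  ∷ (199 ∷ 362 ∷ 628 ∷ 248 ∷ 1984 ∷ [] , branch 1 6 9 1049003959640977426459498113607
   ( copy 51 280314655205 ∷ branch 0 6 8 1049011487751507982514300530315 []
   ∷ branch 0 6 9 1049011487751507982514299173830 []
   ∷ branch 0 4 6 1049011487751505411682978400495 [] ∷ copy 12 280314658855
   ∷ copy 11 280314948045 ∷ branch 0 3 6 1046149601251585038284087766667 []
   ∷ branch 0 3 6 1046129727039826559882383170235 []
   ∷ branch 0 3 6 1049011487751507982514300530315 []
   ∷ branch 0 4 6 1049011437566524641051980410363 []
   ∷ branch 0 4 6 1049011487751507982514228866673 []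
   ∷ branch 0 6 9 1049011487751507982514300530315 [] ∷ copy 0 282391588765 ∷ []))
  ∷ (79 ∷ 55 ∷ 1163 ∷ 1317 ∷ 409 ∷ 1617 ∷ [] , branch 0 5 6 149858231903062227922768196701 (branch 0 1 8 149858783964501140359185790045 [] ∷ []))
  ∷ (79 ∷ 182 ∷ 1078 ∷ 314 ∷ 1674 ∷ 1378 ∷ [] , branch 0 1 4 299717567929002280718371580090 [])
  ∷ (79 ∷ 182 ∷ 1302 ∷ 314 ∷ 1674 ∷ 1378 ∷ [] , branch 0 1 7 299717567929002280718371580090 [])
  ∷ (93 ∷ 174 ∷ 310 ∷ 1804 ∷ 1684 ∷ 1380 ∷ [] , branch 1 2 6 449556477681702573366524009751 (copy 5 282456943395 ∷ []))
  ∷ (91 ∷ 174 ∷ 316 ∷ 1688 ∷ 1384 ∷ [] , branch 1 3 10 46110565037556943587856851312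
   ( copy 3 281895678375 ∷ branch 2 3 6 599435135858004561436743160180 []
   ∷ branch 0 2 3 587907540952073976600976544116 [] ∷ copy 2 282458525855
   ∷ branch 0 3 7 599435135858004561436737187900 []
   ∷ branch 0 2 3 587908093013512880059370349532 [] ∷ copy 1 282458525855
   ∷ branch 0 2 3 599435135858004561436743160180 []
   ∷ branch 0 3 7 599435135858004561436743160180 []
   ∷ branch 0 3 7 599435135858004561436743160180 []
   ∷ branch 0 3 7 599435135858004561436743160180 []
   ∷ branch 0 3 7 599435135858004561436743160180 [] ∷ copy 0 282458551375 ∷ []))
  ∷ (199 ∷ 346 ∷ 484 ∷ 248 ∷ 1984 ∷ [] , branch 1 5 6 1049011487751507982514300530315 [])
  ∷ (199 ∷ 346 ∷ 740 ∷ 248 ∷ 1984 ∷ [] , branch 0 6 8 1049011487751507982514300530315 [])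
  ∷ (115 ∷ 158 ∷ 316 ∷ 1392 ∷ 1712 ∷ [] , branch 0 4 7 749293919822505701795928950225 [])
  ∷ (203 ∷ 866 ∷ 348 ∷ 244 ∷ 632 ∷ 1984 ∷ [] , branch 0 4 6 1047089209821214878908240506507 [])
  ∷ (59 ∷ 906 ∷ 348 ∷ 236 ∷ 1240 ∷ 1832 ∷ [] , branch 0 3 6 599435135858004561436743160180 [])
  ∷ (143 ∷ 279 ∷ 551 ∷ 1095 ∷ 121 ∷ 1801 ∷ 1681 ∷ 1441 ∷ 961 ∷ [] , branch 1 3 8 4457406582764649438671965
   ( branch 1 6 8 306399167525462675922017662045 []
   ∷ branch 1 5 8 379854254355631903836235445341 []
   ∷ branch 2 3 8 1348728503299591283339043091549 []
   ∷ branch 2 3 8 1348728503299591283339043091549 []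
   ∷ branch 5 7 9 1198870271716009064513552856157 []
   ∷ branch 2 3 8 4457646205282432743076957
     ( branch 2 5 8 506817119988395891010686743645 []
     ∷ branch 1 7 8 1348469034650811574231354946653 []
     ∷ branch 1 3 9 599435433148442333784610124893 []
     ∷ branch 1 8 9 1323924934579112971394620650589 []
     ∷ branch 1 3 9 599435135858004551710081610845 []
     ∷ branch 1 3 4 599435135858004551715241391197 []
     ∷ branch 1 3 4 1423658447662760833412255233117 [] ∷ [])
   ∷ branch 2 8 10 1348729055680510263232646050909 []
   ∷ branch 1 5 8 1348729055680494856149154100317 []
   ∷ branch 1 5 8 378503132411736953634434397277 (branch 2 5 8 1347774541452615185558490133597 [] ∷ [])
   ∷ branch 2 7 8 1198870271716009064513552856157 []
   ∷ branch 2 7 9 1198870271716009064513767847005 []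
   ∷ branch 1 7 8 1348729055668476095397316572253 [] ∷ []))
  ∷ (199 ∷ 346 ∷ 868 ∷ 248 ∷ 1984 ∷ [] , branch 1 5 6 87417275090308551596486377099
   ( copy 26 280706923335 ∷ copy 2 282458536855 ∷ copy 1 282414547305 ∷ copy 2 282458551375
   ∷ copy 1 282416318745
   ∷ branch 0 6 9 1049011487751507233561862876811
     ( branch 0 6 8 1048455009821084246605366439563
       ( branch 2 3 6 1049011437550994363304797351419 (copy 0 273058925695 ∷ []) ∷ []) ∷ []) ∷ []))
  ∷ (181 ∷ 542 ∷ 122 ∷ 348 ∷ 1840 ∷ 1744 ∷ [] , branch 0 3 4 748339957655864720385858029009 [])
  ∷ (93 ∷ 302 ∷ 182 ∷ 1196 ∷ 1812 ∷ 1476 ∷ [] , branch 0 2 5 449576351893503421077557370135 [])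
  ∷ (115 ∷ 286 ∷ 188 ∷ 1840 ∷ 1488 ∷ [] , branch 1 4 7 62441159973191283359271373265
   ( copy 41 280297246605 ∷ copy 1 280297248055 ∷ copy 0 282458082995 ∷ copy 1 280297249375
   ∷ copy 0 282458244035
   ∷ branch 0 4 10 749293919822505701795749791185
     ( branch 2 4 6 749293919821581280501453768145
       ( branch 0 4 8 744524108990302251147922458065 (copy 3 282253225995 ∷ []) ∷ []) ∷ []) ∷ []))
  ∷ (181 ∷ 286 ∷ 122 ∷ 604 ∷ 1840 ∷ 1744 ∷ [] , branch 0 3 4 748339957655864720385858029009 [])
  ∷ (93 ∷ 174 ∷ 310 ∷ 1324 ∷ 1684 ∷ 1860 ∷ [] , branch 0 2 5 449576351893503421077557370135 [])
  ∷ (115 ∷ 158 ∷ 316 ∷ 1712 ∷ 1872 ∷ [] , branch 1 4 8 62441159973191283359272617425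
   ( copy 1 282228249545 ∷ copy 0 282458082995 ∷ copy 1 282228250865 ∷ copy 0 282458244035
   ∷ branch 0 4 9 749293919822505701795749791185 (branch 0 4 7 749293919822505701795928950225 [] ∷ []) ∷ []))
  ∷ (203 ∷ 244 ∷ 376 ∷ 1984 ∷ [] , branch 0 2 6 0
   ( branch 2 6 8 1049011487751457588714459491943 [] ∷ copy 147 282458407495
   ∷ copy 147 282458553905 ∷ copy 80 282458553905
   ∷ branch 2 6 9 1049011487549604635379852098304
     ( copy 73 282262978265 ∷ copy 71 282457732605 ∷ copy 70 282458067125 ∷ copy 70 282458081645
     ∷ copy 71 282457893535 ∷ copy 70 282458068445 ∷ copy 70 282458082965 ∷ copy 71 282263505535
     ∷ copy 71 282263666465
     ∷ branch 0 4 6 87417275107133019155932948123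
       ( copy 88 281389851655 ∷ copy 55 281407561495 ∷ copy 53 280816842905
       ∷ copy 55 281389851645 ∷ copy 53 281752080215 ∷ copy 52 281525391665 ∷ [])
     ∷ copy 73 282458552695 ∷ [])
   ∷ branch 3 6 9 1049011487565144649508975475547
     ( copy 51 280314639365 ∷ copy 51 280314653885 ∷ copy 51 280314640685 ∷ copy 51 280314655205
     ∷ copy 73 279925221675 ∷ [])
   ∷ copy 48 280815076535 ∷ copy 86 282458380865 ∷ copy 86 282458540585
   ∷ branch 1 6 8 1049011487751457588714459491943 []
   ∷ branch 3 6 9 1049011487565144649548103809883
     ( copy 47 282458228185 ∷ copy 47 282458242705
     ∷ branch 1 2 6 1049011487751507953334345199240 [] ∷ [])
   ∷ branch 2 6 8 1049011487751507920062469045076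
     ( copy 71 282457732605 ∷ copy 44 282458066925 ∷ copy 44 282458081555 ∷ copy 46 282458071105
     ∷ copy 46 282458085625 ∷ copy 45 278640385885 ∷ [])
   ∷ branch 2 6 8 1049011487751507977274113588052
     ( branch 0 4 6 979845891479604526367374978699
       ( branch 1 4 6 1049011165715668616926370722987
         ( branch 2 6 9 1049011487751507982514030163115 (copy 72 279916008895 ∷ []) ∷ []) ∷ [])
     ∷ copy 32 282350800425 ∷ copy 32 282350800535 ∷ copy 43 280738826285 ∷ copy 43 280738826405
     ∷ copy 33 280648490995 ∷ [])
   ∷ branch 0 6 8 87417071225645188611850169988
     ( copy 159 282458552355 ∷ branch 1 2 6 1049009279399253435728703450760 []
     ∷ branch 1 4 6 1049011487751507982491941482123 []
     ∷ branch 1 4 6 1049011487751507982491941482123 [] ∷ copy 154 282448101585 ∷ [])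
   ∷ copy 78 282458406275 ∷ copy 21 282458406275 ∷ copy 18 280314817465 ∷ copy 13 281181145675
   ∷ copy 78 282458552685 ∷ copy 21 282458552685 ∷ copy 18 280314963875 ∷ copy 13 281181306605
   ∷ copy 12 282458086505 ∷ copy 11 282458086505 ∷ copy 10 281181612735 ∷ copy 6 282458086505
   ∷ copy 3 282350842995 ∷ copy 0 281181612735 ∷ []))
  ∷ (31 ∷ 103 ∷ 1166 ∷ 186 ∷ 1234 ∷ 1826 ∷ [] , branch 0 1 7 299717567929002280718371580090 [])
  ∷ (31 ∷ 107 ∷ 188 ∷ 1240 ∷ 1832 ∷ [] , branch 0 3 10 599435135858004561189073620336
   ( branch 0 3 7 599435135858004552520176898419 []
   ∷ branch 2 3 6 599435135858004561436743160180 [] ∷ copy 0 282458552355 ∷ []))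
  ∷ (79 ∷ 55 ∷ 1067 ∷ 1413 ∷ 409 ∷ 1617 ∷ [] , branch 0 1 7 148904821798060450229584491613
   ( branch 0 2 9 149858783964501140358755808349
     ( branch 0 5 7 149858231903062227922768196701 (copy 75 274559146895 ∷ []) ∷ []) ∷ []))
  ∷ (91 ∷ 62 ∷ 188 ∷ 1816 ∷ 1264 ∷ [] , branch 1 4 10 749293919820085408497013130688 (branch 2 4 6 749134926072430542585636902978 [] ∷ []))
  ∷ (59 ∷ 94 ∷ 412 ∷ 1624 ∷ 1456 ∷ [] , branch 0 4 10 749293919820085408497013130693 [])
  ∷ (31 ∷ 1070 ∷ 230 ∷ 1798 ∷ 1236 ∷ [] , branch 2 4 5 449576351893503420267006041366 [])
  ∷ (59 ∷ 94 ∷ 236 ∷ 1240 ∷ 1832 ∷ [] , branch 0 3 10 599435135858004561189073703280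
   ( branch 1 3 7 599276050100111294447302857076 [] ∷ copy 5 282447899515 ∷ []))
  ∷ (79 ∷ 55 ∷ 1414 ∷ 410 ∷ 1322 ∷ 1618 ∷ [] , branch 0 1 8 299717567929002280718371580090 [])
  ∷ (47 ∷ 87 ∷ 1414 ∷ 410 ∷ 1610 ∷ 1586 ∷ [] , branch 1 5 6 299716463806124455845536393402 (copy 62 282458407495 ∷ []))
  ∷ (31 ∷ 110 ∷ 1318 ∷ 1418 ∷ 434 ∷ 1618 ∷ [] , branch 0 1 6 299717567929002280718371580090 [])
  ∷ (59 ∷ 94 ∷ 428 ∷ 1432 ∷ 1640 ∷ [] , branch 2 3 10 599435135858004558217027198320
   ( copy 7 282457762205 ∷ copy 2 282262890515 ∷ copy 2 282457762225 ∷ copy 1 282448099165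
   ∷ copy 0 282263214915 ∷ copy 0 282458086625 ∷ []))
  ∷ (47 ∷ 118 ∷ 1190 ∷ 410 ∷ 1610 ∷ 1330 ∷ [] , branch 0 1 6 299717567929002280718371580090 [])
  ∷ (143 ∷ 118 ∷ 1606 ∷ 122 ∷ 1802 ∷ 1202 ∷ [] , branch 0 1 4 299717567929002280718371580090 [])
  ∷ (47 ∷ 214 ∷ 1798 ∷ 794 ∷ 1226 ∷ 1586 ∷ [] , branch 0 1 9 299716463806124455845536393402
   ( branch 0 1 4 276822475934425717607940417722
     ( branch 1 5 6 299716463806124455845536393402 (copy 21 279276797735 ∷ []) ∷ []) ∷ []))
  ∷ (31 ∷ 230 ∷ 1798 ∷ 1196 ∷ 1236 ∷ [] , branch 2 3 8 449554820459071665367736928039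
   ( copy 64 282221606755 ∷ copy 6 282208562955 ∷ copy 4 282228208515 ∷ copy 4 282208881185
   ∷ copy 30 282260312235 ∷ copy 31 282046114405 ∷ branch 0 2 8 449576351893503421077557370135 []
   ∷ copy 0 277141965045 ∷ []))
  ∷ (61 ∷ 654 ∷ 342 ∷ 1356 ∷ 1812 ∷ 1700 ∷ [] , branch 0 1 2 449576351893503421077557370135 [])
  ∷ (61 ∷ 709 ∷ 158 ∷ 358 ∷ 1116 ∷ 1700 ∷ 1924 ∷ [] , branch 0 1 2 449576351893503421077557370135 [])
  ∷ (59 ∷ 206 ∷ 796 ∷ 1240 ∷ 1832 ∷ [] , branch 1 3 10 2408995369799722549498228
   ( copy 1 279712591895 ∷ copy 1 282051052415 ∷ copy 1 279925179215 ∷ copy 1 282263639735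
   ∷ branch 0 3 8 599432927612248911691072786804 (copy 0 281830825135 ∷ []) ∷ []))
  ∷ (79 ∷ 310 ∷ 1174 ∷ 186 ∷ 1802 ∷ 1634 ∷ [] , branch 0 1 4 299717567929002280718371580090 [])
  ∷ (79 ∷ 182 ∷ 1798 ∷ 314 ∷ 1178 ∷ 1378 ∷ [] , branch 0 1 4 299717567929002280718371580090 [])
  ∷ (31 ∷ 230 ∷ 1798 ∷ 1132 ∷ 1684 ∷ [] , branch 2 3 7 446692922538343790214173125143
   ( copy 11 281994285265 ∷ copy 1 282435857825 ∷ copy 0 280292271435 ∷ copy 1 282416385295
   ∷ copy 0 280272798905 ∷ copy 6 282437177935 ∷ []))
  ∷ (59 ∷ 220 ∷ 1816 ∷ 1264 ∷ [] , branch 0 2 4 0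
   ( branch 0 4 10 749293919820085408497013130693 []
   ∷ branch 2 4 10 749293919822505701795928950225 [] ∷ copy 19 282456490855
   ∷ copy 19 282437018325 ∷ copy 70 282223406135 ∷ copy 70 279865619495
   ∷ branch 4 5 8 749291159514303263283605130960
     ( branch 0 4 6 749260796136170955610873349585 (branch 1 4 6 749293919822505701795915920477 [] ∷ [])
     ∷ copy 18 282227591155 ∷ copy 39 281175288695 ∷ copy 39 281155802855 ∷ copy 18 282227430115
     ∷ copy 39 281175127765 ∷ copy 39 281155641925 ∷ copy 18 280825484845 ∷ copy 18 280825323805
     ∷ branch 4 6 8 744524108990302247123292435660
       ( copy 56 282144727935 ∷ copy 56 280911714285 ∷ copy 56 276157137645
       ∷ copy 56 280697356735 ∷ copy 56 275942780095 ∷ copy 146 261835409675 ∷ [])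
     ∷ copy 72 280815017135 ∷ [])
   ∷ branch 1 4 10 749293919820085408497013130693 [] ∷ copy 17 282456943385
   ∷ copy 17 282437617265 ∷ copy 16 282228250965 ∷ copy 16 279872074835 ∷ copy 15 282458081665
   ∷ copy 14 282458247765 ∷ copy 14 282440532155 ∷ copy 10 282227944835 ∷ copy 10 279871768705
   ∷ branch 4 5 8 749291159515311139613840871185
     ( copy 9 282150331365 ∷ copy 9 281935987125 ∷ branch 1 4 6 749293919822505701795928950225 [] ∷ [])
   ∷ branch 0 4 10 62441159985208760185300075980
     ( branch 1 4 6 749293919822505683953336829391 []
     ∷ branch 1 2 4 749293919764821795177225504209 [] ∷ copy 8 280269255685 ∷ copy 8 282412844495
     ∷ copy 175 282421493795 ∷ [])
   ∷ copy 35 282262058365 ∷ copy 35 279923597845 ∷ copy 6 282440366055 ∷ copy 35 282047860535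
   ∷ copy 35 279709400015 ∷ copy 6 282458081665 ∷ copy 3 277356444905 ∷ copy 0 280219406215
   ∷ copy 0 282362995025 ∷ []))
  ∷ (199 ∷ 122 ∷ 484 ∷ 248 ∷ 1984 ∷ [] , branch 0 5 6 1049011487751507875459177766126 [])
  ∷ (205 ∷ 242 ∷ 372 ∷ 488 ∷ 1984 ∷ [] , branch 0 5 6 1049011138879348669794028580478
   ( branch 1 2 6 1049011437566524641051980410363 []
   ∷ branch 1 3 6 1049011437566524641051980410363 [] ∷ []))
  ∷ (241 ∷ 206 ∷ 370 ∷ 724 ∷ 872 ∷ 1984 ∷ [] , branch 0 1 6 1049011483890723860238160178803 [])
  ∷ (205 ∷ 242 ∷ 372 ∷ 744 ∷ 1984 ∷ [] , branch 0 6 8 1049011460915188035381972933175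
   ( branch 0 6 9 1049011487751507982514300530315 []
   ∷ branch 1 2 6 1049011483598267883702567120523 [] ∷ copy 0 282458403635 ∷ []))
  ∷ (157 ∷ 286 ∷ 110 ∷ 1804 ∷ 1208 ∷ 1480 ∷ [] , branch 0 1 3 599435135858004561436739923479 [])
  ∷ (93 ∷ 186 ∷ 316 ∷ 1816 ∷ 1264 ∷ [] , branch 0 4 10 744524108987881957849005394368
   ( branch 0 4 8 749293919820085515490218509765 []
   ∷ branch 2 4 7 749293919820100815518587717061 [] ∷ copy 0 282448101695 ∷ []))
  ∷ (213 ∷ 234 ∷ 460 ∷ 880 ∷ 1984 ∷ [] , branch 0 5 6 1049011487734683452542149078667
   ( branch 1 4 6 1049011487751507982514300530315 [] ∷ copy 3 280314951775
   ∷ branch 1 2 6 1049011487751507955564767751816 [] ∷ []))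
  ∷ (117 ∷ 186 ∷ 316 ∷ 1840 ∷ 1504 ∷ [] , branch 0 5 7 899152653587602524040931555742
   ( branch 1 5 6 899152653602023500692794620318 []
   ∷ branch 1 2 5 899152703784601954267886205472 [] ∷ copy 2 282457736925 ∷ []))
  ∷ (117 ∷ 186 ∷ 316 ∷ 1840 ∷ 1760 ∷ [] , branch 0 5 7 899152653602023500692794620318 [])
  ∷ (211 ∷ 236 ∷ 496 ∷ 1984 ∷ [] , branch 0 2 6 606715707737088054752932663
   ( copy 8 282458345315 ∷ copy 44 282458345315 ∷ copy 43 280314756505 ∷ copy 26 280824726405
   ∷ copy 8 282458538165 ∷ copy 44 282458538165 ∷ copy 43 280314949355 ∷ copy 26 281292096515
   ∷ branch 1 3 6 1049011487431997169100456766971 [] ∷ copy 7 282458336955 ∷ copy 5 280314748145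
   ∷ copy 3 282314931385 ∷ copy 7 282458525735 ∷ copy 5 280314936925 ∷ copy 3 282350523555
   ∷ copy 2 282458015115 ∷ copy 1 282350696585 ∷ copy 0 282350696585 ∷ []))
  ∷ (211 ∷ 62 ∷ 124 ∷ 1264 ∷ 1872 ∷ [] , branch 0 4 5 749293919822505701795928950225 [])
  ∷ (109 ∷ 158 ∷ 310 ∷ 1804 ∷ 1140 ∷ 1700 ∷ [] , branch 0 2 7 449576351893503421077557370135 [])
  ∷ (117 ∷ 218 ∷ 316 ∷ 1264 ∷ 1872 ∷ [] , branch 0 3 4 62010552062857108077271270865
   ( branch 0 1 4 749293919822505701795928950225 []
   ∷ branch 1 4 8 749293919822505701795928950225 [] ∷ copy 0 280765117535 ∷ []))
  ∷ (61 ∷ 94 ∷ 422 ∷ 1180 ∷ 1332 ∷ 1636 ∷ [] , branch 0 1 2 449576351893503421077557370135 [])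
  ∷ (61 ∷ 206 ∷ 1180 ∷ 1804 ∷ 1256 ∷ [] , branch 0 3 7 599406428663181113932476977523
   ( copy 0 281565252035 ∷ copy 0 279209075905 ∷ []))
  ∷ (117 ∷ 186 ∷ 796 ∷ 1264 ∷ 1840 ∷ [] , branch 0 3 4 749293919822505701795928950225 [])
  ∷ (93 ∷ 174 ∷ 1084 ∷ 1804 ∷ 1736 ∷ [] , branch 0 3 7 599435119244982956351400841587
   ( copy 4 282047074035 ∷ branch 1 3 8 599435135858004551710091383155 []
   ∷ branch 0 1 3 599435135858004561436739902743 [] ∷ []))
  ∷ (199 ∷ 122 ∷ 868 ∷ 248 ∷ 1984 ∷ [] , branch 1 6 10 87417623979292331876191710859 (copy 192 282449873255 ∷ []))
  ∷ (115 ∷ 213 ∷ 234 ∷ 844 ∷ 880 ∷ 1984 ∷ [] , branch 0 3 6 1049011483556114379668134178299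
   ( branch 1 2 6 1049011165710828244314969386611 (copy 166 267030464795 ∷ []) ∷ []))
  ∷ (205 ∷ 242 ∷ 244 ∷ 872 ∷ 1984 ∷ [] , branch 1 3 6 1049011483571644550421681876619 [])
  ∷ (205 ∷ 242 ∷ 372 ∷ 872 ∷ 1984 ∷ [] , branch 1 2 6 80739884936999533073754059659
   ( branch 1 3 6 1049011483891124656763437788807 []
   ∷ branch 1 3 6 1049011483891124656785510182539 []
   ∷ branch 3 4 6 1049011487751507982514300530315 []
   ∷ branch 0 1 6 1049011487751507982311779151496 []
   ∷ branch 0 4 6 1049011165715668616926390267531
     ( branch 3 4 6 1049011441398990443687190277627
       ( branch 0 6 9 1048931338472897673486615745191 (copy 79 261883717915 ∷ []) ∷ []) ∷ [])
   ∷ copy 52 280314963665 ∷ branch 0 5 6 1049011487751507982514300530315 []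
   ∷ branch 0 1 6 1049011487751507982514300530315 [] ∷ copy 62 280978849525 ∷ []))
  ∷ (47 ∷ 214 ∷ 1798 ∷ 794 ∷ 1674 ∷ 1138 ∷ [] , branch 0 1 7 299717567929002280718371580090 [])
  ∷ (93 ∷ 302 ∷ 1676 ∷ 692 ∷ 1812 ∷ 1380 ∷ [] , branch 0 2 9 449576351893503421077557370135 [])
  ∷ (93 ∷ 186 ∷ 812 ∷ 1816 ∷ 1256 ∷ [] , branch 2 3 10 549829103203088635813370909040
   ( branch 3 6 8 599435135858004558464709677428 (copy 80 275960643445 ∷ [])
   ∷ copy 31 276284840865 ∷ copy 1 280199988255 ∷ copy 1 282343577065 ∷ copy 0 279925193845
   ∷ copy 0 282263654365 ∷ []))
  ∷ (199 ∷ 121 ∷ 850 ∷ 868 ∷ 248 ∷ 1984 ∷ [] , branch 0 6 10 1049011487751507982514300530315 [])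
  ∷ (115 ∷ 213 ∷ 234 ∷ 868 ∷ 856 ∷ 1984 ∷ [] , branch 0 3 6 1049011487751507982514300530315 [])
  ∷ (199 ∷ 233 ∷ 850 ∷ 868 ∷ 248 ∷ 1984 ∷ [] , branch 0 4 6 1049011483571640484679877471883 [])
  ∷ (327 ∷ 233 ∷ 722 ∷ 740 ∷ 376 ∷ 1984 ∷ [] , branch 2 4 6 1049011483582737712948998520315
   ( branch 1 3 6 1049011165715668616926390267531 (copy 85 263528693225 ∷ [])
   ∷ branch 0 6 9 1049004310926178787554826792587 [] ∷ []))
  ∷ (59 ∷ 333 ∷ 714 ∷ 188 ∷ 1144 ∷ 1928 ∷ [] , branch 0 3 10 553644951868851435215880835444 (copy 33 282457764755 ∷ []))
  ∷ (91 ∷ 185 ∷ 810 ∷ 668 ∷ 364 ∷ 1336 ∷ 1736 ∷ [] , branch 0 2 3 599435135858004561436743160180 [])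
  ∷ (451 ∷ 205 ∷ 242 ∷ 852 ∷ 872 ∷ 1984 ∷ [] , branch 2 5 6 1049011487751507920101576490635
   ( copy 0 266029628415 ∷ copy 0 273117644085 ∷ []))
  ∷ (583 ∷ 457 ∷ 466 ∷ 124 ∷ 484 ∷ 632 ∷ 1984 ∷ [] , branch 0 4 6 1049011483917193016310416666251 [])
  ∷ (597 ∷ 457 ∷ 454 ∷ 618 ∷ 124 ∷ 496 ∷ 1984 ∷ [] , branch 0 1 6 1049011487751507982514300530315 [])
  ∷ (587 ∷ 453 ∷ 466 ∷ 628 ∷ 248 ∷ 488 ∷ 1984 ∷ [] , branch 0 4 6 1049011487750902935937881878119 [])
  ∷ (203 ∷ 837 ∷ 850 ∷ 244 ∷ 248 ∷ 872 ∷ 1984 ∷ [] , branch 0 4 6 1049011487724279923636182789735 [])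
  ∷ (59 ∷ 205 ∷ 842 ∷ 316 ∷ 1144 ∷ 696 ∷ 1928 ∷ [] , branch 0 3 8 599435135858004561436743160180 [])
  ∷ (587 ∷ 465 ∷ 482 ∷ 460 ∷ 628 ∷ 248 ∷ 1984 ∷ [] , branch 0 2 6 1049011487751107399953289621131 [])
  ∷ (203 ∷ 849 ∷ 866 ∷ 844 ∷ 244 ∷ 248 ∷ 1984 ∷ [] , branch 0 2 6 1049011487751104618129949765259 [])
  ∷ (203 ∷ 313 ∷ 570 ∷ 124 ∷ 908 ∷ 1208 ∷ 1864 ∷ [] , branch 0 2 3 49952927988167046786383319412
   ( copy 103 276111562345
   ∷ branch 1 3 8 599435135858004525772341367156 (copy 68 266188651215 ∷ []) ∷ []))
  ∷ (707 ∷ 341 ∷ 362 ∷ 740 ∷ 728 ∷ 496 ∷ 1984 ∷ [] , branch 0 3 6 1049011487751138000010028035723 [])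
  ∷ (115 ∷ 405 ∷ 666 ∷ 628 ∷ 376 ∷ 1264 ∷ 1872 ∷ [] , branch 0 3 4 749293919822505701795928950225 [])
  ∷ (143 ∷ 307 ∷ 214 ∷ 1190 ∷ 1114 ∷ 618 ∷ 1922 ∷ [] , branch 0 1 6 299717567929002280718371580090 [])
  ∷ (173 ∷ 341 ∷ 158 ∷ 614 ∷ 1228 ∷ 1588 ∷ 1924 ∷ [] , branch 0 1 2 449576351893503421077557370135 [])
  ∷ (179 ∷ 341 ∷ 602 ∷ 188 ∷ 1264 ∷ 1936 ∷ [] , branch 0 3 4 4805715726057799523522278865
   ( copy 1 282449798985 ∷ copy 1 280308021665 ∷ branch 1 2 4 749293919822505701795928950225 []
   ∷ branch 1 2 4 749293919822505701795928950225 []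
   ∷ branch 1 2 4 749293919822505701795928950225 [] ∷ copy 0 280314148115 ∷ copy 0 282458176145 ∷ []))
  ∷ (61 ∷ 334 ∷ 662 ∷ 1676 ∷ 1364 ∷ 1828 ∷ [] , branch 1 2 5 449576351813633421234901638423 (copy 87 282458380875 ∷ []))
  ∷ (117 ∷ 186 ∷ 796 ∷ 1840 ∷ 1744 ∷ [] , branch 2 4 7 33142989182754422853329105
   ( copy 87 282047872305 ∷ branch 1 4 6 749293919822505701795928950225 []
   ∷ branch 0 3 4 749293919822505701795928950225 [] ∷ copy 0 277843812125
   ∷ branch 1 2 4 749293919822505700985807603153 []
   ∷ branch 0 3 4 749293919822505701795928950225 []
   ∷ branch 1 2 4 749293919822505701795928950225 []
   ∷ branch 1 2 4 749293919822505701795928950225 []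
   ∷ branch 1 2 4 749293919822505701795928950225 []
   ∷ branch 1 2 4 749293919822505701795928950225 []
   ∷ branch 1 2 4 749293919822505701795928950225 []
   ∷ branch 1 4 6 749293919822505701795928950225 []
   ∷ branch 1 2 4 749293919822505701795928950225 [] ∷ []))
  ∷ (179 ∷ 94 ∷ 124 ∷ 1840 ∷ 1744 ∷ [] , branch 1 4 8 62441159985208808482994079185 (copy 220 282458511445 ∷ []))
  ∷ (117 ∷ 186 ∷ 124 ∷ 1840 ∷ 1760 ∷ [] , branch 0 5 7 899152653602023500692794620318 [])
  ∷ (31 ∷ 109 ∷ 182 ∷ 1564 ∷ 1828 ∷ 1732 ∷ [] , branch 0 2 7 449576351893503420891805277463
   ( branch 1 2 6 449576351893457200012833611031 (copy 160 282458553905 ∷ []) ∷ []))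
  ∷ (117 ∷ 186 ∷ 348 ∷ 1840 ∷ 1744 ∷ [] , branch 4 7 8 749293919810488224967735409040
   ( branch 0 3 4 62441159985208808482994079185 (copy 124 281950546065 ∷ [])
   ∷ copy 94 282440836745 ∷ branch 0 1 4 749293919822505701795928950225 []
   ∷ branch 0 1 4 749293919822505701795928950225 []
   ∷ branch 1 4 9 749293919822505701795928950225 []
   ∷ branch 1 4 10 749293919822505701795928950225 [] ∷ []))
  ∷ (527 ∷ 61 ∷ 214 ∷ 358 ∷ 1612 ∷ 1812 ∷ 1700 ∷ [] , branch 0 2 6 449576351893503421077548412183
   ( branch 0 2 7 449576351893503420891805277463 (copy 138 282051092325 ∷ []) ∷ []))
  ∷ (117 ∷ 186 ∷ 348 ∷ 1840 ∷ 1488 ∷ [] , branch 0 3 4 4772822076415652005632992465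
   ( branch 0 4 7 749293919822504310884223190469 []
   ∷ branch 0 4 7 749293919822505701795928950225 []
   ∷ branch 2 4 7 749293919822505701795928950225 [] ∷ copy 76 280314963875 ∷ copy 53 282324047435
   ∷ branch 0 1 4 692056189836064294019851044305 (copy 0 278640785645 ∷ [])
   ∷ branch 0 1 4 749293919822505701795928950225 []
   ∷ branch 0 1 4 749293919822505701795928950225 [] ∷ copy 88 282324064595 ∷ []))
  ∷ (47 ∷ 87 ∷ 1411 ∷ 1797 ∷ 409 ∷ 1609 ∷ 1585 ∷ [] , branch 0 1 9 149858783964501140359185769309
   ( branch 0 5 7 149858231903062227922768196701 (copy 140 282435514295 ∷ []) ∷ []))
  ∷ (61 ∷ 206 ∷ 1804 ∷ 1240 ∷ 1704 ∷ [] , branch 1 3 4 46137062708643153873706360180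
   ( branch 0 3 7 599435135858004561436743160180 []
   ∷ branch 0 3 10 599435135858004561436743160180 []
   ∷ branch 1 3 5 599435135858004561436743160180 []
   ∷ branch 0 1 3 49952927988167046786395263348 (copy 0 282214530095 ∷ [])
   ∷ branch 0 1 3 599435135858004561436743160180 [] ∷ copy 77 282262043855 ∷ copy 80 280313326755
   ∷ copy 8 282263680985 ∷ branch 0 1 3 599435135858004561436743160180 [] ∷ []))
  ∷ (93 ∷ 174 ∷ 310 ∷ 1804 ∷ 1428 ∷ 1636 ∷ [] , branch 0 2 7 449576351893503421077557370135 [])
  ∷ (157 ∷ 110 ∷ 316 ∷ 1804 ∷ 1368 ∷ 1704 ∷ [] , branch 0 3 5 599435135858004551772008747379 [])
  ∷ (61 ∷ 206 ∷ 1804 ∷ 372 ∷ 1620 ∷ 1444 ∷ [] , branch 0 2 6 449576351893503421077557370135 [])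
  ∷ (61 ∷ 206 ∷ 1804 ∷ 372 ∷ 1364 ∷ 1700 ∷ [] , branch 0 2 6 449576351893503421077557370135 [])
  ∷ (157 ∷ 110 ∷ 1804 ∷ 1368 ∷ 1704 ∷ 1736 ∷ [] , branch 0 3 5 599435135858004561436743160180 [])
  ∷ (31 ∷ 61 ∷ 206 ∷ 1804 ∷ 1624 ∷ 1704 ∷ [] , branch 0 3 6 599435135858004551710091383155 [])
  ∷ (527 ∷ 93 ∷ 174 ∷ 310 ∷ 1804 ∷ 1684 ∷ 1636 ∷ [] , branch 0 2 5 449576351893503421077557370135 [])
  ∷ (47 ∷ 87 ∷ 1171 ∷ 1797 ∷ 409 ∷ 1609 ∷ 1585 ∷ [] , branch 0 1 8 149858783964501140359185790045 [])
  ∷ (31 ∷ 61 ∷ 230 ∷ 1612 ∷ 1684 ∷ 1828 ∷ [] , branch 1 2 8 449576351893503421077557370135 [])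
  ∷ (31 ∷ 109 ∷ 182 ∷ 1676 ∷ 1620 ∷ 1828 ∷ [] , branch 0 2 7 449576351893503421077557370135 [])
  ∷ (47 ∷ 93 ∷ 406 ∷ 1676 ∷ 1588 ∷ 1860 ∷ [] , branch 2 5 6 449576351893503421077557364951 (branch 1 2 6 449576351893503421077557366365 [] ∷ []))
  ∷ (527 ∷ 181 ∷ 94 ∷ 358 ∷ 1580 ∷ 1812 ∷ 1732 ∷ [] , branch 0 2 6 449576351893503421077557370135 [])
  ∷ (271 ∷ 61 ∷ 214 ∷ 1356 ∷ 1812 ∷ 1444 ∷ [] , branch 2 5 6 449576351893503418848531511575
   ( copy 0 280313354575 ∷ copy 15 280314965095 ∷ []))
  ∷ (47 ∷ 279 ∷ 1347 ∷ 1669 ∷ 217 ∷ 1801 ∷ 1585 ∷ [] , branch 0 1 7 149858783964501140359185790045 [])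
  ∷ (31 ∷ 227 ∷ 1795 ∷ 1190 ∷ 1610 ∷ 1682 ∷ [] , branch 1 4 6 299717567290042281853290997946
   ( copy 15 282208467245 ∷ copy 0 282159586545 ∷ []))
  ∷ (527 ∷ 117 ∷ 406 ∷ 1564 ∷ 236 ∷ 1700 ∷ 1860 ∷ [] , branch 0 2 7 449576351893503421077557370135 [])
  ∷ (47 ∷ 279 ∷ 1555 ∷ 1605 ∷ 217 ∷ 1801 ∷ 1441 ∷ [] , branch 0 1 6 149858783964501140359185790045 [])
  ∷ (31 ∷ 47 ∷ 211 ∷ 1795 ∷ 1558 ∷ 1610 ∷ 1698 ∷ [] , branch 1 2 6 299717567929002280718368322653 [])
  ∷ (31 ∷ 47 ∷ 211 ∷ 1795 ∷ 1606 ∷ 1674 ∷ 1586 ∷ [] , branch 1 2 7 299717567929002280718368322653 [])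
  ∷ (31 ∷ 47 ∷ 1555 ∷ 1605 ∷ 1673 ∷ 241 ∷ 1825 ∷ [] , branch 0 1 6 149858783964501140359185790045 [])
  ∷ (31 ∷ 167 ∷ 327 ∷ 1547 ∷ 1557 ∷ 121 ∷ 1825 ∷ 1729 ∷ [] , branch 0 3 7 149858783964485733337611203677 (copy 187 282440838295 ∷ []))
  ∷ (31 ∷ 1543 ∷ 107 ∷ 181 ∷ 1673 ∷ 1617 ∷ 1825 ∷ [] , branch 0 1 7 149858783964501140359185790045 [])
  ∷ (47 ∷ 87 ∷ 1547 ∷ 1669 ∷ 409 ∷ 1585 ∷ 1857 ∷ [] , branch 0 1 7 149858783964501140359185790045 [])
  ∷ (47 ∷ 279 ∷ 1299 ∷ 1349 ∷ 217 ∷ 1801 ∷ 1441 ∷ [] , branch 0 1 6 149858783964501140359185790045 [])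
  ∷ (47 ∷ 211 ∷ 1795 ∷ 1558 ∷ 1610 ∷ 1250 ∷ 1698 ∷ [] , branch 1 2 6 299717567929002280718371580090 [])
  ∷ (47 ∷ 87 ∷ 1667 ∷ 1797 ∷ 409 ∷ 1609 ∷ 1585 ∷ [] , branch 0 1 8 149858783937877807078300525405
   ( copy 4 281987060465 ∷ copy 125 282259848915 ∷ []))
  ∷ (47 ∷ 279 ∷ 1347 ∷ 1413 ∷ 217 ∷ 1801 ∷ 1329 ∷ [] , branch 0 1 7 149858783964501140359185790045 [])
  ∷ (47 ∷ 211 ∷ 1795 ∷ 1606 ∷ 1674 ∷ 1586 ∷ 1250 ∷ [] , branch 1 2 4 299717567929002280718371580090 [])
  ∷ (115 ∷ 188 ∷ 1840 ∷ 1760 ∷ [] , branch 0 2 5 0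
   ( copy 192 282458407495 ∷ copy 181 282440835405 ∷ copy 35 282458404605 ∷ copy 187 282435857465
   ∷ copy 105 282050945575 ∷ copy 108 280297100185 ∷ copy 83 282429446665 ∷ copy 181 282458553895
   ∷ copy 187 282455186465 ∷ copy 35 282440691875 ∷ copy 105 282263535775 ∷ copy 108 280314818675
   ∷ copy 83 282452781755 ∷ copy 34 282458552355 ∷ copy 34 282440834305 ∷ copy 73 282458552355
   ∷ copy 74 280314963545 ∷ copy 65 282458015115
   ∷ branch 1 3 5 74929391982250570179592895022 (copy 33 282371634655 ∷ [])
   ∷ copy 32 282458405945 ∷ copy 30 280314817135 ∷ copy 28 282428733095 ∷ copy 32 282440687895
   ∷ copy 30 280297099085 ∷ copy 28 282451573075 ∷ copy 36 282458405945
   ∷ branch 0 5 7 477257286999866609157278766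
     ( copy 119 282431220855 ∷ copy 27 280287632045 ∷ copy 24 282428731885 ∷ copy 25 280285143075
     ∷ copy 27 282361383305 ∷ copy 119 280217794495 ∷ copy 26 282432246955 ∷ copy 26 280216770815
     ∷ copy 25 282362115355 ∷ copy 24 280218526545
     ∷ branch 1 2 5 899152703787006842155114740270 [] ∷ copy 23 280179875515
     ∷ copy 23 282448059215 ∷ [])
   ∷ branch 1 3 5 0
     ( copy 33 282458359965 ∷ copy 22 282451573075 ∷ copy 19 282451332285 ∷ copy 18 282360997315
     ∷ copy 17 282147238715 ∷ copy 15 280308036295 ∷ copy 13 282321475715 ∷ copy 22 282428733095
     ∷ copy 18 282447738585 ∷ copy 19 282428319275 ∷ copy 17 281895679695 ∷ copy 15 280285169695
     ∷ copy 13 282362512865 ∷ copy 22 282362116565 ∷ copy 22 282321707385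
     ∷ branch 1 2 5 899152703784601955877773507106 []
     ∷ branch 0 5 7 899152653601931058563346977694
       ( copy 21 282431220855 ∷ copy 21 282361383305 ∷ [])
     ∷ branch 0 5 7 899152653601931058563346977694
       ( copy 20 281094940175 ∷ copy 20 281906306665 ∷ [])
     ∷ copy 33 282350375935 ∷ copy 17 281162258785 ∷ copy 15 280218499925 ∷ copy 13 282427835925
     ∷ copy 17 280717598285 ∷ copy 15 280178077435 ∷ copy 13 282451170775
     ∷ branch 0 5 7 824740340519027098703018513454
       ( copy 16 281921660815 ∷ copy 12 281894721375 ∷ copy 16 281154472435
       ∷ branch 1 5 7 899152653921503500063417547166 [] ∷ copy 12 281161939345
       ∷ branch 1 5 7 899152703787006842155114740270 []
       ∷ branch 1 2 5 899152703787006842155114740270 [] ∷ [])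
     ∷ branch 0 5 7 824740340519027098703018513454
       ( copy 14 282356009435 ∷ copy 11 282341252165 ∷ copy 14 282429669175
       ∷ branch 0 3 5 899152703784601955877773507106 [] ∷ copy 11 282372919845
       ∷ branch 0 3 5 899152703787006842155114740270 []
       ∷ branch 1 2 5 899152703787006842155114740270 [] ∷ [])
     ∷ branch 0 3 5 0
       ( branch 0 5 7 899152703782199637437361247278 (copy 7 282440661145 ∷ [])
       ∷ copy 10 282451610005 ∷ copy 8 282451295725 ∷ copy 6 282360997055 ∷ copy 5 282147242085
       ∷ copy 4 280308026355 ∷ copy 3 282330708015 ∷ copy 10 282430472515 ∷ copy 6 282449524395
       ∷ copy 8 282429994775 ∷ copy 5 281915163975 ∷ copy 4 280286885125 ∷ copy 3 282355039905
       ∷ copy 9 282450812615 ∷ copy 9 282429672705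
       ∷ branch 0 5 7 899152653921503500063417547166 []
       ∷ branch 0 5 7 899152657431346163933511825798 []
       ∷ branch 2 5 6 899152653602023500692793376093 [] ∷ copy 6 282352081225
       ∷ copy 2 282138384995 ∷ copy 1 280307221815 ∷ copy 0 282428076715 ∷ copy 2 281906306665
       ∷ copy 1 280286080365 ∷ copy 0 282452408605
       ∷ branch 0 5 7 899152703787006842155114740270 []
       ∷ branch 2 5 6 899152703787006842155114740270 []
       ∷ branch 2 5 6 899152703787006842155098565405 [] ∷ []) ∷ []) ∷ [])) ∷ []

-- The triple takes one of the two common points, 6, and joins two blocks of the pencil through 0
-- and 3. The hint 0 means that none of the 28 choices for a fourth block dies at once.
pencilTree : Tree
pencilTree = branch 0 3 6 0
   ( copy 256 282458023005 ∷ copy 187 282458375355 ∷ copy 187 282458536395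
   ∷ copy 180 282457851185 ∷ copy 105 282457851185 ∷ copy 105 280314262375 ∷ copy 83 282330714065
   ∷ copy 187 282458376685 ∷ copy 187 282458537725 ∷ copy 180 282458012115
   ∷ copy 105 282458012115 ∷ copy 105 280314423305 ∷ copy 83 282350201115 ∷ copy 256 282458553675
   ∷ copy 180 282458374595 ∷ copy 105 282458374595 ∷ copy 105 280314785785 ∷ copy 83 282394007435
   ∷ copy 180 282458535525 ∷ copy 105 282458535525 ∷ copy 105 280314946715 ∷ copy 83 282413494485
   ∷ copy 73 282458176155 ∷ copy 73 280314587345
   ∷ branch 1 4 6 606715707737088057762804528
     ( copy 72 282381599395 ∷ branch 2 5 6 1049011487744852149193953807147 []
     ∷ copy 70 282381602065 ∷ copy 70 280238013255 ∷ copy 68 282313114825 ∷ copy 116 280758205315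
     ∷ copy 116 278419744795 ∷ copy 99 282351455545 ∷ copy 72 282323625355 ∷ copy 70 282323620045
     ∷ copy 70 280180031235 ∷ copy 68 282376363975 ∷ copy 116 281395971595
     ∷ copy 116 279057511075 ∷ copy 99 282415666975 ∷ copy 67 282370328495 ∷ copy 66 280247269755
     ∷ copy 66 282390858565 ∷ [])
   ∷ branch 1 4 6 0
     ( copy 65 282457716865
     ∷ branch 2 5 6 1042333752586423151607091441291 (copy 64 282458175935 ∷ [])
     ∷ copy 189 282457736915 ∷ copy 63 282457704985 ∷ copy 62 282457704985 ∷ copy 62 280314116175
     ∷ copy 59 282337330555 ∷ copy 189 282458171825 ∷ copy 229 282458176155
     ∷ copy 183 282457716865 ∷ copy 112 282457716865 ∷ copy 112 280314128055
     ∷ copy 87 264494812015 ∷ copy 65 282458247535 ∷ copy 63 282458227735 ∷ copy 62 282458227735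
     ∷ copy 62 280314638925 ∷ copy 59 282390960205 ∷ copy 183 282458247535
     ∷ copy 112 282458247535 ∷ copy 112 280314658725 ∷ copy 87 272211248905
     ∷ copy 76 282458174495 ∷ copy 76 280314585685 ∷ copy 67 282391585775
     ∷ branch 2 5 6 0
       ( copy 58 282457850075 ∷ copy 64 282458174495 ∷ copy 57 282458334215
       ∷ copy 56 282457703555 ∷ copy 55 282262831845 ∷ copy 55 279924371325
       ∷ copy 54 265175911675 ∷ copy 57 282458189015 ∷ copy 64 282458348735
       ∷ copy 56 282457850075 ∷ copy 55 282262978365 ∷ copy 55 279924517845
       ∷ copy 54 265195398955 ∷ copy 58 282458380745 ∷ copy 56 282458234225
       ∷ copy 55 282263362515 ∷ copy 55 279924901995 ∷ copy 54 271665139285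
       ∷ copy 56 282458380745 ∷ copy 55 282263509035 ∷ copy 55 279925048515
       ∷ copy 54 271684626565 ∷ copy 52 282458375355 ∷ copy 52 280314786545
       ∷ branch 0 4 6 1049011487751507982514300530315 []
       ∷ branch 0 4 6 0
         ( copy 51 277975827385
         ∷ branch 2 3 6 1049011487735977700716689895046
           ( branch 0 5 6 1049011387381541299589639388811 (copy 232 276997940995 ∷ []) ∷ [])
         ∷ copy 50 277976302045 ∷ copy 48 282457852495 ∷ copy 49 277975803165
         ∷ copy 49 277780931455 ∷ copy 47 261824118275 ∷ copy 50 277976125285
         ∷ copy 50 277976476405 ∷ copy 45 282458013445 ∷ copy 46 277975964115
         ∷ copy 46 277781092405 ∷ copy 44 264235212585 ∷ copy 51 277976198215
         ∷ copy 48 282458228175 ∷ copy 49 277976178845 ∷ copy 49 277781307135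
         ∷ copy 47 267319500285 ∷ copy 45 282458550045 ∷ copy 46 277976500715
         ∷ copy 46 277781629005 ∷ copy 44 272159405145 ∷ copy 43 282263462505
         ∷ copy 43 279925001985 ∷ branch 2 3 6 1049011487751507982514300530315 []
         ∷ branch 2 3 6 1049011487751507982514298902461 [] ∷ copy 42 268958160935
         ∷ copy 42 268959771445 ∷ [])
       ∷ copy 39 271762543305 ∷ copy 39 271781869425 ∷ [])
     ∷ copy 37 280247996965 ∷ copy 37 282391585775 ∷ [])
   ∷ copy 0 280226594935 ∷ copy 0 282370183745 ∷ [])

extensionsOfPencil-valid : verifyEntries bound (standard ∷ []) extensionsOfPencil ≡ true
extensionsOfPencil-valid = refl

pencilTree-valid : verify bound (overloaded bound) (configs (standard ∷ []) extensionsOfPencil) pencilTree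
                 (foldr cover allTriples pencil) pencil ≡ true
pencilTree-valid = refl

pencil-good : Good pencil
pencil-good = config-sound {db = configs (standard ∷ []) extensionsOfPencil} {F = pencil} pencilTree
  (verifyEntries-sound {db = standard ∷ []} extensionsOfPencil extensionsOfPencil-valid (standard-good ∷ []))
  (witness (unique? pencil) refl) pencilTree-valid

-- Coverings with 0 and 1 on at most three blocks

scarce : Table 11 → List (Subset 11) → Fin 11 → Bool
scarce t Bs _ = 3 <ᵇ need (row t 0F 1F) + codegree 0F 1F Bs

-- A block through 0 and 1 takes at most three of the nine other points, so three blocks can only
-- partition them. An overlap leaves a row whose `need` raises the count above three.
scarce-sound : ∀ {t Bs Cs} → codegree 0F 1F Cs ≤ 3 → Admissible bound Cs → Partial t Bs Cs →
               ∀ x → scarce t Bs x ≢ true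
scarce-sound {t} {Bs} {Cs} few adm (Rs , split , res) x over = ℕ.<-irrefl refl (begin-strict
  3                                       <⟨ ℕ.<ᵇ⇒< 3 _ (Equivalence.from T-≡ over) ⟩
  need (row t 0F 1F) + codegree 0F 1F Bs
    ≤⟨ ℕ.+-monoˡ-≤ (codegree 0F 1F Bs) (need≤codegree uniR res λ ()) ⟩
  codegree 0F 1F Rs + codegree 0F 1F Bs   ≡⟨ ℕ.+-comm (codegree 0F 1F Rs) _ ⟩
  codegree 0F 1F Bs + codegree 0F 1F Rs   ≡⟨ tally-++ f Bs Rs ⟨
  codegree 0F 1F (Bs ++ Rs)               ≡⟨ tally-↭ f split ⟩
  codegree 0F 1F Cs                       ≤⟨ few ⟩
  3                                       ∎)
  where
  open ≤-Reasoning
  f : Subset 11 → Bool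
  f B = lookup B 0F ∧ lookup B 1F
  uniR : Uniform 5 Rs
  uniR = All.++⁻ʳ Bs (↭.All-resp-↭ (↭-sym split) (Admissible.sizes adm))

-- A hint 1 + x just says that the pair 0, 1 lies on too many blocks.

scarceTree : Tree
scarceTree = branch 0 1 2 0
   ( branch 0 1 5 2420303025535022173
     ( branch 0 1 8 12488231997041761696598815837 (copy 0 282331355825 ∷ [])
     ∷ branch 0 1 7 12488231997041761696598815837 (copy 0 282117157995 ∷ [])
     ∷ branch 0 1 7 138411237967212858803970208861 (copy 0 279759371355 ∷ [])
     ∷ branch 0 1 7 148904821798060450229584491613 (copy 0 274614790155 ∷ [])
     ∷ branch 0 1 6 12488231997041761696598815837 (copy 0 281902813755 ∷ [])
     ∷ branch 0 1 6 138411237967212858803970208861 (copy 0 279545027115 ∷ [])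
     ∷ branch 0 1 6 148904821798060450229584491613 (copy 0 276972736515 ∷ [])
     ∷ branch 0 1 6 149779287117297749515052348509 (copy 0 277187094065 ∷ [])
     ∷ branch 0 1 6 149852159227234191122174669917 (copy 0 279330669565 ∷ [])
     ∷ branch 0 1 6 149858231903062227922768196701 (copy 0 281688456205 ∷ []) ∷ [])
   ∷ branch 0 1 4 2420303025535022173
     ( branch 0 1 8 12488231997041761696598815837 (copy 0 282331354615 ∷ [])
     ∷ branch 0 1 7 12488231997041761696598815837 (copy 0 282117156785 ∷ [])
     ∷ branch 0 1 7 138411237967212858803970208861 (copy 0 279759370145 ∷ [])
     ∷ branch 0 1 7 148904821798060450229584491613 (copy 0 274400431395 ∷ [])
     ∷ branch 0 1 6 12488231997041761696598815837 (copy 0 281902812545 ∷ [])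
     ∷ branch 0 1 6 138411237967212858803970208861 (copy 0 279545025905 ∷ [])
     ∷ branch 0 1 6 148904821798060450229584491613 (copy 0 276758377755 ∷ [])
     ∷ branch 0 1 6 149779287117297749515052348509 (copy 0 277187092855 ∷ [])
     ∷ branch 0 1 6 149852159227234191122174669917 (copy 0 279116310805 ∷ [])
     ∷ branch 0 1 6 149858231903062227922768196701 (copy 0 281474097445 ∷ []) ∷ [])
   ∷ branch 0 1 4 50184983351188545172573
     ( branch 0 1 8 12488231997041761696598815837 (copy 0 282331340095 ∷ [])
     ∷ branch 0 1 7 12488231997041761696598815837 (copy 0 282117142265 ∷ [])
     ∷ branch 0 1 7 138411237967212858803970208861 (copy 0 279759355625 ∷ [])
     ∷ branch 0 1 7 148904821798060450229584491613 (copy 0 272042483825 ∷ [])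
     ∷ branch 0 1 5 12488231997041761696598815837 (copy 0 281688453785 ∷ [])
     ∷ branch 0 1 5 138411237967212858803970208861 (copy 0 279330667145 ∷ [])
     ∷ branch 0 1 5 148904821798060450229584491613 (copy 0 276758376545 ∷ [])
     ∷ branch 0 1 5 149779287117297749515052348509 (copy 0 276972734095 ∷ [])
     ∷ branch 0 1 5 149852159227234191122174669917 (copy 0 279116309595 ∷ [])
     ∷ branch 0 1 5 149858231903062227922768196701 (copy 0 281474096235 ∷ []) ∷ [])
   ∷ branch 0 1 4 86673672533879443566982237
     ( branch 0 1 8 12488231997041761696598815837 (copy 0 282331179165 ∷ [])
     ∷ branch 0 1 6 12488231997041761696598815837 (copy 0 281902783505 ∷ [])
     ∷ branch 0 1 6 138411237967212858803970208861 (copy 0 279544996865 ∷ [])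
     ∷ branch 0 1 6 148904821798060450229584491613 (copy 0 272042482615 ∷ [])
     ∷ branch 0 1 5 12488231997041761696598815837 (copy 0 281688439265 ∷ [])
     ∷ branch 0 1 5 138411237967212858803970208861 (copy 0 279330652625 ∷ [])
     ∷ branch 0 1 5 148904821798060450229584491613 (copy 0 274400428975 ∷ [])
     ∷ branch 0 1 5 149858737959381230989484323933 (copy 0 274614786525 ∷ [])
     ∷ branch 0 1 5 149858780130741147911710667869 (copy 0 279116295075 ∷ [])
     ∷ branch 0 1 5 149858783645021140988562863197 (copy 0 281474081715 ∷ []) ∷ [])
   ∷ branch 0 1 4 12402060544663300240087020637
     ( branch 0 1 7 12488231997041761696598815837 (copy 0 282116820405 ∷ [])
     ∷ branch 0 1 6 12488231997041761696598815837 (copy 0 281902622575 ∷ [])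
     ∷ branch 0 1 6 149779287117297749515052348509 (copy 0 277187049295 ∷ [])
     ∷ branch 0 1 6 149852159227234191122174669917 (copy 0 272042468095 ∷ [])
     ∷ branch 0 1 5 12488231997041761696598815837 (copy 0 281688278335 ∷ [])
     ∷ branch 0 1 5 149779287117297749515052348509 (copy 0 276972705055 ∷ [])
     ∷ branch 0 1 5 149852159227234191122174669917 (copy 0 274400414455 ∷ [])
     ∷ branch 0 1 5 149858737959381230989484323933 (copy 0 274614772005 ∷ [])
     ∷ branch 0 1 5 149858780130741147911710667869 (copy 0 276758347505 ∷ [])
     ∷ branch 0 1 5 149858783937877807078300546141 (copy 0 281473920785 ∷ []) ∷ [])
   ∷ branch 0 1 4 138331142705111904462224585821
     ( branch 0 1 7 138411237967212858803970208861 (copy 0 279758872835 ∷ [])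
     ∷ branch 0 1 6 138411237967212858803970208861 (copy 0 279544675005 ∷ [])
     ∷ branch 0 1 6 149779287117297749515052348509 (copy 0 277186888365 ∷ [])
     ∷ branch 0 1 6 149858231903062227922768196701 (copy 0 272042307165 ∷ [])
     ∷ branch 0 1 5 138411237967212858803970208861 (copy 0 279330330765 ∷ [])
     ∷ branch 0 1 5 149779287117297749515052348509 (copy 0 276972544125 ∷ [])
     ∷ branch 0 1 5 149858231903062227922768196701 (copy 0 274400253525 ∷ [])
     ∷ branch 0 1 5 149858737959381230989484323933 (copy 0 274614611075 ∷ [])
     ∷ branch 0 1 5 149858783645021140988562863197 (copy 0 276758186575 ∷ [])
     ∷ branch 0 1 5 149858783937877807078300546141 (copy 0 279115973215 ∷ []) ∷ [])
   ∷ branch 0 1 4 148897640819289581265032934493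
     ( branch 0 1 7 148904821798060450229584491613 (copy 0 266897870705 ∷ [])
     ∷ branch 0 1 6 148904821798060450229584491613 (copy 0 266897869495 ∷ [])
     ∷ branch 0 1 6 149852159227234191122174669917 (copy 0 266897854975 ∷ [])
     ∷ branch 0 1 6 149858231903062227922768196701 (copy 0 266897694045 ∷ [])
     ∷ branch 0 1 5 148904821798060450229584491613 (copy 0 266897868175 ∷ [])
     ∷ branch 0 1 5 149852159227234191122174669917 (copy 0 266897853655 ∷ [])
     ∷ branch 0 1 5 149858231903062227922768196701 (copy 0 266897692725 ∷ [])
     ∷ branch 0 1 5 149858780130741147911710667869 (copy 0 266897839025 ∷ [])
     ∷ branch 0 1 5 149858783645021140988562863197 (copy 0 266897678095 ∷ [])
     ∷ branch 0 1 5 149858783937877807078300546141 (copy 0 266897517055 ∷ []) ∷ [])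
   ∷ branch 0 1 3 2420303025535022173
     ( branch 0 1 8 12488231997041761696598815837 (copy 0 282331353295 ∷ [])
     ∷ branch 0 1 7 12488231997041761696598815837 (copy 0 282117155465 ∷ [])
     ∷ branch 0 1 7 138411237967212858803970208861 (copy 0 279759368825 ∷ [])
     ∷ branch 0 1 7 148904821798060450229584491613 (copy 0 274186072525 ∷ [])
     ∷ branch 0 1 6 12488231997041761696598815837 (copy 0 281902811225 ∷ [])
     ∷ branch 0 1 6 138411237967212858803970208861 (copy 0 279545024585 ∷ [])
     ∷ branch 0 1 6 148904821798060450229584491613 (copy 0 276544018885 ∷ [])
     ∷ branch 0 1 6 149779287117297749515052348509 (copy 0 277187091535 ∷ [])
     ∷ branch 0 1 6 149852159227234191122174669917 (copy 0 278901951935 ∷ [])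
     ∷ branch 0 1 6 149858231903062227922768196701 (copy 0 281259738575 ∷ []) ∷ [])
   ∷ branch 0 1 3 50184983351188545172573
     ( branch 0 1 8 12488231997041761696598815837 (copy 0 282331338775 ∷ [])
     ∷ branch 0 1 7 12488231997041761696598815837 (copy 0 282117140945 ∷ [])
     ∷ branch 0 1 7 138411237967212858803970208861 (copy 0 279759354305 ∷ [])
     ∷ branch 0 1 7 148904821798060450229584491613 (copy 0 271828124955 ∷ [])
     ∷ branch 0 1 5 12488231997041761696598815837 (copy 0 281688452465 ∷ [])
     ∷ branch 0 1 5 138411237967212858803970208861 (copy 0 279330665825 ∷ [])
     ∷ branch 0 1 5 148904821798060450229584491613 (copy 0 276544017675 ∷ [])
     ∷ branch 0 1 5 149779287117297749515052348509 (copy 0 276972732775 ∷ [])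
     ∷ branch 0 1 5 149852159227234191122174669917 (copy 0 278901950725 ∷ [])
     ∷ branch 0 1 5 149858231903062227922768196701 (copy 0 281259737365 ∷ []) ∷ [])
   ∷ branch 0 1 3 86673672533879443566982237
     ( branch 0 1 8 12488231997041761696598815837 (copy 0 282331177845 ∷ [])
     ∷ branch 0 1 6 12488231997041761696598815837 (copy 0 281902782185 ∷ [])
     ∷ branch 0 1 6 138411237967212858803970208861 (copy 0 279544995545 ∷ [])
     ∷ branch 0 1 6 148904821798060450229584491613 (copy 0 271828123745 ∷ [])
     ∷ branch 0 1 5 12488231997041761696598815837 (copy 0 281688437945 ∷ [])
     ∷ branch 0 1 5 138411237967212858803970208861 (copy 0 279330651305 ∷ [])
     ∷ branch 0 1 5 148904821798060450229584491613 (copy 0 274186070105 ∷ [])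
     ∷ branch 0 1 5 149858737959381230989484323933 (copy 0 274614785205 ∷ [])
     ∷ branch 0 1 5 149858780130741147911710667869 (copy 0 278901936205 ∷ [])
     ∷ branch 0 1 5 149858783645021140988562863197 (copy 0 281259722845 ∷ []) ∷ [])
   ∷ branch 0 1 3 12402060544663300240087020637
     ( branch 0 1 7 12488231997041761696598815837 (copy 0 282116819085 ∷ [])
     ∷ branch 0 1 6 12488231997041761696598815837 (copy 0 281902621255 ∷ [])
     ∷ branch 0 1 6 149779287117297749515052348509 (copy 0 277187047975 ∷ [])
     ∷ branch 0 1 6 149852159227234191122174669917 (copy 0 271828109225 ∷ [])
     ∷ branch 0 1 5 12488231997041761696598815837 (copy 0 281688277015 ∷ [])
     ∷ branch 0 1 5 149779287117297749515052348509 (copy 0 276972703735 ∷ [])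
     ∷ branch 0 1 5 149852159227234191122174669917 (copy 0 274186055585 ∷ [])
     ∷ branch 0 1 5 149858737959381230989484323933 (copy 0 274614770685 ∷ [])
     ∷ branch 0 1 5 149858780130741147911710667869 (copy 0 276543988635 ∷ [])
     ∷ branch 0 1 5 149858783937877807078300546141 (copy 0 281259561915 ∷ []) ∷ [])
   ∷ branch 0 1 3 138331142705111904462224585821
     ( branch 0 1 7 138411237967212858803970208861 (copy 0 279758871515 ∷ [])
     ∷ branch 0 1 6 138411237967212858803970208861 (copy 0 279544673685 ∷ [])
     ∷ branch 0 1 6 149779287117297749515052348509 (copy 0 277186887045 ∷ [])
     ∷ branch 0 1 6 149858231903062227922768196701 (copy 0 271827948295 ∷ [])
     ∷ branch 0 1 5 138411237967212858803970208861 (copy 0 279330329445 ∷ [])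
     ∷ branch 0 1 5 149779287117297749515052348509 (copy 0 276972542805 ∷ [])
     ∷ branch 0 1 5 149858231903062227922768196701 (copy 0 274185894655 ∷ [])
     ∷ branch 0 1 5 149858737959381230989484323933 (copy 0 274614609755 ∷ [])
     ∷ branch 0 1 5 149858783645021140988562863197 (copy 0 276543827705 ∷ [])
     ∷ branch 0 1 5 149858783937877807078300546141 (copy 0 278901614345 ∷ []) ∷ [])
   ∷ branch 0 1 3 148897640819289581265032934493
     ( branch 0 1 7 148904821798060450229584491613 (copy 0 269255818395 ∷ [])
     ∷ branch 0 1 6 148904821798060450229584491613 (copy 0 269255817185 ∷ [])
     ∷ branch 0 1 6 149852159227234191122174669917 (copy 0 269255802665 ∷ [])
     ∷ branch 0 1 6 149858231903062227922768196701 (copy 0 269255641735 ∷ [])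
     ∷ branch 0 1 5 148904821798060450229584491613 (copy 0 269255815865 ∷ [])
     ∷ branch 0 1 5 149852159227234191122174669917 (copy 0 269255801345 ∷ [])
     ∷ branch 0 1 5 149858231903062227922768196701 (copy 0 269255640415 ∷ [])
     ∷ branch 0 1 5 149858780130741147911710667869 (copy 0 269255786715 ∷ [])
     ∷ branch 0 1 5 149858783645021140988562863197 (copy 0 269255625785 ∷ [])
     ∷ branch 0 1 5 149858783937877807078300546141 (copy 0 269255464745 ∷ []) ∷ [])
   ∷ branch 0 1 3 50187403527768033817693
     ( branch 0 1 8 12488231997041761696598815837 (copy 0 282331324145 ∷ [])
     ∷ branch 0 1 7 12488231997041761696598815837 (copy 0 282117126315 ∷ [])
     ∷ branch 0 1 7 138411237967212858803970208861 (copy 0 279759339675 ∷ [])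
     ∷ branch 0 1 7 148904821798060450229584491613 (copy 0 269470177275 ∷ [])
     ∷ branch 0 1 4 12488231997041761696598815837 (copy 0 281474093595 ∷ [])
     ∷ branch 0 1 4 138411237967212858803970208861 (copy 0 279116306955 ∷ [])
     ∷ branch 0 1 4 148904821798060450229584491613 (copy 0 276544016355 ∷ [])
     ∷ branch 0 1 4 149779287117297749515052348509 (copy 0 276758373905 ∷ [])
     ∷ branch 0 1 4 149852159227234191122174669917 (copy 0 278901949405 ∷ [])
     ∷ branch 0 1 4 149858231903062227922768196701 (copy 0 281259736045 ∷ []) ∷ [])
   ∷ branch 0 1 3 86673674952879102526256221
     ( branch 0 1 8 12488231997041761696598815837 (copy 0 282331163215 ∷ [])
     ∷ branch 0 1 6 12488231997041761696598815837 (copy 0 281902767555 ∷ [])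
     ∷ branch 0 1 6 138411237967212858803970208861 (copy 0 279544980915 ∷ [])
     ∷ branch 0 1 6 148904821798060450229584491613 (copy 0 269470176065 ∷ [])
     ∷ branch 0 1 4 12488231997041761696598815837 (copy 0 281474079075 ∷ [])
     ∷ branch 0 1 4 138411237967212858803970208861 (copy 0 279116292435 ∷ [])
     ∷ branch 0 1 4 148904821798060450229584491613 (copy 0 274186068785 ∷ [])
     ∷ branch 0 1 4 149858737959381230989484323933 (copy 0 274400426335 ∷ [])
     ∷ branch 0 1 4 149858780130741147911710667869 (copy 0 278901934885 ∷ [])
     ∷ branch 0 1 4 149858783645021140988562863197 (copy 0 281259721525 ∷ []) ∷ [])
   ∷ branch 0 1 3 12402060547068176852693840989
     ( branch 0 1 7 12488231997041761696598815837 (copy 0 282116804455 ∷ [])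
     ∷ branch 0 1 6 12488231997041761696598815837 (copy 0 281902606625 ∷ [])
     ∷ branch 0 1 6 149779287117297749515052348509 (copy 0 277187033345 ∷ [])
     ∷ branch 0 1 6 149852159227234191122174669917 (copy 0 269470161545 ∷ [])
     ∷ branch 0 1 4 12488231997041761696598815837 (copy 0 281473918145 ∷ [])
     ∷ branch 0 1 4 149779287117297749515052348509 (copy 0 276758344865 ∷ [])
     ∷ branch 0 1 4 149852159227234191122174669917 (copy 0 274186054265 ∷ [])
     ∷ branch 0 1 4 149858737959381230989484323933 (copy 0 274400411815 ∷ [])
     ∷ branch 0 1 4 149858780130741147911710667869 (copy 0 276543987315 ∷ [])
     ∷ branch 0 1 4 149858783937877807078300546141 (copy 0 281259560595 ∷ []) ∷ [])
   ∷ branch 0 1 3 138331142707347304518601962589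
     ( branch 0 1 7 138411237967212858803970208861 (copy 0 279758856885 ∷ [])
     ∷ branch 0 1 6 138411237967212858803970208861 (copy 0 279544659055 ∷ [])
     ∷ branch 0 1 6 149779287117297749515052348509 (copy 0 277186872415 ∷ [])
     ∷ branch 0 1 6 149858231903062227922768196701 (copy 0 269470000615 ∷ [])
     ∷ branch 0 1 4 138411237967212858803970208861 (copy 0 279115970575 ∷ [])
     ∷ branch 0 1 4 149779287117297749515052348509 (copy 0 276758183935 ∷ [])
     ∷ branch 0 1 4 149858231903062227922768196701 (copy 0 274185893335 ∷ [])
     ∷ branch 0 1 4 149858737959381230989484323933 (copy 0 274400250885 ∷ [])
     ∷ branch 0 1 4 149858783645021140988562863197 (copy 0 276543826385 ∷ [])
     ∷ branch 0 1 4 149858783937877807078300546141 (copy 0 278901613025 ∷ []) ∷ [])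
   ∷ branch 0 1 3 148897640819491262646656988253
     ( branch 0 1 7 148904821798060450229584491613 (copy 0 271613766075 ∷ [])
     ∷ branch 0 1 6 148904821798060450229584491613 (copy 0 271613764865 ∷ [])
     ∷ branch 0 1 6 149852159227234191122174669917 (copy 0 271613750345 ∷ [])
     ∷ branch 0 1 6 149858231903062227922768196701 (copy 0 271613589415 ∷ [])
     ∷ branch 0 1 4 148904821798060450229584491613 (copy 0 271613762225 ∷ [])
     ∷ branch 0 1 4 149852159227234191122174669917 (copy 0 271613747705 ∷ [])
     ∷ branch 0 1 4 149858231903062227922768196701 (copy 0 271613586775 ∷ [])
     ∷ branch 0 1 4 149858780130741147911710667869 (copy 0 271613733075 ∷ [])
     ∷ branch 0 1 4 149858783645021140988562863197 (copy 0 271613572145 ∷ [])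
     ∷ branch 0 1 4 149858783937877807078300546141 (copy 0 271613411105 ∷ []) ∷ [])
   ∷ branch 0 1 3 86723830893877903509861469
     ( branch 0 1 8 12488231997041761696598815837 (copy 0 282331002175 ∷ [])
     ∷ branch 0 1 5 12488231997041761696598815837 (copy 0 281688408685 ∷ [])
     ∷ branch 0 1 5 138411237967212858803970208861 (copy 0 279330622045 ∷ [])
     ∷ branch 0 1 5 148904821798060450229584491613 (copy 0 269470174745 ∷ [])
     ∷ branch 0 1 4 12488231997041761696598815837 (copy 0 281474064445 ∷ [])
     ∷ branch 0 1 4 138411237967212858803970208861 (copy 0 279116277805 ∷ [])
     ∷ branch 0 1 4 148904821798060450229584491613 (copy 0 271828121105 ∷ [])
     ∷ branch 0 1 4 149858783962282529252445353053 (copy 0 272042478655 ∷ [])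
     ∷ branch 0 1 4 149858783964316256100290753629 (copy 0 278901920255 ∷ [])
     ∷ branch 0 1 4 149858783964485733337611203677 (copy 0 281259706895 ∷ []) ∷ [])
   ∷ branch 0 1 3 12402110410166632667049800797
     ( branch 0 1 7 12488231997041761696598815837 (copy 0 282116643415 ∷ [])
     ∷ branch 0 1 5 12488231997041761696598815837 (copy 0 281688247755 ∷ [])
     ∷ branch 0 1 5 149779287117297749515052348509 (copy 0 276972674475 ∷ [])
     ∷ branch 0 1 5 149852159227234191122174669917 (copy 0 269470160225 ∷ [])
     ∷ branch 0 1 4 12488231997041761696598815837 (copy 0 281473903515 ∷ [])
     ∷ branch 0 1 4 149779287117297749515052348509 (copy 0 276758330235 ∷ [])
     ∷ branch 0 1 4 149852159227234191122174669917 (copy 0 271828106585 ∷ [])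
     ∷ branch 0 1 4 149858783962282529252445353053 (copy 0 272042464135 ∷ [])
     ∷ branch 0 1 4 149858783964316256100290753629 (copy 0 276543972685 ∷ [])
     ∷ branch 0 1 4 149858783964499856440721241181 (copy 0 281259545965 ∷ []) ∷ [])
   ∷ branch 0 1 3 138331189056335244493426177117
     ( branch 0 1 7 138411237967212858803970208861 (copy 0 279758695845 ∷ [])
     ∷ branch 0 1 5 138411237967212858803970208861 (copy 0 279330300185 ∷ [])
     ∷ branch 0 1 5 149779287117297749515052348509 (copy 0 276972513545 ∷ [])
     ∷ branch 0 1 5 149858231903062227922768196701 (copy 0 269469999295 ∷ [])
     ∷ branch 0 1 4 138411237967212858803970208861 (copy 0 279115955945 ∷ [])
     ∷ branch 0 1 4 149779287117297749515052348509 (copy 0 276758169305 ∷ [])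
     ∷ branch 0 1 4 149858231903062227922768196701 (copy 0 271827945655 ∷ [])
     ∷ branch 0 1 4 149858783962282529252445353053 (copy 0 272042303205 ∷ [])
     ∷ branch 0 1 4 149858783964485733337611203677 (copy 0 276543811755 ∷ [])
     ∷ branch 0 1 4 149858783964499856440721241181 (copy 0 278901598395 ∷ []) ∷ [])
   ∷ branch 0 1 3 148897644999153012547100259421
     ( branch 0 1 7 148904821798060450229584491613 (copy 0 273971713645 ∷ [])
     ∷ branch 0 1 5 148904821798060450229584491613 (copy 0 273971711225 ∷ [])
     ∷ branch 0 1 5 149852159227234191122174669917 (copy 0 273971696705 ∷ [])
     ∷ branch 0 1 5 149858231903062227922768196701 (copy 0 273971535775 ∷ [])
     ∷ branch 0 1 4 148904821798060450229584491613 (copy 0 273971709905 ∷ [])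
     ∷ branch 0 1 4 149852159227234191122174669917 (copy 0 273971695385 ∷ [])
     ∷ branch 0 1 4 149858231903062227922768196701 (copy 0 273971534455 ∷ [])
     ∷ branch 0 1 4 149858783964316256100290753629 (copy 0 273971666125 ∷ [])
     ∷ branch 0 1 4 149858783964485733337611203677 (copy 0 273971505195 ∷ [])
     ∷ branch 0 1 4 149858783964499856440721241181 (copy 0 273971344155 ∷ []) ∷ [])
   ∷ branch 0 1 3 12488182155758247861006742621
     ( branch 0 1 6 12488231997041761696598815837 (copy 0 281902284545 ∷ [])
     ∷ branch 0 1 5 12488231997041761696598815837 (copy 0 281688086715 ∷ [])
     ∷ branch 0 1 5 149858737959381230989484323933 (copy 0 274614726795 ∷ [])
     ∷ branch 0 1 5 149858780130741147911710667869 (copy 0 269470145595 ∷ [])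
     ∷ branch 0 1 4 12488231997041761696598815837 (copy 0 281473742475 ∷ [])
     ∷ branch 0 1 4 149858737959381230989484323933 (copy 0 274400382555 ∷ [])
     ∷ branch 0 1 4 149858780130741147911710667869 (copy 0 271828091955 ∷ [])
     ∷ branch 0 1 4 149858783962282529252445353053 (copy 0 272042449505 ∷ [])
     ∷ branch 0 1 4 149858783964316256100290753629 (copy 0 274186025005 ∷ [])
     ∷ branch 0 1 4 149858783964501033365980410973 (copy 0 281259384925 ∷ []) ∷ [])
   ∷ branch 0 1 3 138411191640378815963641787485
     ( branch 0 1 6 138411237967212858803970208861 (copy 0 279544336975 ∷ [])
     ∷ branch 0 1 5 138411237967212858803970208861 (copy 0 279330139145 ∷ [])
     ∷ branch 0 1 5 149858737959381230989484323933 (copy 0 274614565865 ∷ [])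
     ∷ branch 0 1 5 149858783645021140988562863197 (copy 0 269469984665 ∷ [])
     ∷ branch 0 1 4 138411237967212858803970208861 (copy 0 279115794905 ∷ [])
     ∷ branch 0 1 4 149858737959381230989484323933 (copy 0 274400221625 ∷ [])
     ∷ branch 0 1 4 149858783645021140988562863197 (copy 0 271827931025 ∷ [])
     ∷ branch 0 1 4 149858783962282529252445353053 (copy 0 272042288575 ∷ [])
     ∷ branch 0 1 4 149858783964485733337611203677 (copy 0 274185864075 ∷ [])
     ∷ branch 0 1 4 149858783964501033365980410973 (copy 0 278901437355 ∷ []) ∷ [])
   ∷ branch 0 1 3 148904817644620059332419892317
     ( branch 0 1 6 148904821798060450229584491613 (copy 0 276329660005 ∷ [])
     ∷ branch 0 1 5 148904821798060450229584491613 (copy 0 276329658795 ∷ [])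
     ∷ branch 0 1 5 149858780130741147911710667869 (copy 0 276329629755 ∷ [])
     ∷ branch 0 1 5 149858783645021140988562863197 (copy 0 276329468825 ∷ [])
     ∷ branch 0 1 4 148904821798060450229584491613 (copy 0 276329657475 ∷ [])
     ∷ branch 0 1 4 149858780130741147911710667869 (copy 0 276329628435 ∷ [])
     ∷ branch 0 1 4 149858783645021140988562863197 (copy 0 276329467505 ∷ [])
     ∷ branch 0 1 4 149858783964316256100290753629 (copy 0 276329613805 ∷ [])
     ∷ branch 0 1 4 149858783964485733337611203677 (copy 0 276329452875 ∷ [])
     ∷ branch 0 1 4 149858783964501033365980410973 (copy 0 276329130795 ∷ []) ∷ [])
   ∷ branch 0 1 3 149779241083334495924329231453
     ( branch 0 1 6 149779287117297749515052348509 (copy 0 277186389295 ∷ [])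
     ∷ branch 0 1 5 149779287117297749515052348509 (copy 0 276972191465 ∷ [])
     ∷ branch 0 1 5 149858737959381230989484323933 (copy 0 274614404825 ∷ [])
     ∷ branch 0 1 5 149858783937877807078300546141 (copy 0 269469823625 ∷ [])
     ∷ branch 0 1 4 149779287117297749515052348509 (copy 0 276757847225 ∷ [])
     ∷ branch 0 1 4 149858737959381230989484323933 (copy 0 274400060585 ∷ [])
     ∷ branch 0 1 4 149858783937877807078300546141 (copy 0 271827769985 ∷ [])
     ∷ branch 0 1 4 149858783962282529252445353053 (copy 0 272042127535 ∷ [])
     ∷ branch 0 1 4 149858783964499856440721241181 (copy 0 274185703035 ∷ [])
     ∷ branch 0 1 4 149858783964501033365980410973 (copy 0 276543489675 ∷ []) ∷ [])
   ∷ branch 0 1 3 149852155366664589474615374941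
     ( branch 0 1 6 149852159227234191122174669917 (copy 0 278687593055 ∷ [])
     ∷ branch 0 1 5 149852159227234191122174669917 (copy 0 278687591845 ∷ [])
     ∷ branch 0 1 5 149858780130741147911710667869 (copy 0 278687577325 ∷ [])
     ∷ branch 0 1 5 149858783937877807078300546141 (copy 0 278687255465 ∷ [])
     ∷ branch 0 1 4 149852159227234191122174669917 (copy 0 278687590525 ∷ [])
     ∷ branch 0 1 4 149858780130741147911710667869 (copy 0 278687576005 ∷ [])
     ∷ branch 0 1 4 149858783937877807078300546141 (copy 0 278687254145 ∷ [])
     ∷ branch 0 1 4 149858783964316256100290753629 (copy 0 278687561375 ∷ [])
     ∷ branch 0 1 4 149858783964499856440721241181 (copy 0 278687239515 ∷ [])
     ∷ branch 0 1 4 149858783964501033365980410973 (copy 0 278687078475 ∷ []) ∷ [])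
   ∷ branch 0 1 3 149858231556942097270472553565
     ( branch 0 1 6 149858231903062227922768196701 (copy 0 281045379695 ∷ [])
     ∷ branch 0 1 5 149858231903062227922768196701 (copy 0 281045378485 ∷ [])
     ∷ branch 0 1 5 149858783645021140988562863197 (copy 0 281045363965 ∷ [])
     ∷ branch 0 1 5 149858783937877807078300546141 (copy 0 281045203035 ∷ [])
     ∷ branch 0 1 4 149858231903062227922768196701 (copy 0 281045377165 ∷ [])
     ∷ branch 0 1 4 149858783645021140988562863197 (copy 0 281045362645 ∷ [])
     ∷ branch 0 1 4 149858783937877807078300546141 (copy 0 281045201715 ∷ [])
     ∷ branch 0 1 4 149858783964485733337611203677 (copy 0 281045348015 ∷ [])
     ∷ branch 0 1 4 149858783964499856440721241181 (copy 0 281045187085 ∷ [])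
     ∷ branch 0 1 4 149858783964501033365980410973 (copy 0 281045026045 ∷ []) ∷ []) ∷ [])

scarceTree-valid : verify bound scarce (pencil ∷ []) scarceTree allTriples [] ≡ true
scarceTree-valid = refl

-- The 28 · 10 leaves of the tree are the partitions of nine points into three triples. As `∞` is
-- one of these nine points and not of the common pair, a permutation that fixes `∞` turns `pencil`
-- into each of them.
standard-if-scarce : ∀ {Cs} → Admissible bound Cs → codegree 0F 1F Cs ≤ 3 → Goal Cs
standard-if-scarce adm few =
  verify-sound scarce {db = pencil ∷ []} (pencil-good ∷ []) (λ Cs → codegree 0F 1F Cs ≤ 3)
    (λ x few adm part → scarce-sound few adm part x) few adm scarceTree allTriples [] scarceTree-valid
    (partial-start (Admissible.meeting adm))

-- Reduction of all coverings with twenty blocks to the scarce case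

scarce-partner : ∀ {Cs} → Admissible bound Cs → ∃ λ y → (y ≢ 0F × y ≢ ∞) × codegree 0F y Cs ≤ 3
scarce-partner {Cs} adm with any? (λ y → (¬? (y ≟ 0F) ×-dec ¬? (y ≟ ∞)) ×-dec (codegree 0F y Cs ≤? 3))
... | yes (y , found) = y , found
... | no none = ⊥-elim (ℕ.<-irrefl refl (begin-strict
  -- Otherwise nine points share four or more blocks with 0, and `∞` shares three: in all 39, not
  -- counting the diagonal term `d`. But the at most nine blocks through 0 have only 4 · 9 = 36
  -- further incidences.
  39 + d              ≡⟨ cong (39 +_) (codegree-diagonal 0F Cs) ⟨
  sum floor + codegree 0F 0F Cs  ≤⟨ sum-gap (λ y → codegree 0F y Cs) floor floor≤ 0F ⟩
  sum (λ y → codegree 0F y Cs) + 0 ≡⟨ ℕ.+-identityʳ _ ⟩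
  sum (λ y → codegree 0F y Cs) ≡⟨ sum-codegree 0F sizes ⟩
  5 * d               ≡⟨ ℕ.+-comm d (4 * d) ⟩
  4 * d + d           ≤⟨ ℕ.+-monoˡ-≤ d (ℕ.*-monoʳ-≤ 4 (bounded 0F)) ⟩
  36 + d              <⟨ ℕ.m<n+m (36 + d) {3} (s≤s z≤n) ⟩
  39 + d ∎))
  where
  open ≤-Reasoning
  open Admissible adm
  d = degree 0F Cs
  floor : Fin 11 → ℕ
  floor y = if does (y ≟ 0F) then 0 else if does (y ≟ ∞) then 3 else 4
  three : 3 ≤ codegree 0F ∞ Cs
  -- In the full table the row of 0 and `∞` has nine points, which require three blocks.
  three = need≤codegree {t = allTriples} sizes (proj₂ (proj₂ (partial-start meeting))) {0F} {∞} λ ()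
  floor≤ : ∀ y → floor y ≤ codegree 0F y Cs
  floor≤ y with y ≟ 0F | y ≟ ∞
  ... | yes _  | _        = z≤n
  ... | no _   | yes refl = three
  ... | no y≢0 | no y≢∞   = ℕ.≰⇒> λ few → none (y , (y≢0 , y≢∞) , few)

relabel : Fin 11 → Permutation′ 11
relabel y = transpose y 1F

-- This is why the partner must differ from `∞`: exchanging `∞` with 1 would put the bound 10 where
-- 9 is required.
relabel-bound : ∀ y → y ≢ ∞ → ∀ x → bound (relabel y ⟨$⟩ˡ x) ≤ bound x
relabel-bound = witness
  (all? λ y → ¬? (y ≟ ∞) →-dec all? λ x → bound (relabel y ⟨$⟩ˡ x) ≤? bound x) refl

relabel-fixes : ∀ y → y ≢ 0F → relabel y ⟨$⟩ˡ 0F ≡ 0F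
relabel-fixes = witness (all? λ y → ¬? (y ≟ 0F) →-dec (relabel y ⟨$⟩ˡ 0F ≟ 0F)) refl

admissible⇒standard : ∀ {Cs} → Admissible bound Cs → Goal Cs
admissible⇒standard {Cs} adm len with scarce-partner adm
... | y , (y≢0 , y≢∞) , few = standard-images σ Cs
  (standard-if-scarce (admissible-images (Perm.flip σ) (relabel-bound y y≢∞) adm)
    (ℕ.≤-trans (ℕ.≤-reflexive (trans (codegree-images σ 0F 1F Cs)
      (cong₂ (λ x y → codegree x y Cs) (relabel-fixes y y≢0) refl))) few)
    (trans (length-map (image σ) Cs) len))
  where
  σ = relabel y

-- The bounds add up to 10 · 9 + 10 = 100, which is the number 5 · 20 of incidences, so lower bounds
-- are also upper bounds.
exact-degrees : ∀ {Cs} → IsCover Cs → (∀ x → bound x ≤ degree x Cs) → Admissible bound Cs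
exact-degrees {Cs} (len , sizes , meeting) lower = record
  { sizes = sizes ; meeting = meeting
  ; bounded = sum-saturated (λ x → degree x Cs) bound lower (ℕ.≤-reflexive total)
  }
  where
  total : sum (λ x → degree x Cs) ≡ 100
  total = trans (sum-degree {k = 5} {Bs = Cs} sizes) (cong (5 *_) len)

cover⇒standard : ∀ {Cs} → IsCover Cs → Standard Cs
cover⇒standard {Cs} cover with any? (λ x → 10 ≤? degree x Cs)
... | yes (x , 10≤d) = standard-images σ Cs (admissible⇒standard (exact-degrees cover′ lower) (proj₁ cover′))
  where
  σ = transpose x ∞
  cover′ = images-cover σ cover
  lower : ∀ y → bound y ≤ degree y (images σ Cs)
  lower y with y ≟ ∞
  ... | no _     = degree≥9 cover′ y
  ... | yes refl = ℕ.≤-trans 10≤d (ℕ.≤-reflexive (sym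
    (trans (degree-images σ ∞ Cs) refl)))
-- Eleven degrees of at most nine cannot add up to 100, but no contradiction has to be derived: such
-- degrees stay within `bound`, and the search covers this case as well.
... | no none = admissible⇒standard adm (proj₁ cover)
  where
  bounded : ∀ x → degree x Cs ≤ bound x
  bounded x = ℕ.≤-trans (s≤s⁻¹ (ℕ.≰⇒> λ 10≤d → none (x , 10≤d))) (nine x)
    where
    nine : ∀ x → 9 ≤ bound x
    nine = witness (all? λ x → 9 ≤? bound x) refl
  adm : Admissible bound Cs
  adm = record { sizes = proj₁ (proj₂ cover) ; meeting = proj₂ (proj₂ cover) ; bounded = bounded }

-- Counting the classes of a setoid

module _ (S : Setoid 0ℓ 0ℓ) where
  private module S = Setoid S
  open S using (_≈_) renaming (Carrier to A)

  bijection : ∀ {n} (f : Fin n → A) → (∀ {i j} → f i ≈ f j → i ≡ j) → (∀ x → ∃ λ i → f i ≈ x) →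
              HasCardinality S n
  bijection f injective surjective = record
    { to        = f
    ; cong      = λ { refl → S.refl }
    ; bijective = injective , λ x → proj₁ (surjective x) , λ { refl → proj₂ (surjective x) }
    }

  module Count {n : ℕ} (card : HasCardinality S n) where
    open Bijection card using (strictlySurjective)

    to : Fin n → A
    to = Bijection.to card

    to-injective : ∀ {i j} → to i ≈ to j → i ≡ j
    to-injective = Bijection.injective card

    index : A → Fin n
    index x = proj₁ (strictlySurjective x)

    to-index : ∀ x → to (index x) ≈ x
    to-index x = proj₂ (strictlySurjective x)

    index-injective : ∀ {x y} → index x ≡ index y → x ≈ y
    index-injective {x} {y} eq =
      S.trans (S.sym (to-index x)) (S.trans (S.reflexive (cong to eq)) (to-index y))

  cardinality-unique : ∀ {m n} → HasCardinality S m → HasCardinality S n → m ≡ n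
  cardinality-unique a b = cantor-schröder-bernstein
    (Count.to-injective a ∘ Count.index-injective b)
    (Count.to-injective b ∘ Count.index-injective a)

module _ (S : DecSetoid 0ℓ 0ℓ) where
  private module S = DecSetoid S
  open S using (_≈_; setoid) renaming (Carrier to A; _≟_ to _≈?_)
  open SetoidMembership setoid using () renaming (_∈_ to _∈ₛ_)
  open SetoidUnique setoid using () renaming (Unique to Uniqueₛ)

  lookup-injective : ∀ {xs} → Uniqueₛ xs → ∀ i j → List.lookup xs i ≈ List.lookup xs j → i ≡ j
  lookup-injective (_ ∷ _)      zero    zero    _  = refl
  lookup-injective (x∉xs ∷ _)   zero    (suc j) eq = ⊥-elim (All.lookup x∉xs (∈-lookup j) eq)
  lookup-injective (x∉xs ∷ _)   (suc i) zero    eq = ⊥-elim (All.lookup x∉xs (∈-lookup i) (S.sym eq))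
  lookup-injective (_ ∷ unique) (suc i) (suc j) eq = cong suc (lookup-injective unique i j eq)

  -- Removing repetitions from the list of values gives an enumeration before its length is known.
  -- `quotient-count` then finds the length by counting.
  finite-image : ∀ {N} (f : Fin N → A) → (∀ x → ∃ λ i → f i ≈ x) → ∃ (HasCardinality setoid)
  finite-image {N} f surjective = length xs , bijection setoid (List.lookup xs)
    (λ {i} {j} → lookup-injective (deduplicate-! S ys) i j)
    (λ x → Any.index (x∈xs x) , S.sym (Any.lookup-index (x∈xs x)))
    where
    ys = map f (allFin N)
    xs = deduplicate _≈?_ ys
    x∈xs : ∀ x → x ∈ₛ xs
    x∈xs = Enumerates.deduplicate⁺ S λ x → let i , fi≈x = surjective x in
      Any.map⁺ (Any.map (λ { refl → S.sym fi≈x }) (∈-allFin i))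

permutationSetoid : ℕ → Setoid 0ℓ 0ℓ
permutationSetoid n = record
  { Carrier = Permutation′ n
  ; _≈_     = Perm._≈_
  ; isEquivalence = record
    { refl  = λ _ → refl
    ; sym   = λ eq i → sym (eq i)
    ; trans = λ eq₁ eq₂ i → trans (eq₁ i) (eq₂ i)
    }
  }

insert-cong : ∀ {n} (i : Fin (suc n)) {π ρ : Permutation′ n} →
              π Perm.≈ ρ → insert 0F i π Perm.≈ insert 0F i ρ
insert-cong i         eq 0F      = refl
insert-cong i {π} {ρ} eq (suc k) = trans (insert-punchIn 0F i π k)
  (trans (cong (punchIn i) (eq k)) (sym (insert-punchIn 0F i ρ k)))

-- A permutation of `suc n` points is the image of 0 together with a permutation of the others,
-- which `remove` extracts and `insert` restores.
permutation-count : ∀ n → HasCardinality (permutationSetoid n) (n !)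
permutation-count zero    = bijection _ (λ _ → Perm.id) (λ { {0F} {0F} _ → refl ; {suc ()} ; {0F} {suc ()} })
                                    (λ _ → 0F , λ ())
permutation-count (suc n) = bijection _ (λ k → assemble (remQuot {suc n} (n !) k)) injective surjective
  where
  open Count (permutationSetoid n) (permutation-count n)
  assemble : Fin (suc n) × Fin (n !) → Permutation′ (suc n)
  assemble (i , k) = insert 0F i (to k)
  assemble-injective : ∀ p q → assemble p Perm.≈ assemble q → p ≡ q
  assemble-injective (i , k) (j , l) eq with refl ← eq 0F =
    cong (i ,_) (to-injective λ x → punchIn-injective i _ _
      (trans (sym (insert-punchIn 0F i (to k) x)) (trans (eq (suc x)) (insert-punchIn 0F i (to l) x))))
  injective : ∀ {k l} → assemble (remQuot {suc n} (n !) k) Perm.≈ assemble (remQuot {suc n} (n !) l) → k ≡ l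
  injective {k} {l} eq = trans (sym (combine-remQuot {suc n} (n !) k))
    (trans (cong (uncurry combine) (assemble-injective _ (remQuot {suc n} (n !) l) eq))
           (combine-remQuot {suc n} (n !) l))
  surjective : ∀ π → ∃ λ k → assemble (remQuot {suc n} (n !) k) Perm.≈ π
  surjective π = combine (π ⟨$⟩ʳ 0F) j , λ x → trans
    (cong (λ p → assemble p ⟨$⟩ʳ x) (remQuot-combine (π ⟨$⟩ʳ 0F) j))
    (trans (insert-cong (π ⟨$⟩ʳ 0F) (to-index (remove 0F π)) x) (insert-remove 0F π x))
    where j = index (remove 0F π)

-- Orbit–stabiliser, for an action of a finite setoid of group elements G on
-- X presented by the orbit map of one point: the fibres have m elements each.

module _ (G : Setoid 0ℓ 0ℓ) (X : DecSetoid 0ℓ 0ℓ) where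
  private
    module G = Setoid G
    module X = DecSetoid X

  quotient-count : ∀ {N m q} .{{_ : NonZero m}} → HasCardinality G N → N ≡ q * m →
    (orbit : G.Carrier → X.Carrier) → (∀ {g h} → g G.≈ h → orbit g X.≈ orbit h) →
    (shift : Fin m → G.Carrier → G.Carrier) →
    (∀ i g → orbit (shift i g) X.≈ orbit g) →
    (∀ {i j} g → shift i g G.≈ shift j g → i ≡ j) →
    (∀ g h → orbit g X.≈ orbit h → ∃ λ i → shift i g G.≈ h) →
    (∀ x → ∃ λ g → orbit g X.≈ x) →
    HasCardinality X.setoid q
  quotient-count {N} {m} {q} cardG N≡qm orbit orbit-cong shift fixes faithful transitive onto =
    -- With `r` classes and fibres of `m` elements, `r * m ≡ N ≡ q * m`; cancelling `m` identifies
    -- `r`.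
    subst (HasCardinality X.setoid) (ℕ.*-cancelʳ-≡ r q m (trans (cardinality-unique G pairs cardG) N≡qm)) cardX
    where
    finite : ∃ (HasCardinality X.setoid)
    finite = finite-image X (orbit ∘ Count.to G cardG) λ x → let g , gx = onto x in
      Count.index G cardG g , X.trans (orbit-cong (Count.to-index G cardG g)) gx
    r = proj₁ finite
    cardX = proj₂ finite
    open Count X.setoid cardX
    rep : Fin r → G.Carrier
    rep k = proj₁ (onto (to k))
    orbit-rep : ∀ k → orbit (rep k) X.≈ to k
    orbit-rep k = proj₂ (onto (to k))
    element : Fin r × Fin m → G.Carrier
    element (k , i) = shift i (rep k)
    element-injective : ∀ p p′ → element p G.≈ element p′ → p ≡ p′
    element-injective (k , i) (k′ , i′) eq
      with refl ← to-injective {k} {k′} (X.trans (X.sym (orbit-rep k)) (X.trans (X.sym (fixes i (rep k)))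
                    (X.trans (orbit-cong eq) (X.trans (fixes i′ (rep k′)) (orbit-rep k′)))))
      = cong (k ,_) (faithful (rep k) eq)
    pairs : HasCardinality G (r * m)
    pairs = bijection G (λ k → element (remQuot {r} m k))
      (λ {k} {l} eq → trans (sym (combine-remQuot {r} m k))
        (trans (cong (uncurry combine) (element-injective _ (remQuot {r} m l) eq)) (combine-remQuot {r} m l)))
      (λ g → let k = index (orbit g)
                 i , eq = transitive (rep k) g (X.trans (orbit-rep k) (to-index (orbit g)))
             in combine k i , G.trans (G.reflexive (cong element (remQuot-combine k i))) eq)

-- Stabilisers of lists of blocks

module SetEq {n} = Setoid ([ set ]-Equality (Subset n))
module SetEqReasoning {n} = SetoidReasoning ([ set ]-Equality (Subset n))

images-cong : (π : Permutation′ n) {xs ys : List (Subset n)} → xs ∼[ set ] ys → images π xs ∼[ set ] images π ys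
images-cong π = Eq.map-cong λ _ → refl

images-flip : (π : Permutation′ n) (xs : List (Subset n)) → images (Perm.flip π) (images π xs) ≡ xs
images-flip π xs = trans (sym (map-∘ xs)) (trans (map-cong (image-flip π) xs) (map-id xs))

images-≈ : {π ρ : Permutation′ n} → π Perm.≈ ρ → (xs : List (Subset n)) → images π xs ≡ images ρ xs
images-≈ {π = π} {ρ} eq = map-cong (image-cong π ρ λ i →
  trans (sym (inverseˡ ρ)) (cong (ρ ⟨$⟩ˡ_) (trans (sym (eq (π ⟨$⟩ˡ i))) (inverseʳ π))))

images-swap : (π : Permutation′ n) {xs ys : List (Subset n)} →
              images π xs ∼[ set ] ys → xs ∼[ set ] images (Perm.flip π) ys
images-swap π {xs} eq = SetEq.trans (SetEq.reflexive (sym (images-flip π xs))) (images-cong (Perm.flip π) eq)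

image-injective : (π : Permutation′ n) {p q : Subset n} → image π p ≡ image π q → p ≡ q
image-injective π eq = trans (sym (image-flip π _)) (trans (cong (image (Perm.flip π)) eq) (image-flip π _))

Stabiliser : List (Subset n) → Vec (Fin n) n → Set
Stabiliser {n} S f = ∃ λ (π : Permutation′ n) → (∀ i → π ⟨$⟩ʳ i ≡ lookup f i) × images π S ∼[ set ] S

-- Only π⁻¹ is applied to blocks: it is a vector lookup, whereas π itself
-- would have to be searched for.

preserves : List (Subset n) → Maybe (Permutation′ n) → Bool
preserves S nothing  = false
preserves S (just π) = does (All.all? (_∈ₗ? S) (images (Perm.flip π) S))

inverse-lookup : ∀ (f : Vec (Fin (suc n)) (suc n)) {π} → inverse f ≡ just π → ∀ i → π ⟨$⟩ʳ i ≡ lookup f i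
inverse-lookup f eq i with all? (λ i → lookup f (position i f) ≟ i) | all? (λ i → position (lookup f i) f ≟ i)
inverse-lookup f refl i | yes _ | yes _ = refl

-- Inclusion of the image in `S` is enough to test: the image is free of repetitions and as long as
-- `S`, hence a rearrangement of it.
stabiliser : ∀ {S} → Unique S → (f : Vec (Fin (suc n)) (suc n)) → preserves S (inverse f) ≡ true → Stabiliser S f
stabiliser {S = S} unique f ok with inverse f in eq
... | just π = π , inverse-lookup f eq , SetEq.sym (images-swap (Perm.flip π)
  (mk⇔ (↭.∈-resp-↭ same) (↭.∈-resp-↭ (↭-sym same))))
  where
  same : images (Perm.flip π) S ↭ S
  same = unique-⊆-↭ (Unique.map⁺ (image-injective (Perm.flip π)) unique)
    (witness (All.all? (_∈ₗ? S) (images (Perm.flip π) S)) ok) (sym (length-map (image (Perm.flip π)) S))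

all-true : ∀ {A : Set} (p : A → Bool) xs → all p xs ≡ true → All (λ x → p x ≡ true) xs
all-true p []       _  = []
all-true p (x ∷ xs) ok = proj₁ (∧⁻ ok) ∷ all-true p xs (proj₂ (∧⁻ ok))

-- Maps preserving a matrix

entry : Vec (Vec ℕ n) n → Fin n → Fin n → ℕ
entry M x y = lookup (lookup M x) y

Compatible : Vec (Vec ℕ n) n → Fin n → Vec (Fin n) m → Vec (Fin n) (suc m) → Set
Compatible M p ps (q ∷ qs) = entry M q q ≡ entry M p p × (∀ i → entry M q (lookup qs i) ≡ entry M p (lookup ps i))

compatible? : (M : Vec (Vec ℕ n) n) (p : Fin n) (ps : Vec (Fin n) m) → ∀ qs → Dec (Compatible M p ps qs)
compatible? M p ps (q ∷ qs) =
  (entry M q q ℕ.≟ entry M p p) ×-dec all? (λ i → entry M q (lookup qs i) ℕ.≟ entry M p (lookup ps i))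

-- Partial maps are built up from the last point and filtered at each stage, so the n-fold product
-- of choices is never formed. Injectivity is left to `inverse`, through which every result passes
-- later.
embeddings : Vec (Vec ℕ n) n → Vec (Fin n) m → List (Vec (Fin n) m)
embeddings M []       = [] ∷ []
embeddings M (p ∷ ps) = filter (compatible? M p ps) (cartesianProductWith _∷_ (allFin _) (embeddings M ps))

∈-embeddings : (M : Vec (Vec ℕ n) n) (f : Fin n → Fin n) → (∀ x y → entry M (f x) (f y) ≡ entry M x y) →
               (ps : Vec (Fin n) m) → Vec.map f ps ∈ₗ embeddings M ps
∈-embeddings M f preserves []       = here refl
∈-embeddings M f preserves (p ∷ ps) = ∈-filter⁺ (compatible? M p ps)
  (∈-cartesianProductWith⁺ _∷_ (∈-allFin (f p)) (∈-embeddings M f preserves ps))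
  (preserves p p , λ i → trans (cong (entry M (f p)) (lookup-map i f ps)) (preserves p (lookup ps i)))

embeddings-unique : (M : Vec (Vec ℕ n) n) (ps : Vec (Fin n) m) → Unique (embeddings M ps)
embeddings-unique M []       = [] ∷ []
embeddings-unique M (p ∷ ps) = Unique.filter⁺ (compatible? M p ps)
  (Unique.cartesianProductWith⁺ _∷_ ∷-injective (Unique.allFin⁺ _) (embeddings-unique M ps))

-- An automorphism preserves the matrix of codegrees; conversely the maps that
-- preserve it are few enough to be tested one by one.

codegrees : List (Subset n) → Vec (Vec ℕ n) n
codegrees S = tabulate λ x → tabulate λ y → codegree x y S

entry-codegrees : (S : List (Subset n)) → ∀ x y → entry (codegrees S) x y ≡ codegree x y S
entry-codegrees S x y = trans
  (cong (λ v → lookup v y) (lookup∘tabulate (λ x → tabulate λ y → codegree x y S) x))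
  (lookup∘tabulate (λ y → codegree x y S) y)

candidates : (S : List (Subset n)) → List (Vec (Fin n) n)
candidates S = embeddings (codegrees S) (Vec.allFin _)

AllPreserve : List (Subset (suc n)) → Bool
AllPreserve S = all (preserves S ∘ inverse) (candidates S)

-- Since neither list repeats a block, their equality as sets is a rearrangement, under which
-- tallies do not change.
codegree-stable : {S : List (Subset n)} → Unique S → ∀ τ → images τ S ∼[ set ] S →
                  ∀ x y → codegree (τ ⟨$⟩ʳ x) (τ ⟨$⟩ʳ y) S ≡ codegree x y S
codegree-stable {S = S} unique τ stable x y = begin
  codegree (τ ⟨$⟩ʳ x) (τ ⟨$⟩ʳ y) S
    ≡⟨ tally-↭ (λ B → lookup B (τ ⟨$⟩ʳ x) ∧ lookup B (τ ⟨$⟩ʳ y))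
         (∼bag⇒↭ (unique∧set⇒bag (Unique.map⁺ (image-injective τ) unique) unique stable)) ⟨
  codegree (τ ⟨$⟩ʳ x) (τ ⟨$⟩ʳ y) (images τ S)
    ≡⟨ codegree-images τ _ _ S ⟩
  codegree (τ ⟨$⟩ˡ (τ ⟨$⟩ʳ x)) (τ ⟨$⟩ˡ (τ ⟨$⟩ʳ y)) S
    ≡⟨ cong₂ (λ x y → codegree x y S) (inverseˡ τ) (inverseˡ τ) ⟩
  codegree x y S
    ∎
  where open ≡-Reasoning

∈-candidates : {S : List (Subset n)} → Unique S → ∀ τ → images τ S ∼[ set ] S →
               Vec.map (τ ⟨$⟩ʳ_) (Vec.allFin n) ∈ₗ candidates S
∈-candidates {S = S} unique τ stable = ∈-embeddings (codegrees S) (τ ⟨$⟩ʳ_) (λ x y →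
  trans (entry-codegrees S (τ ⟨$⟩ʳ x) (τ ⟨$⟩ʳ y))
        (trans (codegree-stable unique τ stable x y) (sym (entry-codegrees S x y)))) (Vec.allFin _)

-- The group of S is conjugated by an isomorphism ρ from C to S.

module _ {t k : ℕ} {S : List (Subset (suc n))} (unique : Unique S) (checked : AllPreserve S ≡ true)
         (C : Covering t (suc n) k) (ρ : Permutation′ (suc n)) (isomorphism : images ρ (blocks C) ∼[ set ] S) where

  conjugate : Permutation′ (suc n) → Permutation′ (suc n)
  conjugate π = ρ ∘ₚ π ∘ₚ Perm.flip ρ

  conjugate-stable : ∀ π → images π S ∼[ set ] S → images (conjugate π) (blocks C) ∼[ set ] blocks C
  conjugate-stable π stable = begin
    images (conjugate π) (blocks C)
      ≡⟨ trans (images-∘ ρ (π ∘ₚ Perm.flip ρ) (blocks C))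
               (images-∘ π (Perm.flip ρ) (images ρ (blocks C))) ⟩
    images (Perm.flip ρ) (images π (images ρ (blocks C)))
      ≈⟨ images-cong (Perm.flip ρ) (images-cong π isomorphism) ⟩
    images (Perm.flip ρ) (images π S)                   ≈⟨ images-cong (Perm.flip ρ) stable ⟩
    images (Perm.flip ρ) S                              ≈⟨ images-swap ρ isomorphism ⟨
    blocks C                                                   ∎
    where open SetEqReasoning

  stabiliserAt : (i : Fin (length (candidates S))) → Stabiliser S (List.lookup (candidates S) i)
  stabiliserAt i = stabiliser unique (List.lookup (candidates S) i) 
    (All.lookup (all-true (preserves S ∘ inverse) (candidates S) checked) (∈-lookup i))

  automorphism : Fin (length (candidates S)) → Automorphism C
  automorphism i = let π , _ , stable = stabiliserAt i in conjugate π , conjugate-stable π stable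

  automorphism-injective : ∀ i j → perm (automorphism i) Perm.≈ perm (automorphism j) → i ≡ j
  automorphism-injective i j eq = lookup-injective (decSetoid _≟ᵥ_) (embeddings-unique (codegrees S) (Vec.allFin _)) i j
    (Pointwise-≡⇒≡ (ext λ x → begin
      lookup (List.lookup (candidates S) i) x   ≡⟨ proj₁ (proj₂ (stabiliserAt i)) x ⟨
      π ⟨$⟩ʳ x                              ≡⟨ cong (π ⟨$⟩ʳ_) (inverseʳ ρ) ⟨
      π ⟨$⟩ʳ (ρ ⟨$⟩ʳ (ρ ⟨$⟩ˡ x))            ≡⟨ inverseʳ ρ ⟨
      -- Evaluation at the preimage of `x` under `ρ` undoes the conjugation.
      ρ ⟨$⟩ʳ (conjugate π ⟨$⟩ʳ (ρ ⟨$⟩ˡ x))  ≡⟨ cong (ρ ⟨$⟩ʳ_) (eq (ρ ⟨$⟩ˡ x)) ⟩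
      ρ ⟨$⟩ʳ (conjugate σ ⟨$⟩ʳ (ρ ⟨$⟩ˡ x))  ≡⟨ inverseʳ ρ ⟩
      σ ⟨$⟩ʳ (ρ ⟨$⟩ʳ (ρ ⟨$⟩ˡ x))            ≡⟨ cong (σ ⟨$⟩ʳ_) (inverseʳ ρ) ⟩
      σ ⟨$⟩ʳ x                              ≡⟨ proj₁ (proj₂ (stabiliserAt j)) x ⟩
      lookup (List.lookup (candidates S) j) x   ∎))
    where
    open ≡-Reasoning
    _≟ᵥ_ = ≡-dec {n = suc n} (_≟_ {n = suc n})
    π = proj₁ (stabiliserAt i)
    σ = proj₁ (stabiliserAt j)

  automorphism-surjective : ∀ (a : Automorphism C) → ∃ λ i → perm (automorphism i) Perm.≈ perm a
  automorphism-surjective (σ , stable) = i , λ x → begin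
    ρ ⟨$⟩ˡ (π ⟨$⟩ʳ (ρ ⟨$⟩ʳ x))              ≡⟨ cong (ρ ⟨$⟩ˡ_) (π≈τ (ρ ⟨$⟩ʳ x)) ⟩
    ρ ⟨$⟩ˡ (τ ⟨$⟩ʳ (ρ ⟨$⟩ʳ x))              ≡⟨ inverseˡ ρ ⟩
    σ ⟨$⟩ʳ (ρ ⟨$⟩ˡ (ρ ⟨$⟩ʳ x))              ≡⟨ cong (σ ⟨$⟩ʳ_) (inverseˡ ρ) ⟩
    σ ⟨$⟩ʳ x                                ∎
    where
    -- Transported to `S`, the given automorphism has its table of values among the candidates, and
    -- the position there is the index sought.
    τ = Perm.flip ρ ∘ₚ σ ∘ₚ ρ
    τ-stable : images τ S ∼[ set ] S
    τ-stable = begin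
      images τ S
        ≡⟨ trans (images-∘ (Perm.flip ρ) (σ ∘ₚ ρ) S) (images-∘ σ ρ (images (Perm.flip ρ) S)) ⟩
      images ρ (images σ (images (Perm.flip ρ) S))
        ≈⟨ images-cong ρ (images-cong σ (images-swap ρ isomorphism)) ⟨
      images ρ (images σ (blocks C))                       ≈⟨ images-cong ρ stable ⟩
      images ρ (blocks C)                                  ≈⟨ isomorphism ⟩
      S                                             ∎
      where open SetEqReasoning
    τ∈ = ∈-candidates unique τ τ-stable
    i = Any.index τ∈
    π = proj₁ (stabiliserAt i)
    open ≡-Reasoning
    π≈τ : π Perm.≈ τ
    π≈τ x = begin
      π ⟨$⟩ʳ x                                       ≡⟨ proj₁ (proj₂ (stabiliserAt i)) x ⟩
      lookup (List.lookup (candidates S) i) x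
        ≡⟨ cong (λ f → lookup f x) (Any.lookup-index τ∈) ⟨
      lookup (Vec.map (τ ⟨$⟩ʳ_) (Vec.allFin (suc n))) x
        ≡⟨ lookup-map x (τ ⟨$⟩ʳ_) (Vec.allFin (suc n)) ⟩
      τ ⟨$⟩ʳ lookup (Vec.allFin (suc n)) x                ≡⟨ cong (τ ⟨$⟩ʳ_) (lookup-allFin x) ⟩
      τ ⟨$⟩ʳ x                                       ∎

  automorphism-count : ∀ {m} → length (candidates S) ≡ m → HasOrder (Aut C) m
  automorphism-count len = subst (HasOrder (Aut C)) len
    (bijection (Group.setoid (Aut C)) automorphism (λ {i} {j} → automorphism-injective i j) automorphism-surjective)

candidates-preserve : AllPreserve standard ≡ true
candidates-preserve = refl

-- Only `∞` has degree ten, so it is fixed. Codegree three occurs exactly between points of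
-- different quintuples that are not partners: a complete bipartite graph on 5 + 5 points without a
-- perfect matching. Its group has order 2 · 5!, from the permutations of the five pairs and the
-- exchange of the quintuples.
candidates-length : length (candidates standard) ≡ 240
candidates-length = refl

automorphism-group-order : ∀ (C : Covering 3 11 5) → Standard (blocks C) → HasOrder (Aut C) 240
automorphism-group-order C (ρ , iso) =
  automorphism-count {S = standard} standard-unique candidates-preserve C ρ iso candidates-length

-- Images of coverings and the labelled count

covering⇒cover : (C : Covering 3 11 5) → length (blocks C) ≡ 20 → IsCover (blocks C)
covering⇒cover C len = len , uniform C , λ {x} {y} {z} xyz →
  Any.map (λ xyz⊆B → xyz⊆B (x∈p∪q⁺ (inj₁ (x∈⁅x⁆ x)))
                   , xyz⊆B (x∈p∪q⁺ (inj₂ (x∈p∪q⁺ (inj₁ (x∈⁅x⁆ y)))))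
                   , xyz⊆B (x∈p∪q⁺ {p = ⁅ x ⁆} (inj₂ (x∈p∪q⁺ {p = ⁅ y ⁆} (inj₂ (x∈⁅x⁆ z))))))
          (covers C (⁅ x ⁆ ∪ ⁅ y ⁆ ∪ ⁅ z ⁆) (∣triple∣ xyz))

image-⊆ : (π : Permutation′ n) {p q : Subset n} → image (Perm.flip π) p ⊆ q → p ⊆ image π q
image-⊆ π {p} sub {x} x∈p = ∈-image⁺ π (sub (∈-image⁺ (Perm.flip π) (subst (_∈ p) (sym (inverseʳ π)) x∈p)))

imageCovering : Permutation′ n → Covering t n k → Covering t n k
imageCovering π C = record
  { blocks   = images π (blocks C)
  ; distinct = Unique.map⁺ (image-injective π) (distinct C)
  ; uniform  = uniform-images π (uniform C)
  ; covers   = λ T ∣T∣≡t → Any.map⁺ (Any.map (image-⊆ π)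
      (covers C (image (Perm.flip π) T) (trans (∣image∣ (Perm.flip π) T) ∣T∣≡t)))
  }

-- Decidable equality of coverings is what allows `finite-image` to delete repetitions.
coveringDecSetoid : (t n k b : ℕ) → DecSetoid 0ℓ 0ℓ
coveringDecSetoid t n k b = record
  { isDecEquivalence = record
    { isEquivalence = Setoid.isEquivalence (coveringSetoid t n k b)
    ; _≟_ = λ (C , _) (D , _) → same? (blocks C) (blocks D)
    }
  }
  where
  same? : (Bs Cs : List (Subset n)) → Dec (Bs ∼[ set ] Cs)
  same? Bs Cs = map′
    (λ (Bs⊆Cs , Cs⊆Bs) → mk⇔ (All.lookup Bs⊆Cs) (All.lookup Cs⊆Bs))
    (λ same → All.tabulate (Equivalence.to same) , All.tabulate (Equivalence.from same))
    (All.all? (_∈ₗ? Cs) Bs ×-dec All.all? (_∈ₗ? Bs) Cs)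

-- The labelled coverings form one orbit

labelled-count : ∀ {b m q} .{{_ : NonZero m}} (C : Covering t n k) (len : length (blocks C) ≡ b) →
  (∀ (D : CoveringOfSize t n k b) → C ≅ proj₁ D) → HasOrder (Aut C) m → n ! ≡ q * m →
  HasCardinality (coveringSetoid t n k b) q
labelled-count {t} {n} {k} {b} {m} C len unique order n!≡qm =
  quotient-count (permutationSetoid n) (coveringDecSetoid t n k b) (permutation-count n) n!≡qm
    orbit
    (λ {π} {ρ} π≈ρ → SetEq.reflexive (images-≈ {π = π} {ρ} π≈ρ (blocks C)))
    -- The automorphism acts before `π`, so the image of `C` stays the same: the fibres of the orbit
    -- map are cosets of the automorphism group.
    (λ i π → perm (to i) ∘ₚ π)
    (λ i π → SetEq.trans (SetEq.reflexive (images-∘ (perm (to i)) π (blocks C)))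
                         (images-cong π (stabilises (to i))))
    (λ π eq → to-injective λ x → trans (sym (inverseˡ π)) (trans (cong (π ⟨$⟩ˡ_) (eq x)) (inverseˡ π)))
    (λ π ρ eq → let a = ρ ∘ₚ Perm.flip π , transporter π ρ eq in
       index a , λ x → trans (cong (π ⟨$⟩ʳ_) (to-index a x)) (inverseʳ π))
    unique
  where
  open Count (Group.setoid (Aut C)) order
  orbit : Permutation′ n → CoveringOfSize t n k b
  orbit π = imageCovering π C , trans (length-map (image π) (blocks C)) len
  transporter : ∀ π ρ → images π (blocks C) ∼[ set ] images ρ (blocks C) →
                images (ρ ∘ₚ Perm.flip π) (blocks C) ∼[ set ] blocks C
  transporter π ρ eq = SetEq.trans (SetEq.reflexive (images-∘ ρ (Perm.flip π) (blocks C)))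
    (SetEq.sym (images-swap π eq))

-- The standard covering and the theorem

standard-covers : All (λ T → Any (T ⊆_) standard) (extensions 3 ∅)
-- All 165 triples are tested.
standard-covers = witness (All.all? (λ T → Any.any? (T ⊆?_) standard) (extensions 3 ∅)) refl

standardCovering : Covering 3 11 5
standardCovering = record
  { blocks   = standard
  ; distinct = standard-unique
  ; uniform  = witness (All.all? (λ B → ∣ B ∣ ℕ.≟ 5) standard) refl
  ; covers   = λ T ∣T∣≡3 → All.lookup standard-covers
      (∈-extensions 3 ∅ T ⊥⊆ (trans ∣T∣≡3 (cong (_+ 3) (sym (∣⊥∣≡0 11)))))
  }

standard≅ : ∀ (C : Covering 3 11 5) → length (blocks C) ≡ 20 → standardCovering ≅ C
standard≅ C len = let ρ , iso = cover⇒standard (covering⇒cover C len) in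
  Perm.flip ρ , SetEq.sym (images-swap ρ iso)

proposition15 : ∃! _≅_ (λ (C : Covering 3 11 5) → length (blocks C) ≡ 20)
    × (∀ (C : Covering 3 11 5) → length (blocks C) ≡ 20 → HasOrder (Aut C) 240)
    × HasCardinality (coveringSetoid 3 11 5 20) 166320
proposition15 =
    (standardCovering , refl , λ {C} len → standard≅ C len)
  , order
  -- The last `refl` evaluates 11! = 166320 · 240.
  , labelled-count standardCovering refl (λ (C , len) → standard≅ C len) (order standardCovering refl) refl
  where
  order : ∀ (C : Covering 3 11 5) → length (blocks C) ≡ 20 → HasOrder (Aut C) 240
  order C len = automorphism-group-order C (cover⇒standard (covering⇒cover C len))
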